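{- Let $m$ be a positive integer and let $(K,\partial_0,\dots,\partial_{m-1})$ be a field with $m$ commuting derivations. Let $\mu\in\mathbb{N}^m$ and let $n$ be a positive integer, and suppose $K$ has a field extension $K(a_h^{\xi}\colon|\xi|\le|\mu|\land h<n)$ that meets the differential condition, and such that $\sigma\le\mu$ whenever $a_k^{\sigma}$ is a minimal separable leader. Then $(K,\partial_0,\dots,\partial_{m-1})$ has an extension $(M,D_0,\dots,D_{m-1})$ (a field $M\supseteq K$ with $m$ commuting derivations extending the $\partial_i$) compatible with $K(a_h^{\xi}\colon|\xi|<|\mu|\land h<n)$, i.e. $K(a_h^{\xi}\colon|\xi|<|\mu|\land h<n)\subseteq M$ and $D_ia_k^{\sigma}=a_k^{\sigma+\varepsilon_i}$ whenever $i<m$, $k<n$ and $|\sigma|+1<|\mu|$.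
   Context: $n$ denotes also $\{0,\dots,n-1\}$. For $\sigma\in\mathbb{N}^m$, $|\sigma|=\sum_{i<m}\sigma(i)$; $\le$ is the componentwise order on $\mathbb{N}^m$; $\varepsilon_i$ is the characteristic function of $\{i\}$ in $\mathbb{N}^m$. The total order $\unlhd$ on $\mathbb{N}^m\times n$: $(\xi,k)\unlhd(\eta,g)$ iff $(|\xi|,k,\xi(0),\dots,\xi(m-2))$ is lexicographically $\le(|\eta|,g,\eta(0),\dots,\eta(m-2))$; $\lhd$ is the strict version. The extension meets the differential condition if: whenever $i<m$, $k<n$, $|\sigma|+1\le|\mu|$, and $f$ is a polynomial over $K$ in variables $(x_h^{\xi}\colon(\xi,h)\unlhd(\sigma,k))$ vanishing at $a=(a_h^{\xi}\colon(\xi,h)\unlhd(\sigma,k))$, then $\sum_{(\eta,g)\unlhd(\sigma,k)}\frac{\partial f}{\partial x_g^{\eta}}(a)\,a_g^{\eta+\varepsilon_i}+f^{\partial_i}(a)=0$, with $f^{\partial_i}$ being $f$ with $\partial_i$ applied to its coefficients. A generator $a_k^{\sigma}$ is a separable leader if it is separably algebraic over $K(a_h^{\xi}\colon(\xi,h)\lhd(\sigma,k))$, and a minimal separable leader if in addition no $a_k^{\rho}$ with $\rho\le\sigma$, $\rho\ne\sigma$, is a separable leader. -}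

module Defs where

open import Algebra.Apartness.Bundles using (HeytingField; HeytingCommutativeRing)
open import Algebra.Bundles using (CommutativeRing)
open import Algebra.Bundles.Raw using (RawRing)
open import Algebra.Core using (Op₁)
open import Algebra.Morphism.Bundles using (RingHomomorphism)
open import Data.Bool.Base using (if_then_else_)
open import Data.Fin.Base as Fin using (Fin; toℕ)
import Data.Fin.Properties as Fin
open import Data.List.Base as List
  using (List; []; _∷_; _++_; _∷ʳ_; length; map; concatMap; foldr; filter; upTo; allFin; cartesianProduct; cartesianProductWith)
open import Data.List.Relation.Unary.All using (All)
open import Data.Nat.Base as ℕ using (ℕ; zero; suc; _<_; _≤_)
import Data.Nat.Properties as ℕ
open import Data.Product.Base using (Σ; ∃-syntax; _×_; _,_; proj₁; proj₂)
open import Data.Product.Properties using (≡-dec)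
open import Data.Vec.Base as Vec using (Vec; []; _∷_; init; sum; updateAt)
import Data.Vec.Properties as Vec
open import Data.Vec.Relation.Binary.Lex.Strict as Lex using (Lex-<; Lex-≤)
open import Data.Vec.Relation.Binary.Pointwise.Inductive using (Pointwise)
open import Level using (Level; 0ℓ; _⊔_) renaming (suc to lsuc)
open import Relation.Binary.Core using (Rel)
open import Relation.Binary.Definitions using (Decidable; DecidableEquality)
open import Relation.Binary.PropositionalEquality.Core using (_≡_; _≢_; refl; sym; trans; cong; subst)
open import Relation.Nullary.Decidable.Core using (does)
open import Relation.Nullary.Negation.Core using (¬_)
open import Relation.Unary using (Pred)

∣_∣ : ∀ {m} → Vec ℕ m → ℕ
∣ σ ∣ = sum σ

infix 4 _≤ᵥ_
_≤ᵥ_ : ∀ {m} → Rel (Vec ℕ m) 0ℓ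
_≤ᵥ_ = Pointwise _≤_

infixl 6 _+ε_
_+ε_ : ∀ {m} → Vec ℕ m → Fin m → Vec ℕ m
σ +ε i = updateAt σ i suc

∣+ε∣ : ∀ {m} (σ : Vec ℕ m) i → ∣ σ +ε i ∣ ≡ suc ∣ σ ∣
∣+ε∣ (x ∷ σ) Fin.zero    = refl
∣+ε∣ (x ∷ σ) (Fin.suc i) = trans (cong (x ℕ.+_) (∣+ε∣ σ i)) (ℕ.+-suc x ∣ σ ∣)

Index : ℕ → ℕ → Set
Index m n = Vec ℕ m × Fin n

_≟ᵢ_ : ∀ {m n} → DecidableEquality (Index m n)
_≟ᵢ_ = ≡-dec (Vec.≡-dec ℕ._≟_) Fin._≟_

degree : ∀ {m n} → Index m n → ℕ
degree (ξ , _) = ∣ ξ ∣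

-- The last entry of ξ is omitted: it is determined by ∣ ξ ∣ and the others.
key : ∀ {m n} → Index (suc m) n → Vec ℕ (suc (suc m))
key (ξ , k) = ∣ ξ ∣ ∷ toℕ k ∷ init ξ

infix 4 _⊴_ _⊲_ _⊴?_
_⊴_ _⊲_ : ∀ {m n} → Rel (Index (suc m) n) 0ℓ
v ⊴ w = Lex-≤ _≡_ _<_ (key v) (key w)
v ⊲ w = Lex-< _≡_ _<_ (key v) (key w)

_⊴?_ : ∀ {m n} → Decidable (_⊴_ {m} {n})
v ⊴? w = Lex.≤-dec ℕ._≟_ ℕ._<?_ (key v) (key w)

-- All exponents with every entry at most r, each listed once.
box : ∀ m → ℕ → List (Vec ℕ m)
box zero    r = [] ∷ []
box (suc m) r = cartesianProductWith _∷_ (upTo (suc r)) (box m r)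

-- All indices v ⊴ w, each listed once: v ⊴ w forces degree v ≤ degree w,
-- so the entries of v are at most degree w.
below : ∀ {m n} → Index (suc m) n → List (Index (suc m) n)
below {m} {n} w = filter (_⊴? w) (cartesianProduct (box (suc m) (degree w)) (allFin n))

-- Under excluded middle a Heyting field is the same thing as a field,
-- its apartness relation being inequality.
module Field {c ℓ₁ ℓ₂} (F : HeytingField c ℓ₁ ℓ₂) where
  open HeytingField F using (heytingCommutativeRing)
  open CommutativeRing (HeytingCommutativeRing.commutativeRing heytingCommutativeRing) public

record IsDerivation {c ℓ₁ ℓ₂} (F : HeytingField c ℓ₁ ℓ₂) (D : Op₁ (Field.Carrier F)) : Set (c ⊔ ℓ₁) where
  open Field F
  field
    D-cong : ∀ {x y} → x ≈ y → D x ≈ D y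
    D-+    : ∀ x y → D (x + y) ≈ D x + D y
    D-*    : ∀ x y → D (x * y) ≈ D x * y + x * D y

record DifferentialField c ℓ₁ ℓ₂ (m : ℕ) : Set (lsuc (c ⊔ ℓ₁ ⊔ ℓ₂)) where
  field
    heytingField : HeytingField c ℓ₁ ℓ₂
  open Field heytingField public
  field
    ∂            : Fin m → Op₁ Carrier
    isDerivation : ∀ i → IsDerivation heytingField (∂ i)
    ∂-comm       : ∀ i j x → ∂ i (∂ j x) ≈ ∂ j (∂ i x)

-- A polynomial is a formal finite sum of terms c · v₁ ⋯ vᵣ with the variables
-- listed with multiplicity; neither the order of the factors nor that of the
-- terms matters, and like terms need not be collected.
Polynomial : ∀ {c} → Set c → Set → Set c
Polynomial C V = List (C × List V)

VariablesIn : ∀ {c} {C : Set c} {V : Set} → Pred V 0ℓ → Polynomial C V → Set c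
VariablesIn P = All (λ t → All P (proj₂ t))

mapCoefficients : ∀ {c} {C : Set c} {V : Set} → (C → C) → Polynomial C V → Polynomial C V
mapCoefficients d = map (λ (c , w) → d c , w)

module _ {V : Set} (_≟_ : DecidableEquality V) where

  -- One monomial for each occurrence of v in w, with that occurrence deleted.
  removals : V → List V → List (List V)
  removals v []      = []
  removals v (u ∷ w) = (if does (u ≟ v) then w ∷ [] else []) ++ map (u ∷_) (removals v w)

  partial : ∀ {c} {C : Set c} → V → Polynomial C V → Polynomial C V
  partial v = concatMap (λ (c , w) → map (c ,_) (removals v w))

module Evaluation {c ℓ} (R : RawRing c ℓ) {c′} {C : Set c′} {V : Set}
                  (ι : C → RawRing.Carrier R) (a : V → RawRing.Carrier R) where
  open RawRing R

  term : C × List V → Carrier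
  term (c , w) = ι c * foldr (λ v x → a v * x) 1# w

  eval : Polynomial C V → Carrier
  eval f = foldr (λ t x → term t + x) 0# f

-- Lists of coefficients, constant term first, possibly with trailing zeros.
module Univariate {c ℓ} (R : RawRing c ℓ) where
  open RawRing R

  coefficient : List Carrier → ℕ → Carrier
  coefficient []      _       = 0#
  coefficient (c ∷ f) zero    = c
  coefficient (c ∷ f) (suc d) = coefficient f d

  infix  4 _≋_
  infixl 6 _⊕_
  infixl 7 _⊗_

  _≋_ : Rel (List Carrier) ℓ
  f ≋ g = ∀ d → coefficient f d ≈ coefficient g d

  _⊕_ : List Carrier → List Carrier → List Carrier
  []      ⊕ g       = g
  (c ∷ f) ⊕ []      = c ∷ f
  (c ∷ f) ⊕ (d ∷ g) = c + d ∷ f ⊕ g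

  _⊗_ : List Carrier → List Carrier → List Carrier
  []      ⊗ g = []
  (c ∷ f) ⊗ g = map (c *_) g ⊕ (0# ∷ f ⊗ g)

  -- (c + X f)′ = f + X f′
  derivative : List Carrier → List Carrier
  derivative []      = []
  derivative (c ∷ f) = f ⊕ (0# ∷ derivative f)

  Monic : List Carrier → Set c
  Monic f = ∃[ g ] f ≡ g ∷ʳ 1#

  RelativelyPrime : List Carrier → List Carrier → Set (c ⊔ ℓ)
  RelativelyPrime f g = ∃[ u ] ∃[ v ] u ⊗ f ⊕ v ⊗ g ≋ 1# ∷ []

  Separable : List Carrier → Set (c ⊔ ℓ)
  Separable f = RelativelyPrime f (derivative f)

module _ {c ℓ c′ ℓ′} (F : RawRing c ℓ) (L : RawRing c′ ℓ′) (ι : RawRing.Carrier F → RawRing.Carrier L) where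
  private
    module F = RawRing F
    module L = RawRing L
  open Univariate F

  evalAt : L.Carrier → List F.Carrier → L.Carrier
  evalAt x []      = L.0#
  evalAt x (c ∷ f) = ι c L.+ x L.* evalAt x f

  record IsMinimalPolynomial (x : L.Carrier) (f : List F.Carrier) : Set (c ⊔ ℓ ⊔ ℓ′) where
    field
      monic   : Monic f
      root    : evalAt x f L.≈ L.0#
      -- A list shorter than the monic list f is a polynomial of smaller degree.
      minimal : ∀ g → length g < length f → evalAt x g L.≈ L.0# → All (F._≈ F.0#) g

  SeparablyAlgebraic : L.Carrier → Set (c ⊔ ℓ ⊔ ℓ′)
  SeparablyAlgebraic x = ∃[ f ] IsMinimalPolynomial x f × Separable f

module _ {c ℓ₁ ℓ₂ c′ ℓ₁′ ℓ₂′} (K : HeytingField c ℓ₁ ℓ₂) (L : HeytingField c′ ℓ₁′ ℓ₂′)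
         (ι : Field.Carrier K → Field.Carrier L) {V : Set} (a : V → Field.Carrier L) where
  private
    module K = Field K
  open Field L

  -- The least subfield of L containing K and the a v with P v.
  data Generated (P : Pred V 0ℓ) : Pred Carrier (c ⊔ c′ ⊔ ℓ₁′) where
    base : ∀ x → Generated P (ι x)
    gen  : ∀ v → P v → Generated P (a v)
    add  : ∀ {x y} → Generated P x → Generated P y → Generated P (x + y)
    mul  : ∀ {x y} → Generated P x → Generated P y → Generated P (x * y)
    neg  : ∀ {x} → Generated P x → Generated P (- x)
    zer  : Generated P 0#
    one  : Generated P 1#
    inv  : ∀ {x y} → Generated P x → x * y ≈ 1# → Generated P y
    resp : ∀ {x y} → x ≈ y → Generated P x → Generated P y

  adjoin : Pred V 0ℓ → RawRing (c ⊔ c′ ⊔ ℓ₁′) ℓ₁′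
  adjoin P = record
    { Carrier = Σ Carrier (Generated P)
    ; _≈_     = λ x y → proj₁ x ≈ proj₁ y
    ; _+_     = λ x y → proj₁ x + proj₁ y , add (proj₂ x) (proj₂ y)
    ; _*_     = λ x y → proj₁ x * proj₁ y , mul (proj₂ x) (proj₂ y)
    ; -_      = λ x → - proj₁ x , neg (proj₂ x)
    ; 0#      = 0# , zer
    ; 1#      = 1# , one
    }

-- The field K(a_h^ξ : ∣ξ∣ ≤ r, h < n).  The family a is total only for
-- convenience: its values at indices of degree greater than r are never used.
record Extension {c ℓ₁ ℓ₂ m} (K : DifferentialField c ℓ₁ ℓ₂ (suc m)) (n r : ℕ) : Set (lsuc (c ⊔ ℓ₁ ⊔ ℓ₂)) where
  private
    module K = DifferentialField K
  field
    L : HeytingField c ℓ₁ ℓ₂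
  private
    module L = Field L
  field
    ιHom : RingHomomorphism K.rawRing L.rawRing
    a    : Index (suc m) n → L.Carrier
  open RingHomomorphism ιHom public using () renaming (⟦_⟧ to ι)
  field
    generates : ∀ x → Generated K.heytingField L ι a (λ v → degree v ≤ r) x

  K⟮_⟯ : Pred (Index (suc m) n) 0ℓ → RawRing (c ⊔ ℓ₁) ℓ₁
  K⟮ P ⟯ = adjoin K.heytingField L ι a P

  open Evaluation L.rawRing ι a public

  DifferentialCondition : Set (c ⊔ ℓ₁)
  DifferentialCondition =
    ∀ (i : Fin (suc m)) (k : Fin n) (σ : Vec ℕ (suc m)) → suc ∣ σ ∣ ≤ r →
    ∀ (f : Polynomial K.Carrier (Index (suc m) n)) → VariablesIn (_⊴ (σ , k)) f →
    eval f L.≈ L.0# →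
    foldr L._+_ L.0#
      (map (λ (η , g) → eval (partial _≟ᵢ_ (η , g) f) L.* a (η +ε i , g)) (below (σ , k)))
      L.+ eval (mapCoefficients (K.∂ i) f)
    L.≈ L.0#

  SeparableLeader : Pred (Index (suc m) n) (c ⊔ ℓ₁)
  SeparableLeader v =
    degree v ≤ r × SeparablyAlgebraic K⟮ _⊲ v ⟯ L.rawRing proj₁ (a v)

  MinimalSeparableLeader : Pred (Index (suc m) n) (c ⊔ ℓ₁)
  MinimalSeparableLeader (σ , k) =
    SeparableLeader (σ , k) ×
    (∀ ρ → ρ ≤ᵥ σ → ρ ≢ σ → ¬ SeparableLeader (ρ , k))

-- Differential field extensions of K compatible with K(a_h^ξ : ∣ξ∣ < r, h < n).
-- The inclusion of that field in M is an embedding φ over K.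
record CompatibleExtension {c ℓ₁ ℓ₂ m n r} (K : DifferentialField c ℓ₁ ℓ₂ (suc m))
                           (E : Extension K n r) : Set (lsuc (c ⊔ ℓ₁ ⊔ ℓ₂)) where
  private
    module K = DifferentialField K
  open Extension E using (ι; a; K⟮_⟯)

  private
    K⟮a⟯ = K⟮ (λ v → degree v < r) ⟯

  generator : ∀ v → degree v < r → RawRing.Carrier K⟮a⟯
  generator v p = a v , gen v p

  field
    M    : DifferentialField (c ⊔ ℓ₁ ⊔ ℓ₂) (c ⊔ ℓ₁ ⊔ ℓ₂) (c ⊔ ℓ₁ ⊔ ℓ₂) (suc m)
  private
    module M = DifferentialField M
  field
    jHom : RingHomomorphism K.rawRing M.rawRing
    φHom : RingHomomorphism K⟮a⟯ M.rawRing
  open RingHomomorphism jHom public using () renaming (⟦_⟧ to j)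
  open RingHomomorphism φHom public using () renaming (⟦_⟧ to φ)
  field
    extends    : ∀ i x → M.∂ i (j x) M.≈ j (K.∂ i x)
    over-K     : ∀ x → φ (ι x , base x) M.≈ j x
    compatible : ∀ i k σ (p : suc ∣ σ ∣ < r) →
      M.∂ i (φ (generator (σ , k) (ℕ.<-trans (ℕ.n<1+n ∣ σ ∣) p)))
        M.≈ φ (generator (σ +ε i , k) (subst (_< r) (sym (∣+ε∣ σ i)) p))

{-# OPTIONS --safe #-}
module Submission where

-- Let r = ∣ μ ∣.  In the ring of differential polynomials over K the derivations D i commute, so it is
-- enough to find a prime ideal closed under them that contains f exactly when f(a) = 0, for f of order
-- below r; then M is the fraction field of the quotient.  The ideal is the kernel of an evaluation at
-- a family b in a polynomial ring over L, built along ⊲.  Below degree r it agrees with a.  In degree r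
-- a generator is new unless a there is a linear combination of 1 and smaller generators of degree r
-- over the field generated in lower degrees, in which case b is the same combination; as the
-- differential condition only yields relations of this affine kind, they survive the passage from a to b.
-- Above degree r, an index w has an entry w(h) > μ(h), and b at w is new or is obtained by applying
-- D h to the linear equation of b at w − ε(h).  All minimal leaders are ≤ μ, so those ≤ w are also
-- ≤ w − ε(h).  Hence another way to reach w, from w − ε(i), passes through a leader at or below
-- w − ε(i) − ε(h), and the two agree because D i and D h commute on the equation of that leader.

open import Defs
open import Axiom.ExcludedMiddle using (ExcludedMiddle)
open import Data.Fin.Base using (Fin)
open import Data.Nat.Base using (ℕ; suc; NonZero)
open import Data.Product.Base using (_,_)
open import Data.Vec.Base using (Vec)

open import Algebra.Apartness.Bundles using (HeytingField; HeytingCommutativeRing)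
open import Algebra.Bundles using (CommutativeRing; RawRing)
open import Algebra.Core using (Op₁; Op₂)
import Algebra.Definitions
open import Algebra.Morphism.Bundles using (RingHomomorphism)
import Algebra.Morphism.Construct.Composition as Composition
open import Algebra.Structures using (IsCommutativeRing)
open import Data.Bool.Base using (true; false; if_then_else_)
open import Data.Empty using (⊥; ⊥-elim)
open import Data.Fin.Base as Fin using (toℕ)
import Data.Fin.Properties as Fin
open import Data.List.Base using (List; []; _∷_; _++_; map; foldr; cartesianProductWith)
open import Data.List.Membership.Propositional using (_∈_)
open import Data.List.Membership.Propositional.Properties
  using (∈-cartesianProductWith⁺; ∈-cartesianProduct⁺; ∈-filter⁺; ∈-allFin; ∈-upTo⁺)
open import Data.List.Relation.Unary.All as All using (All; []; _∷_)
import Data.List.Relation.Unary.All.Properties as All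
open import Data.List.Relation.Unary.AllPairs using ([]; _∷_)
open import Data.List.Relation.Unary.Any using (here; there)
open import Data.List.Relation.Unary.Unique.Propositional using (Unique)
import Data.List.Relation.Unary.Unique.Propositional.Properties as Unique
open import Data.Maybe.Base using (Maybe; just; nothing)
open import Data.Nat.Base as ℕ using (zero; _<_; _≤_; z≤n; s≤s)
import Data.Nat.Properties as ℕ
open import Data.Product.Base using (Σ; ∃-syntax; _×_; proj₁; proj₂)
open import Data.Sum.Base using (_⊎_; inj₁; inj₂; [_,_]′)
open import Data.Unit.Base using (⊤; tt)
open import Data.Vec.Base as Vec using ([]; _∷_; init; lookup)
open import Data.Vec.Properties using (∷-injective; lookup∘updateAt′)
open import Data.Vec.Relation.Binary.Lex.Strict as Lex using (Lex-<; base; this; next)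
open import Data.Vec.Relation.Binary.Pointwise.Inductive as Pointwise using ([]; _∷_; Pointwise-≡⇒≡)
open import Function.Base using (_∘_; id)
open import Level using (Level; _⊔_; 0ℓ) renaming (suc to lsuc)
open import Relation.Binary.Core using (Rel)
open import Relation.Binary.Definitions using (tri<; tri≈; tri>)
open import Relation.Binary.PropositionalEquality.Core as ≡ using (_≡_; _≢_)
open import Relation.Binary.Structures using (IsEquivalence)
open import Relation.Nullary.Decidable.Core using (Dec; does; yes; no)
open import Relation.Nullary.Negation.Core using (¬_)
open import Relation.Unary using (Pred)

-- The differential condition speaks only of relations of order below `r`, so nothing is known about
-- the derivatives of a relation that involves generators of degree `r`. In positive characteristic
-- such a relation may be inseparable, and then its derivative does not even contain the derivative
-- of the leader. As compatibility is asked only below degree `r`, these relations can be given up,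
-- except for the affine ones: they include all derivatives of relations of order below `r`. A
-- linear equation can be differentiated again and again with the same leading coefficient. That
-- coefficient has order below `r`, so it is inverted in `L` itself; every stage stays a polynomial
-- ring over the previous one, and primality of the kernel comes for free. Closure under `D i` means
-- that vanishing expressions also vanish as dual numbers `e + ε D i e`. This is extended by one
-- generator at a time. The induction treats all derivations together, because the comparison of two
-- ways to reach an index plays `D i` against `D h`.

-- A ring solver with integer coefficients.

module IntegerSolver {c ℓ} (R : CommutativeRing c ℓ) where
  open import Algebra.Solver.Ring.AlmostCommutativeRing
    using (fromCommutativeRing; _-Raw-AlmostCommutative⟶_)
  open import Data.Integer.Base as ℤ using (ℤ; +-*-rawRing; +_; -[1+_]; _⊖_; _◃_; sign)
  open import Data.Integer.Properties as ℤₚ using ([1+m]⊖[1+n]≡m⊖n)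
  open import Data.Nat.Base as ℕ using (ℕ; zero; suc)
  import Data.Nat.Properties as ℕₚ
  open import Data.Sign.Base as Sign using (Sign)
  open CommutativeRing R
  open import Algebra.Properties.Ring ring using (-‿distribˡ-*; -‿distribʳ-*; -0#≈0#; -‿involutive)
  open import Algebra.Properties.AbelianGroup +-abelianGroup using (⁻¹-∙-comm)
  open import Algebra.Properties.Semiring.Mult.TCOptimised semiring using (×-homo-+; 1+×; ×1-homo-*) renaming (_×_ to _·_)
  open import Relation.Binary.Reasoning.Setoid setoid

  private
    ⟦_⟧ : ℤ → Carrier
    ⟦ + n ⟧      = n · 1#
    ⟦ -[1+ n ] ⟧ = - (suc n · 1#)

    -‿homo : ∀ i → ⟦ ℤ.- i ⟧ ≈ - ⟦ i ⟧
    -‿homo (+ zero)   = sym -0#≈0#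
    -‿homo (+ suc n)  = refl
    -‿homo (-[1+ n ]) = sym (-‿involutive _)

    ⊖-homo : ∀ m n → ⟦ m ⊖ n ⟧ ≈ m · 1# - n · 1#
    ⊖-homo m zero = sym (trans (+-congˡ -0#≈0#) (+-identityʳ _))
    ⊖-homo zero (suc n) = sym (+-identityˡ _)
    ⊖-homo (suc m) (suc n) = begin
      ⟦ suc m ⊖ suc n ⟧                       ≡⟨ ≡.cong ⟦_⟧ (ℤₚ.[1+m]⊖[1+n]≡m⊖n m n) ⟩
      ⟦ m ⊖ n ⟧                               ≈⟨ ⊖-homo m n ⟩
      m · 1# - n · 1#                         ≈⟨ +-congʳ (+-identityʳ _) ⟨
      (m · 1# + 0#) - n · 1#                  ≈⟨ +-congʳ (+-congˡ (-‿inverseʳ 1#)) ⟨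
      (m · 1# + (1# - 1#)) - n · 1#           ≈⟨ +-congʳ (+-assoc _ _ _) ⟨
      ((m · 1# + 1#) - 1#) - n · 1#           ≈⟨ +-assoc _ _ _ ⟩
      (m · 1# + 1#) + (- 1# - n · 1#)         ≈⟨ +-cong (+-comm _ _) (⁻¹-∙-comm _ _) ⟩
      (1# + m · 1#) - (1# + n · 1#)           ≈⟨ +-cong (1+× m 1#) (-‿cong (1+× n 1#)) ⟨
      suc m · 1# - suc n · 1#                 ∎

    +-homo : ∀ i j → ⟦ i ℤ.+ j ⟧ ≈ ⟦ i ⟧ + ⟦ j ⟧
    +-homo (+ m) (+ n) = ×-homo-+ 1# m n
    +-homo (+ m) -[1+ n ] = ⊖-homo m (suc n)
    +-homo -[1+ m ] (+ n) = trans (⊖-homo n (suc m)) (+-comm _ _)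
    +-homo -[1+ m ] -[1+ n ] = begin
      - (suc (suc (m ℕ.+ n)) · 1#)  ≡⟨ ≡.cong (λ k → - (k · 1#)) (≡.cong suc (ℕₚ.+-suc m n)) ⟨
      - ((suc m ℕ.+ suc n) · 1#)    ≈⟨ -‿cong (×-homo-+ 1# (suc m) (suc n)) ⟩
      - (suc m · 1# + suc n · 1#)   ≈⟨ ⁻¹-∙-comm _ _ ⟨
      - (suc m · 1#) - suc n · 1#   ∎

    signed : Sign → Carrier → Carrier
    signed Sign.+ x = x
    signed Sign.- x = - x

    ◃-homo : ∀ s n → ⟦ s ◃ n ⟧ ≈ signed s (n · 1#)
    ◃-homo Sign.+ zero    = refl
    ◃-homo Sign.- zero    = sym -0#≈0#
    ◃-homo Sign.+ (suc n) = refl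
    ◃-homo Sign.- (suc n) = refl

    signed-* : ∀ s t x y → signed (s Sign.* t) (x * y) ≈ signed s x * signed t y
    signed-* Sign.+ Sign.+ x y = refl
    signed-* Sign.+ Sign.- x y = -‿distribʳ-* x y
    signed-* Sign.- Sign.+ x y = -‿distribˡ-* x y
    signed-* Sign.- Sign.- x y =
      trans (sym (-‿involutive _)) (trans (-‿cong (-‿distribˡ-* x y)) (-‿distribʳ-* _ _))

    signed-∣∣ : ∀ i → signed (sign i) (ℤ.∣ i ∣ · 1#) ≈ ⟦ i ⟧
    signed-∣∣ (+ n)    = refl
    signed-∣∣ -[1+ n ] = refl

    signed-cong : ∀ s {x y} → x ≈ y → signed s x ≈ signed s y
    signed-cong Sign.+ p = p
    signed-cong Sign.- p = -‿cong p

    *-homo : ∀ i j → ⟦ i ℤ.* j ⟧ ≈ ⟦ i ⟧ * ⟦ j ⟧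
    *-homo i j = begin
      ⟦ sign i Sign.* sign j ◃ ℤ.∣ i ∣ ℕ.* ℤ.∣ j ∣ ⟧                      ≈⟨ ◃-homo (sign i Sign.* sign j) (ℤ.∣ i ∣ ℕ.* ℤ.∣ j ∣) ⟩
      signed (sign i Sign.* sign j) ((ℤ.∣ i ∣ ℕ.* ℤ.∣ j ∣) · 1#)          ≈⟨ signed-cong (sign i Sign.* sign j) (×1-homo-* ℤ.∣ i ∣ ℤ.∣ j ∣) ⟩
      signed (sign i Sign.* sign j) ((ℤ.∣ i ∣ · 1#) * (ℤ.∣ j ∣ · 1#))     ≈⟨ signed-* (sign i) (sign j) _ _ ⟩
      signed (sign i) (ℤ.∣ i ∣ · 1#) * signed (sign j) (ℤ.∣ j ∣ · 1#)     ≈⟨ *-cong (signed-∣∣ i) (signed-∣∣ j) ⟩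
      ⟦ i ⟧ * ⟦ j ⟧                                                   ∎

    morphism : +-*-rawRing -Raw-AlmostCommutative⟶ fromCommutativeRing R
    morphism = record
      { ⟦_⟧    = ⟦_⟧
      ; +-homo = +-homo
      ; *-homo = *-homo
      ; -‿homo = -‿homo
      ; 0-homo = refl
      ; 1-homo = refl
      }

    -- Distinct integers may have the same image in positive characteristic, so the test is sound
    -- but not complete.
    ≟-weak : ∀ i j → Maybe (⟦ i ⟧ ≈ ⟦ j ⟧)
    ≟-weak i j with i ℤₚ.≟ j
    ... | yes ≡.refl = just refl
    ... | no  _      = nothing

  open import Algebra.Solver.Ring +-*-rawRing (fromCommutativeRing R) morphism ≟-weak public
    using (solve; _:=_; _:+_; _:*_; _:-_; :-_) renaming (Polynomial to Term)
  open import Algebra.Solver.Ring +-*-rawRing (fromCommutativeRing R) morphism ≟-weak using (con)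

  :0 :1 : ∀ {n} → Term n
  :0 = con (+ 0)
  :1 = con (+ 1)

-- Commutative rings, integral domains and polynomial rings.

module _ {c ℓ} {A : Set c} {_≈_ : Rel A ℓ} {_+_ _*_ : Op₂ A} { -_ : Op₁ A} {0# 1# : A} where
  open Algebra.Definitions _≈_
  open import Algebra.Structures _≈_ using () renaming (IsCommutativeRing to IsCR)

  mkIsCommutativeRing :
    IsEquivalence _≈_ → Congruent₂ _+_ → Associative _+_ → Commutative _+_ → LeftIdentity 0# _+_ →
    Congruent₁ -_ → LeftInverse 0# -_ _+_ → Congruent₂ _*_ → Associative _*_ → Commutative _*_ →
    LeftIdentity 1# _*_ → _*_ DistributesOverʳ _+_ → IsCR _+_ _*_ -_ 0# 1#
  mkIsCommutativeRing eq +-cong +-assoc +-comm +-idˡ neg-cong neg-invˡ *-cong *-assoc *-comm *-idˡ distribʳ = record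
    { isRing = record
      { +-isAbelianGroup = record
        { isGroup = record
          { isMonoid = record
            { isSemigroup = record
              { isMagma = record { isEquivalence = eq ; ∙-cong = +-cong }
              ; assoc = +-assoc }
            ; identity = +-idˡ , λ x → trans (+-comm x 0#) (+-idˡ x) }
          ; inverse = neg-invˡ , λ x → trans (+-comm x (- x)) (neg-invˡ x)
          ; ⁻¹-cong = neg-cong }
        ; comm = +-comm }
      ; *-cong = *-cong
      ; *-assoc = *-assoc
      ; *-identity = *-idˡ , λ x → trans (*-comm x 1#) (*-idˡ x)
      ; distrib = (λ x y z → trans (*-comm x _) (trans (distribʳ x y z) (+-cong (*-comm y x) (*-comm z x))))
                , distribʳ }
    ; *-comm = *-comm }
    where open IsEquivalence eq using (trans)

record IntegralDomain c ℓ : Set (lsuc (c ⊔ ℓ)) where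
  field
    commutativeRing : CommutativeRing c ℓ
  open CommutativeRing commutativeRing public
  field
    1≉0    : ¬ 1# ≈ 0#
    noZeroDivisors : ∀ {x y} → x * y ≈ 0# → x ≈ 0# ⊎ y ≈ 0#

module PolynomialRing {c ℓ} (R : CommutativeRing c ℓ) where
  open CommutativeRing R hiding (zero)
  open import Algebra.Properties.Ring ring using (-0#≈0#)
  open IntegerSolver R
  open Univariate rawRing public hiding (_≋_)
  open import Relation.Binary.Reasoning.Setoid setoid

  infix 4 _≋_
  -- As a record, the relation determines `f` and `g`, so they can be inferred from a proof; the
  -- bare pointwise statement mentions them only through `coefficient`.
  record _≋_ (f g : List Carrier) : Set ℓ where
    constructor pointwise
    field coefficients : ∀ d → coefficient f d ≈ coefficient g d
  open _≋_ public

  ≋-refl : ∀ {f} → f ≋ f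
  ≋-refl .coefficients d = refl

  ≋-sym : ∀ {f g} → f ≋ g → g ≋ f
  ≋-sym p .coefficients d = sym (p .coefficients d)

  ≋-trans : ∀ {f g h} → f ≋ g → g ≋ h → f ≋ h
  ≋-trans p q .coefficients d = trans (p .coefficients d) (q .coefficients d)

  negate : List Carrier → List Carrier
  negate = map (-_)

  coefficient-⊕ : ∀ f g d → coefficient (f ⊕ g) d ≈ coefficient f d + coefficient g d
  coefficient-⊕ []      g       d       = sym (+-identityˡ _)
  coefficient-⊕ (x ∷ f) []      d       = sym (+-identityʳ _)
  coefficient-⊕ (x ∷ f) (y ∷ g) zero    = refl
  coefficient-⊕ (x ∷ f) (y ∷ g) (suc d) = coefficient-⊕ f g d

  coefficient-map : ∀ (φ : Carrier → Carrier) → φ 0# ≈ 0# → ∀ f d → coefficient (map φ f) d ≈ φ (coefficient f d)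
  coefficient-map φ φ0 []      d       = sym φ0
  coefficient-map φ φ0 (x ∷ f) zero    = refl
  coefficient-map φ φ0 (x ∷ f) (suc d) = coefficient-map φ φ0 f d

  coefficient-scale : ∀ x f d → coefficient (map (x *_) f) d ≈ x * coefficient f d
  coefficient-scale x = coefficient-map (x *_) (zeroʳ x)

  coefficient-negate : ∀ f d → coefficient (negate f) d ≈ - coefficient f d
  coefficient-negate = coefficient-map -_ -0#≈0#

  ∷-cong : ∀ {x y f g} → x ≈ y → f ≋ g → x ∷ f ≋ y ∷ g
  ∷-cong p q .coefficients zero    = p
  ∷-cong p q .coefficients (suc d) = q .coefficients d

  ⊕-cong : ∀ {f f′ g g′} → f ≋ f′ → g ≋ g′ → f ⊕ g ≋ f′ ⊕ g′
  ⊕-cong {f} {f′} {g} {g′} p q .coefficients d =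
    trans (coefficient-⊕ f g d) (trans (+-cong (p .coefficients d) (q .coefficients d)) (sym (coefficient-⊕ f′ g′ d)))

  ⊕-assoc : ∀ f g h → (f ⊕ g) ⊕ h ≋ f ⊕ (g ⊕ h)
  ⊕-assoc f g h .coefficients d = begin
    coefficient ((f ⊕ g) ⊕ h) d                                    ≈⟨ coefficient-⊕ (f ⊕ g) h d ⟩
    coefficient (f ⊕ g) d + coefficient h d                        ≈⟨ +-congʳ (coefficient-⊕ f g d) ⟩
    (coefficient f d + coefficient g d) + coefficient h d          ≈⟨ +-assoc _ _ _ ⟩
    coefficient f d + (coefficient g d + coefficient h d)          ≈⟨ +-congˡ (coefficient-⊕ g h d) ⟨
    coefficient f d + coefficient (g ⊕ h) d                        ≈⟨ coefficient-⊕ f (g ⊕ h) d ⟨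
    coefficient (f ⊕ (g ⊕ h)) d                                    ∎

  ⊕-comm : ∀ f g → f ⊕ g ≋ g ⊕ f
  ⊕-comm f g .coefficients d = trans (coefficient-⊕ f g d) (trans (+-comm _ _) (sym (coefficient-⊕ g f d)))

  negate-cong : ∀ {f g} → f ≋ g → negate f ≋ negate g
  negate-cong {f} {g} p .coefficients d = trans (coefficient-negate f d) (trans (-‿cong (p .coefficients d)) (sym (coefficient-negate g d)))

  negate-inverseˡ : ∀ f → negate f ⊕ f ≋ []
  negate-inverseˡ f .coefficients d = trans (coefficient-⊕ (negate f) f d) (trans (+-congʳ (coefficient-negate f d)) (-‿inverseˡ _))

  ⊗-∷ : ∀ x f g d → coefficient ((x ∷ f) ⊗ g) d ≈ x * coefficient g d + coefficient (0# ∷ f ⊗ g) d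
  ⊗-∷ x f g d = trans (coefficient-⊕ (map (x *_) g) (0# ∷ f ⊗ g) d) (+-congʳ (coefficient-scale x g d))

  -- The mirror image of `⊗-∷`, with the right factor taken apart. The two together make
  -- commutativity an induction on one factor.
  ∷-⊗ : ∀ f y g d → coefficient (f ⊗ (y ∷ g)) d ≈ coefficient f d * y + coefficient (0# ∷ f ⊗ g) d
  ∷-⊗ [] y g zero    = sym (trans (+-identityʳ _) (zeroˡ y))
  ∷-⊗ [] y g (suc d) = sym (trans (+-identityʳ _) (zeroˡ y))
  ∷-⊗ (x ∷ f) y g zero    = ⊗-∷ x f (y ∷ g) zero
  ∷-⊗ (x ∷ f) y g (suc d) = begin
    coefficient ((x ∷ f) ⊗ (y ∷ g)) (suc d)                                    ≈⟨ ⊗-∷ x f (y ∷ g) (suc d) ⟩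
    x * coefficient g d + coefficient (f ⊗ (y ∷ g)) d                          ≈⟨ +-congˡ (∷-⊗ f y g d) ⟩
    x * coefficient g d + (coefficient f d * y + coefficient (0# ∷ f ⊗ g) d)
      ≈⟨ solve 3 (λ a b e → a :+ (b :+ e) := b :+ (a :+ e)) refl _ _ _ ⟩
    coefficient f d * y + (x * coefficient g d + coefficient (0# ∷ f ⊗ g) d)   ≈⟨ +-congˡ (⊗-∷ x f g d) ⟨
    coefficient f d * y + coefficient ((x ∷ f) ⊗ g) d                          ∎

  ⊗-comm : ∀ f g → f ⊗ g ≋ g ⊗ f
  ⊗-comm [] g = ≋-sym (zero-right g)
    where
    zero-right : ∀ g → g ⊗ [] ≋ []
    zero-right []      = ≋-refl
    zero-right (y ∷ g) .coefficients zero    = refl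
    zero-right (y ∷ g) .coefficients (suc d) = zero-right g .coefficients d
  ⊗-comm (x ∷ f) g .coefficients d = begin
    coefficient ((x ∷ f) ⊗ g) d                       ≈⟨ ⊗-∷ x f g d ⟩
    x * coefficient g d + coefficient (0# ∷ f ⊗ g) d  ≈⟨ +-cong (*-comm _ _) (∷-cong refl (⊗-comm f g) .coefficients d) ⟩
    coefficient g d * x + coefficient (0# ∷ g ⊗ f) d  ≈⟨ ∷-⊗ g x f d ⟨
    coefficient (g ⊗ (x ∷ f)) d                       ∎

  ⊗-congˡ : ∀ f {g g′} → g ≋ g′ → f ⊗ g ≋ f ⊗ g′
  ⊗-congˡ []      p = ≋-refl
  ⊗-congˡ (x ∷ f) {g} {g′} p .coefficients d = trans (⊗-∷ x f g d)
    (trans (+-cong (*-congˡ (p .coefficients d)) (∷-cong refl (⊗-congˡ f p) .coefficients d)) (sym (⊗-∷ x f g′ d)))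

  -- A recursion on the left factor cannot follow `f ≋ f′`, since the lists may differ in length by
  -- trailing zeros. Commutativity moves the change to the right factor.
  ⊗-cong : ∀ {f f′ g g′} → f ≋ f′ → g ≋ g′ → f ⊗ g ≋ f′ ⊗ g′
  ⊗-cong {f} {f′} {g} {g′} p q =
    ≋-trans (⊗-congˡ f q) (≋-trans (⊗-comm f g′) (≋-trans (⊗-congˡ g′ p) (⊗-comm g′ f′)))

  shift-⊕ : ∀ f g d → coefficient (0# ∷ (f ⊕ g)) d ≈ coefficient (0# ∷ f) d + coefficient (0# ∷ g) d
  shift-⊕ f g zero    = sym (+-identityˡ 0#)
  shift-⊕ f g (suc d) = coefficient-⊕ f g d

  ⊗-distribʳ : ∀ h f g → (f ⊕ g) ⊗ h ≋ f ⊗ h ⊕ g ⊗ h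
  ⊗-distribʳ h []      g       = ≋-refl
  ⊗-distribʳ h (x ∷ f) []      = ≋-sym (⊕-comm ((x ∷ f) ⊗ h) [])
  ⊗-distribʳ h (x ∷ f) (y ∷ g) .coefficients d = begin
    coefficient ((x + y ∷ f ⊕ g) ⊗ h) d
      ≈⟨ ⊗-∷ (x + y) (f ⊕ g) h d ⟩
    (x + y) * coefficient h d + coefficient (0# ∷ (f ⊕ g) ⊗ h) d
      ≈⟨ +-congˡ (trans (∷-cong refl (⊗-distribʳ h f g) .coefficients d) (shift-⊕ (f ⊗ h) (g ⊗ h) d)) ⟩
    (x + y) * coefficient h d + (coefficient (0# ∷ f ⊗ h) d + coefficient (0# ∷ g ⊗ h) d)
      ≈⟨ solve 5 (λ a b e s t → (a :+ b) :* e :+ (s :+ t) := (a :* e :+ s) :+ (b :* e :+ t)) refl _ _ _ _ _ ⟩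
    (x * coefficient h d + coefficient (0# ∷ f ⊗ h) d) + (y * coefficient h d + coefficient (0# ∷ g ⊗ h) d)
      ≈⟨ +-cong (⊗-∷ x f h d) (⊗-∷ y g h d) ⟨
    coefficient ((x ∷ f) ⊗ h) d + coefficient ((y ∷ g) ⊗ h) d
      ≈⟨ coefficient-⊕ ((x ∷ f) ⊗ h) ((y ∷ g) ⊗ h) d ⟨
    coefficient ((x ∷ f) ⊗ h ⊕ (y ∷ g) ⊗ h) d ∎

  scale-⊗ : ∀ x g h → map (x *_) g ⊗ h ≋ map (x *_) (g ⊗ h)
  scale-⊗ x []      h = ≋-refl
  scale-⊗ x (y ∷ g) h .coefficients d = begin
    coefficient ((x * y ∷ map (x *_) g) ⊗ h) d
      ≈⟨ ⊗-∷ (x * y) (map (x *_) g) h d ⟩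
    x * y * coefficient h d + coefficient (0# ∷ map (x *_) g ⊗ h) d
      ≈⟨ +-congˡ (∷-cong refl (scale-⊗ x g h) .coefficients d) ⟩
    x * y * coefficient h d + coefficient (0# ∷ map (x *_) (g ⊗ h)) d
      ≈⟨ +-cong (*-assoc x y _) (trans (∷-cong (sym (zeroʳ x)) ≋-refl .coefficients d) (coefficient-scale x (0# ∷ g ⊗ h) d)) ⟩
    x * (y * coefficient h d) + x * coefficient (0# ∷ g ⊗ h) d
      ≈⟨ distribˡ x _ _ ⟨
    x * (y * coefficient h d + coefficient (0# ∷ g ⊗ h) d)
      ≈⟨ *-congˡ (⊗-∷ y g h d) ⟨
    x * coefficient ((y ∷ g) ⊗ h) d
      ≈⟨ coefficient-scale x ((y ∷ g) ⊗ h) d ⟨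
    coefficient (map (x *_) ((y ∷ g) ⊗ h)) d ∎

  shift-⊗ : ∀ f h → (0# ∷ f) ⊗ h ≋ 0# ∷ f ⊗ h
  shift-⊗ f h .coefficients d = trans (⊗-∷ 0# f h d) (trans (+-congʳ (zeroˡ _)) (+-identityˡ _))

  ⊗-assoc : ∀ f g h → (f ⊗ g) ⊗ h ≋ f ⊗ (g ⊗ h)
  ⊗-assoc []      g h = ≋-refl
  ⊗-assoc (x ∷ f) g h   =
    ≋-trans (⊗-distribʳ h (map (x *_) g) (0# ∷ f ⊗ g))
            (⊕-cong (scale-⊗ x g h) (≋-trans (shift-⊗ (f ⊗ g) h) (∷-cong refl (⊗-assoc f g h))))

  ⊗-constant : ∀ x f → (x ∷ []) ⊗ f ≋ map (x *_) f
  ⊗-constant x f .coefficients zero    = trans (⊗-∷ x [] f zero) (trans (+-identityʳ _) (sym (coefficient-scale x f zero)))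
  ⊗-constant x f .coefficients (suc d) = trans (⊗-∷ x [] f (suc d)) (trans (+-identityʳ _) (sym (coefficient-scale x f (suc d))))

  ⊗-identityˡ : ∀ f → (1# ∷ []) ⊗ f ≋ f
  ⊗-identityˡ f .coefficients d = trans (⊗-constant 1# f .coefficients d) (trans (coefficient-scale 1# f d) (*-identityˡ _))

  polynomialRing : CommutativeRing c ℓ
  polynomialRing = record
    { Carrier = List Carrier ; _≈_ = _≋_ ; _+_ = _⊕_ ; _*_ = _⊗_ ; -_ = negate ; 0# = [] ; 1# = 1# ∷ []
    ; isCommutativeRing = mkIsCommutativeRing
        (record { refl = ≋-refl ; sym = ≋-sym ; trans = ≋-trans })
        ⊕-cong ⊕-assoc ⊕-comm (λ _ → ≋-refl) negate-cong negate-inverseˡ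
        ⊗-cong ⊗-assoc ⊗-comm ⊗-identityˡ ⊗-distribʳ }

module _ {c ℓ} (em : ∀ {P : Set ℓ} → Dec P) (D : IntegralDomain c ℓ) where
  open IntegralDomain D hiding (zero)
  open PolynomialRing commutativeRing

  private
    shift-≋0 : ∀ {x f} → x ≈ 0# → f ≋ [] → x ∷ f ≋ []
    shift-≋0 p q .coefficients zero    = p
    shift-≋0 p q .coefficients (suc d) = q .coefficients d

    -- The constant coefficient of the product is `x * y`, which forces `y` to vanish; the remaining
    -- coefficients are then those of the product with the tail of the second factor.
    cancel : ∀ {x f} → ¬ x ≈ 0# → ∀ g → (x ∷ f) ⊗ g ≋ [] → g ≋ []
    cancel x≉0 [] p = ≋-refl
    cancel {x} {f} x≉0 (y ∷ g) p with noZeroDivisors (trans (sym (+-identityʳ _)) (p .coefficients zero))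
    ... | inj₁ x≈0 = ⊥-elim (x≉0 x≈0)
    ... | inj₂ y≈0 = shift-≋0 y≈0 (cancel {f = f} x≉0 g (pointwise λ d →
            trans (sym (trans (+-congʳ (trans (*-congˡ y≈0) (zeroʳ _))) (+-identityˡ _)))
                  (trans (sym (∷-⊗ (x ∷ f) y g (suc d))) (p .coefficients (suc d)))))

  -- The lowest nonzero coefficients of two factors multiply to the lowest one of the product.
  polynomial-noZeroDivisors : ∀ f g → f ⊗ g ≋ [] → f ≋ [] ⊎ g ≋ []
  polynomial-noZeroDivisors []      g p = inj₁ ≋-refl
  polynomial-noZeroDivisors (x ∷ f) g p with em {x ≈ 0#}
  ... | no x≉0 = inj₂ (cancel {f = f} x≉0 g p)
  ... | yes x≈0 with polynomial-noZeroDivisors f g (pointwise λ d →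
          trans (sym (trans (+-congʳ (trans (*-congʳ x≈0) (zeroˡ _))) (+-identityˡ _)))
                (trans (sym (⊗-∷ x f g (suc d))) (p .coefficients (suc d))))
  ...   | inj₁ q = inj₁ (shift-≋0 x≈0 q)
  ...   | inj₂ q = inj₂ q

  polynomialDomain : IntegralDomain c ℓ
  polynomialDomain = record
    { commutativeRing = polynomialRing
    ; 1≉0 = λ p → 1≉0 (p .coefficients zero)
    ; noZeroDivisors = λ {f} {g} → polynomial-noZeroDivisors f g }

module _ {c ℓ} (R : CommutativeRing c ℓ) where
  open CommutativeRing R hiding (zero)
  open PolynomialRing R
  open IntegerSolver R
  open import Relation.Binary.Reasoning.Setoid setoid

  horner : Carrier → List Carrier → Carrier
  horner = evalAt rawRing rawRing (λ z → z)

  module _ (x : Carrier) where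

    horner-≋0 : ∀ f → f ≋ [] → horner x f ≈ 0#
    horner-≋0 []      p = refl
    horner-≋0 (c ∷ f) p =
      trans (+-cong (p .coefficients zero) (trans (*-congˡ (horner-≋0 f (pointwise λ d → p .coefficients (suc d)))) (zeroʳ x))) (+-identityˡ 0#)

    horner-cong : ∀ f g → f ≋ g → horner x f ≈ horner x g
    horner-cong []      g       p = sym (horner-≋0 g (≋-sym p))
    horner-cong (c ∷ f) []      p = horner-≋0 (c ∷ f) p
    horner-cong (c ∷ f) (d ∷ g) p = +-cong (p .coefficients zero) (*-congˡ (horner-cong f g (pointwise λ d → p .coefficients (suc d))))

    horner-⊕ : ∀ f g → horner x (f ⊕ g) ≈ horner x f + horner x g
    horner-⊕ []      g       = sym (+-identityˡ _)
    horner-⊕ (c ∷ f) []      = sym (+-identityʳ _)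
    horner-⊕ (c ∷ f) (d ∷ g) = trans (+-congˡ (*-congˡ (horner-⊕ f g)))
      (solve 5 (λ c d x a b → (c :+ d) :+ x :* (a :+ b) := (c :+ x :* a) :+ (d :+ x :* b)) refl c d x _ _)

    horner-scale : ∀ c f → horner x (map (c *_) f) ≈ c * horner x f
    horner-scale c []      = sym (zeroʳ c)
    horner-scale c (d ∷ f) = trans (+-congˡ (*-congˡ (horner-scale c f)))
      (solve 4 (λ c d x a → c :* d :+ x :* (c :* a) := c :* (d :+ x :* a)) refl c d x _)

    horner-⊗ : ∀ f g → horner x (f ⊗ g) ≈ horner x f * horner x g
    horner-⊗ []      g = sym (zeroˡ _)
    horner-⊗ (c ∷ f) g = trans (horner-⊕ (map (c *_) g) (0# ∷ f ⊗ g))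
      (trans (+-cong (horner-scale c g) (+-congˡ (*-congˡ (horner-⊗ f g))))
        (solve 4 (λ c x a b → c :* b :+ (:0 :+ x :* (a :* b)) := (c :+ x :* a) :* b) refl c x (horner x f) (horner x g)))

-- Derivations and fraction fields.

module DerivationProperties {c ℓ} (R : CommutativeRing c ℓ) where
  open CommutativeRing R
  open IntegerSolver R
  open import Relation.Binary.Reasoning.Setoid setoid

  module OfDerivation {δ : Op₁ Carrier} (δ-cong : ∀ {x y} → x ≈ y → δ x ≈ δ y)
    (δ-+ : ∀ x y → δ (x + y) ≈ δ x + δ y) (δ-* : ∀ x y → δ (x * y) ≈ δ x * y + x * δ y) where

    δ-0 : δ 0# ≈ 0#
    δ-0 = begin
      δ 0#                  ≈⟨ solve 1 (λ x → x := (x :+ x) :- x) refl (δ 0#) ⟩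
      (δ 0# + δ 0#) - δ 0#  ≈⟨ +-congʳ (trans (sym (δ-+ 0# 0#)) (δ-cong (+-identityˡ 0#))) ⟩
      δ 0# - δ 0#           ≈⟨ -‿inverseʳ _ ⟩
      0#                    ∎

    δ-1 : δ 1# ≈ 0#
    δ-1 = begin
      δ 1#                            ≈⟨ solve 1 (λ x → x := (x :* :1 :+ :1 :* x) :- x) refl (δ 1#) ⟩
      (δ 1# * 1# + 1# * δ 1#) - δ 1#  ≈⟨ +-congʳ (trans (sym (δ-* 1# 1#)) (δ-cong (*-identityˡ 1#))) ⟩
      δ 1# - δ 1#                     ≈⟨ -‿inverseʳ _ ⟩
      0#                              ∎

    δ-neg : ∀ x → δ (- x) ≈ - δ x
    δ-neg x = begin
      δ (- x)                ≈⟨ solve 2 (λ a b → a := (a :+ b) :- b) refl (δ (- x)) (δ x) ⟩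
      δ (- x) + δ x - δ x    ≈⟨ +-congʳ (trans (sym (δ-+ (- x) x)) (trans (δ-cong (-‿inverseˡ x)) δ-0)) ⟩
      0# - δ x               ≈⟨ +-identityˡ _ ⟩
      - δ x                  ∎

module DomainProperties {c ℓ} (D : IntegralDomain c ℓ) where
  open IntegralDomain D
  open IntegerSolver commutativeRing

  *-≉0 : ∀ {x y} → ¬ x ≈ 0# → ¬ y ≈ 0# → ¬ x * y ≈ 0#
  *-≉0 x≉0 y≉0 p = [ x≉0 , y≉0 ]′ (noZeroDivisors p)

  cancel-≈0 : ∀ {x y} → ¬ x ≈ 0# → x * y ≈ 0# → y ≈ 0#
  cancel-≈0 x≉0 p = [ ⊥-elim ∘ x≉0 , (λ q → q) ]′ (noZeroDivisors p)

  -≈0⇒≈ : ∀ {x y} → x - y ≈ 0# → x ≈ y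
  -≈0⇒≈ {x} {y} p =
    trans (solve 2 (λ x y → x := (x :- y) :+ y) refl x y) (trans (+-congʳ p) (+-identityˡ y))

  ≈⇒-≈0 : ∀ {x y} → x ≈ y → x - y ≈ 0#
  ≈⇒-≈0 {x} {y} p = trans (+-congʳ p) (-‿inverseʳ y)

  *-cancelˡ : ∀ {x} y z → ¬ x ≈ 0# → x * y ≈ x * z → y ≈ z
  *-cancelˡ {x} y z x≉0 p = -≈0⇒≈ (cancel-≈0 x≉0
    (trans (solve 3 (λ x y z → x :* (y :- z) := x :* y :- x :* z) refl x y z) (≈⇒-≈0 p)))

-- The commutator of two derivations is a derivation, so it vanishes at a / b once it vanishes at a and b.
module _ {c ℓ₁ ℓ₂} (L : HeytingField c ℓ₁ ℓ₂) {D₁ D₂ : Op₁ (Field.Carrier L)}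
         (d₁ : IsDerivation L D₁) (d₂ : IsDerivation L D₂) where
  open HeytingField L using (heytingCommutativeRing)
  open Field L
  open IntegerSolver (HeytingCommutativeRing.commutativeRing heytingCommutativeRing)
  open IsDerivation
  open import Relation.Binary.Reasoning.Setoid setoid

  commute-at-quotient : ∀ {a b c x} → c * b ≈ 1# → b * x ≈ a →
    D₁ (D₂ a) ≈ D₂ (D₁ a) → D₁ (D₂ b) ≈ D₂ (D₁ b) → D₁ (D₂ x) ≈ D₂ (D₁ x)
  commute-at-quotient {a} {b} {c} {x} cb≈1 bx≈a comm-a comm-b = begin
    D₁ (D₂ x)                                     ≈⟨ solve 2 (λ t u → t := (t :- u) :+ u) refl (D₁ (D₂ x)) (D₂ (D₁ x)) ⟩
    (D₁ (D₂ x) - D₂ (D₁ x)) + D₂ (D₁ x)           ≈⟨ +-congʳ (*-identityˡ _) ⟨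
    1# * (D₁ (D₂ x) - D₂ (D₁ x)) + D₂ (D₁ x)      ≈⟨ +-congʳ (*-congʳ cb≈1) ⟨
    c * b * (D₁ (D₂ x) - D₂ (D₁ x)) + D₂ (D₁ x)   ≈⟨ +-congʳ (*-assoc c b _) ⟩
    c * (b * (D₁ (D₂ x) - D₂ (D₁ x))) + D₂ (D₁ x) ≈⟨ +-congʳ (*-congˡ vanishes) ⟩
    c * 0# + D₂ (D₁ x)                            ≈⟨ trans (+-congʳ (zeroʳ c)) (+-identityˡ _) ⟩
    D₂ (D₁ x)                                     ∎
    where
    product : ∀ {D D′} → IsDerivation L D → IsDerivation L D′ →
      D (D′ a) ≈ (D (D′ b) * x + D′ b * D x) + (D b * D′ x + b * D (D′ x))
    product {D} {D′} d d′ = trans (d .D-cong (trans (d′ .D-cong (sym bx≈a)) (d′ .D-* b x)))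
      (trans (d .D-+ _ _) (+-cong (d .D-* _ _) (d .D-* _ _)))
    -- The mixed terms of the two second-order Leibniz expansions are the same, so the commutator at
    -- `b * x` reduces to its values at `b` and at `x`.
    vanishes : b * (D₁ (D₂ x) - D₂ (D₁ x)) ≈ 0#
    vanishes = begin
      b * (D₁ (D₂ x) - D₂ (D₁ x))
        ≈⟨ solve 9 (λ b x p q r s v t u → b :* (t :- u)
             := ((p :* x :+ q :* r) :+ (s :* v :+ b :* t)) :- ((p :* x :+ s :* v) :+ (q :* r :+ b :* u))) refl
             b x (D₁ (D₂ b)) (D₂ b) (D₁ x) (D₁ b) (D₂ x) (D₁ (D₂ x)) (D₂ (D₁ x)) ⟩
      ((D₁ (D₂ b) * x + D₂ b * D₁ x) + (D₁ b * D₂ x + b * D₁ (D₂ x)))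
        - ((D₁ (D₂ b) * x + D₁ b * D₂ x) + (D₂ b * D₁ x + b * D₂ (D₁ x)))
        ≈⟨ +-cong (sym (product d₁ d₂)) (-‿cong (trans (+-congʳ (+-congʳ (*-congʳ comm-b))) (sym (product d₂ d₁)))) ⟩
      D₁ (D₂ a) - D₂ (D₁ a)   ≈⟨ +-congʳ comm-a ⟩
      D₂ (D₁ a) - D₂ (D₁ a)   ≈⟨ -‿inverseʳ _ ⟩
      0# ∎

module FractionField (p : Level) {c ℓ} (D : IntegralDomain c ℓ)
                     (em : ∀ {P : Set (c ⊔ ℓ ⊔ p)} → Dec P) where
  open IntegralDomain D
  open DomainProperties D
  open IntegerSolver commutativeRing
  open import Relation.Binary.Reasoning.Setoid setoid

  -- The level `p` lifts the fractions to the universe in which the field of a `CompatibleExtension`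
  -- has to live.
  record Fraction : Set (c ⊔ ℓ ⊔ p) where
    constructor _/_[_]
    field
      num   : Carrier
      den   : Carrier
      den≉0 : ¬ den ≈ 0#
  open Fraction public

  infix 4 _≃_
  record _≃_ (x y : Fraction) : Set (c ⊔ ℓ ⊔ p) where
    constructor cross
    field cross-multiplied : num x * den y ≈ num y * den x
  open _≃_ public

  embed : Carrier → Fraction
  embed x = x / 1# [ 1≉0 ]

  private
    infixl 6 _⊞_
    infixl 7 _⊠_
    _⊞_ _⊠_ : Op₂ Fraction
    x ⊞ y = (num x * den y + num y * den x) / den x * den y [ *-≉0 (den≉0 x) (den≉0 y) ]
    x ⊠ y = (num x * num y) / den x * den y [ *-≉0 (den≉0 x) (den≉0 y) ]

    ⊟_ : Op₁ Fraction
    ⊟ x = (- num x) / den x [ den≉0 x ]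

    ≃-trans : ∀ {x y z} → x ≃ y → y ≃ z → x ≃ z
    ≃-trans {x} {y} {z} (cross p) (cross q) = cross (*-cancelˡ _ _ (den≉0 y) (begin
      den y * (num x * den z)  ≈⟨ solve 3 (λ b a e → b :* (a :* e) := (a :* b) :* e) refl _ _ _ ⟩
      num x * den y * den z    ≈⟨ *-congʳ p ⟩
      num y * den x * den z    ≈⟨ solve 3 (λ a b e → a :* b :* e := (a :* e) :* b) refl _ _ _ ⟩
      num y * den z * den x    ≈⟨ *-congʳ q ⟩
      num z * den y * den x    ≈⟨ solve 3 (λ a b e → a :* b :* e := b :* (a :* e)) refl _ _ _ ⟩
      den y * (num z * den x)  ∎))

    ⊞-cong : ∀ {x x′ y y′} → x ≃ x′ → y ≃ y′ → x ⊞ y ≃ x′ ⊞ y′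
    ⊞-cong {a / b [ _ ]} {a′ / b′ [ _ ]} {e / f [ _ ]} {e′ / f′ [ _ ]} (cross p) (cross q) = cross (begin
      (a * f + e * b) * (b′ * f′)
        ≈⟨ solve 6 (λ a b e f b′ f′ → (a :* f :+ e :* b) :* (b′ :* f′) := (a :* b′) :* (f :* f′) :+ (e :* f′) :* (b :* b′)) refl a b e f b′ f′ ⟩
      (a * b′) * (f * f′) + (e * f′) * (b * b′)
        ≈⟨ +-cong (*-congʳ p) (*-congʳ q) ⟩
      (a′ * b) * (f * f′) + (e′ * f) * (b * b′)
        ≈⟨ solve 6 (λ a′ b e′ f b′ f′ → (a′ :* b) :* (f :* f′) :+ (e′ :* f) :* (b :* b′) := (a′ :* f′ :+ e′ :* b′) :* (b :* f)) refl a′ b e′ f b′ f′ ⟩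
      (a′ * f′ + e′ * b′) * (b * f) ∎)

    ⊠-cong : ∀ {x x′ y y′} → x ≃ x′ → y ≃ y′ → x ⊠ y ≃ x′ ⊠ y′
    ⊠-cong {a / b [ _ ]} {a′ / b′ [ _ ]} {e / f [ _ ]} {e′ / f′ [ _ ]} (cross p) (cross q) = cross (begin
      (a * e) * (b′ * f′)    ≈⟨ solve 4 (λ a e b′ f′ → (a :* e) :* (b′ :* f′) := (a :* b′) :* (e :* f′)) refl a e b′ f′ ⟩
      (a * b′) * (e * f′)    ≈⟨ *-cong p q ⟩
      (a′ * b) * (e′ * f)    ≈⟨ solve 4 (λ a b e f → (a :* b) :* (e :* f) := (a :* e) :* (b :* f)) refl a′ b e′ f ⟩
      (a′ * e′) * (b * f)    ∎)

    ⊟-cong : ∀ {x y} → x ≃ y → ⊟ x ≃ ⊟ y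
    ⊟-cong {a / b [ _ ]} {a′ / b′ [ _ ]} (cross p) = cross (begin
      - a * b′    ≈⟨ solve 2 (λ a b → :- a :* b := :- (a :* b)) refl a b′ ⟩
      - (a * b′)  ≈⟨ -‿cong p ⟩
      - (a′ * b)  ≈⟨ solve 2 (λ a b → :- a :* b := :- (a :* b)) refl a′ b ⟨
      - a′ * b    ∎)

  commutativeRingOfFractions : CommutativeRing (c ⊔ ℓ ⊔ p) (c ⊔ ℓ ⊔ p)
  commutativeRingOfFractions = record
    { Carrier = Fraction ; _≈_ = _≃_ ; _+_ = _⊞_ ; _*_ = _⊠_ ; -_ = ⊟_ ; 0# = embed 0# ; 1# = embed 1#
    ; isCommutativeRing = mkIsCommutativeRing
        (record { refl = cross refl ; sym = λ q → cross (sym (cross-multiplied q)) ; trans = ≃-trans })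
        ⊞-cong
        (λ (a / b [ _ ]) (d / e [ _ ]) (f / g [ _ ]) → cross
          (solve 6 (λ a b d e f g → ((a :* e :+ d :* b) :* g :+ f :* (b :* e)) :* (b :* (e :* g))
                                 := (a :* (e :* g) :+ (d :* g :+ f :* e) :* b) :* (b :* e :* g)) refl a b d e f g))
        (λ (a / b [ _ ]) (d / e [ _ ]) → cross
          (solve 4 (λ a b d e → (a :* e :+ d :* b) :* (e :* b) := (d :* b :+ a :* e) :* (b :* e)) refl a b d e))
        (λ (a / b [ _ ]) → cross (solve 2 (λ a b → (:0 :* b :+ a :* :1) :* b := a :* (:1 :* b)) refl a b))
        ⊟-cong
        (λ (a / b [ _ ]) → cross (solve 2 (λ a b → (:- a :* b :+ a :* b) :* :1 := :0 :* (b :* b)) refl a b))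
        ⊠-cong
        (λ (a / b [ _ ]) (d / e [ _ ]) (f / g [ _ ]) → cross
          (solve 6 (λ a b d e f g → a :* d :* f :* (b :* (e :* g)) := a :* (d :* f) :* (b :* e :* g)) refl a b d e f g))
        (λ (a / b [ _ ]) (d / e [ _ ]) → cross
          (solve 4 (λ a b d e → a :* d :* (e :* b) := d :* a :* (b :* e)) refl a b d e))
        (λ (a / b [ _ ]) → cross (solve 2 (λ a b → :1 :* a :* b := a :* (:1 :* b)) refl a b))
        (λ (a / b [ _ ]) (d / e [ _ ]) (f / g [ _ ]) → cross
          (solve 6 (λ a b d e f g → (d :* g :+ f :* e) :* a :* (e :* b :* (g :* b))
                                 := (d :* a :* (g :* b) :+ f :* a :* (e :* b)) :* (e :* g :* b)) refl a b d e f g)) }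

  private
    module F = CommutativeRing commutativeRingOfFractions
    module FS = IntegerSolver commutativeRingOfFractions

    ≃0⇒num≈0 : ∀ {x} → x F.≈ F.0# → num x ≈ 0#
    ≃0⇒num≈0 (cross q) = trans (sym (*-identityʳ _)) (trans q (zeroˡ _))

    F-inverse : ∀ x → ¬ x F.≈ F.0# → Σ Fraction λ y → y F.* x F.≈ F.1#
    F-inverse x@(a / b [ b≉0 ]) x≉0 =
      b / a [ (λ a≈0 → x≉0 (cross (trans (*-identityʳ a) (trans a≈0 (sym (zeroˡ b)))))) ] ,
      cross (solve 2 (λ a b → b :* a :* :1 := :1 :* (a :* b)) refl a b)

    difference≃0 : ∀ {x y} → x F.- y F.≈ F.0# → x F.≈ y
    difference≃0 {x} {y} q = F.trans (FS.solve 2 (λ x y → x FS.:= (x FS.:- y) FS.:+ y) F.refl x y)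
                                     (F.trans (F.+-congʳ {x = y} q) (F.+-identityˡ y))

    1≄0 : ¬ F.1# F.≈ F.0#
    1≄0 (cross q) = 1≉0 (trans (sym (*-identityʳ 1#)) (trans q (zeroˡ 1#)))

  fractionField : HeytingField (c ⊔ ℓ ⊔ p) (c ⊔ ℓ ⊔ p) (c ⊔ ℓ ⊔ p)
  fractionField = record
    { Carrier = Fraction ; _≈_ = _≃_ ; _#_ = λ x y → ¬ x F.≈ y
    ; _+_ = F._+_ ; _*_ = F._*_ ; -_ = F.-_ ; 0# = F.0# ; 1# = F.1#
    ; isHeytingField = record
      { isHeytingCommutativeRing = record
        { isCommutativeRing = F.isCommutativeRing
        ; isApartnessRelation = record
          { irrefl = λ x≈y x#y → x#y x≈y
          ; sym = λ x#y y≈x → x#y (F.sym y≈x)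
          ; cotrans = cotrans }
        ; #⇒invertible = λ {x} {y} x#y →
            let z , zx≈1 = F-inverse (x F.- y) (λ q → x#y (difference≃0 {x} {y} q))
            in z , zx≈1 , F.trans (F.*-comm (x F.- y) z) zx≈1
        ; invertible⇒# = λ {x} {y} (z , zx≈1 , _) x≈y → 1≄0 (F.trans (F.sym zx≈1)
            (F.trans (F.*-congˡ {x = z} (F.trans (F.+-congʳ {x = F.- y} x≈y) (F.-‿inverseʳ y))) (F.zeroʳ z))) }
      ; tight = λ x y → decidable-stable′ , λ q ¬q → ¬q q } }
    where
    decidable-stable′ : ∀ {P : Set (c ⊔ ℓ ⊔ p)} → ¬ ¬ P → P
    decidable-stable′ {P} ¬¬q with em {P}
    ... | yes q = q
    ... | no ¬q = ⊥-elim (¬¬q ¬q)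
    cotrans : ∀ {x y} → ¬ x F.≈ y → ∀ z → ¬ x F.≈ z ⊎ ¬ z F.≈ y
    cotrans {x} {y} x#y z with em {x F.≈ z}
    ... | yes x≈z = inj₂ (λ z≈y → x#y (F.trans x≈z z≈y))
    ... | no x#z  = inj₁ x#z

  module _ (δ : Op₁ Carrier) (δ-cong : ∀ {x y} → x ≈ y → δ x ≈ δ y)
           (δ-+ : ∀ x y → δ (x + y) ≈ δ x + δ y) (δ-* : ∀ x y → δ (x * y) ≈ δ x * y + x * δ y) where

    quotientRule : Op₁ Fraction
    quotientRule (a / b [ b≉0 ]) = (δ a * b - a * δ b) / b * b [ *-≉0 b≉0 b≉0 ]

    open DerivationProperties.OfDerivation commutativeRing {δ} δ-cong δ-+ δ-*

    quotientRule-embed : ∀ x → quotientRule (embed x) ≃ embed (δ x)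
    quotientRule-embed x = cross (begin
      (δ x * 1# - x * δ 1#) * 1#  ≈⟨ *-congʳ (+-congˡ (-‿cong (trans (*-congˡ δ-1) (zeroʳ x)))) ⟩
      (δ x * 1# - 0#) * 1#        ≈⟨ solve 1 (λ x → (x :* :1 :- :0) :* :1 := x :* (:1 :* :1)) refl (δ x) ⟩
      δ x * (1# * 1#)             ∎)

    quotientRule-isDerivation : IsDerivation fractionField quotientRule
    quotientRule-isDerivation = record
      -- Each side is rewritten in terms of `δ (a * b′)` and `a * b′`, respectively `δ (a′ * b)` and
      -- `a′ * b`, so that the hypothesis is used once differentiated and twice as it stands.
      { D-cong = λ { {a / b [ _ ]} {a′ / b′ [ _ ]} (cross q) → cross (begin
          (δ a * b - a * δ b) * (b′ * b′)
            ≈⟨ solve 6 (λ a b b′ da db db′ → (da :* b :- a :* db) :* (b′ :* b′)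
                 := b :* b′ :* (da :* b′ :+ a :* db′) :- b :* (a :* b′) :* db′ :- b′ :* (a :* b′) :* db) refl a b b′ (δ a) (δ b) (δ b′) ⟩
          b * b′ * (δ a * b′ + a * δ b′) - b * (a * b′) * δ b′ - b′ * (a * b′) * δ b
            ≈⟨ +-cong (+-cong (*-congˡ (trans (sym (δ-* a b′)) (trans (δ-cong q) (δ-* a′ b))))
                 (-‿cong (*-congʳ (*-congˡ q)))) (-‿cong (*-congʳ (*-congˡ q))) ⟩
          b * b′ * (δ a′ * b + a′ * δ b) - b * (a′ * b) * δ b′ - b′ * (a′ * b) * δ b
            ≈⟨ solve 6 (λ a′ b b′ da′ db db′ → b :* b′ :* (da′ :* b :+ a′ :* db) :- b :* (a′ :* b) :* db′ :- b′ :* (a′ :* b) :* db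
                 := (da′ :* b′ :- a′ :* db′) :* (b :* b)) refl a′ b b′ (δ a′) (δ b) (δ b′) ⟩
          (δ a′ * b′ - a′ * δ b′) * (b * b) ∎) }
      ; D-+ = λ (a / b [ _ ]) (e / f [ _ ]) → cross (trans
          (*-congʳ (+-cong (*-congʳ (trans (δ-+ _ _) (+-cong (δ-* a f) (δ-* e b)))) (-‿cong (*-congˡ (δ-* b f)))))
          (solve 8 (λ a b e f da db de df →
             (((da :* f :+ a :* df) :+ (de :* b :+ e :* db)) :* (b :* f) :- (a :* f :+ e :* b) :* (db :* f :+ b :* df))
               :* (b :* b :* (f :* f))
             := ((da :* b :- a :* db) :* (f :* f) :+ (de :* f :- e :* df) :* (b :* b)) :* (b :* f :* (b :* f)))
           refl a b e f (δ a) (δ b) (δ e) (δ f)))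
      ; D-* = λ (a / b [ _ ]) (e / f [ _ ]) → cross (trans
          (*-congʳ (+-cong (*-congʳ (δ-* a e)) (-‿cong (*-congˡ (δ-* b f)))))
          (solve 8 (λ a b e f da db de df →
             ((da :* e :+ a :* de) :* (b :* f) :- a :* e :* (db :* f :+ b :* df))
               :* (b :* b :* f :* (b :* (f :* f)))
             := ((da :* b :- a :* db) :* e :* (b :* (f :* f)) :+ a :* (de :* f :- e :* df) :* (b :* b :* f)) :* (b :* f :* (b :* f)))
           refl a b e f (δ a) (δ b) (δ e) (δ f))) }

  derivations-commute : ∀ {D₁ D₂ : Op₁ Fraction} →
    IsDerivation fractionField D₁ → IsDerivation fractionField D₂ →
    (∀ x → D₁ (D₂ (embed x)) ≃ D₂ (D₁ (embed x))) → ∀ x → D₁ (D₂ x) ≃ D₂ (D₁ x)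
  derivations-commute d₁ d₂ comm (a / b [ b≉0 ]) =
    commute-at-quotient fractionField d₁ d₂ {embed a} {embed b} {proj₁ inverse} {a / b [ b≉0 ]} (proj₂ inverse)
      (cross (solve 2 (λ a b → b :* a :* :1 := a :* (:1 :* b)) refl a b)) (comm a) (comm b)
    where inverse = F-inverse (embed b) (λ q → b≉0 (≃0⇒num≈0 q))

-- Exponents, and the ranking of indices by natural numbers.

module Indices where
  open import Data.Nat.Base using (_+_; _*_; _^_)
  open import Data.Vec.Relation.Unary.All using ([]; _∷_) renaming (All to Allᵥ)
  open import Relation.Binary.PropositionalEquality.Core using (refl; sym; trans; cong; cong₂; subst)

  +ε-comm : ∀ {m} (σ : Vec ℕ m) i j → σ +ε i +ε j ≡ σ +ε j +ε i
  +ε-comm (x ∷ σ) Fin.zero    Fin.zero    = refl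
  +ε-comm (x ∷ σ) Fin.zero    (Fin.suc j) = refl
  +ε-comm (x ∷ σ) (Fin.suc i) Fin.zero    = refl
  +ε-comm (x ∷ σ) (Fin.suc i) (Fin.suc j) = cong (x ∷_) (+ε-comm σ i j)

  +ε-injective : ∀ {m} {σ τ : Vec ℕ m} i → σ +ε i ≡ τ +ε i → σ ≡ τ
  +ε-injective {σ = x ∷ σ} {y ∷ τ} Fin.zero    refl = refl
  +ε-injective {σ = x ∷ σ} {y ∷ τ} (Fin.suc i) p =
    cong₂ _∷_ (cong Vec.head p) (+ε-injective i (cong Vec.tail p))

  -- Supplies the bottom corner of the square on which two ways to reach the same index are
  -- compared.
  +ε-diamond : ∀ {m} (σ τ : Vec ℕ m) {i h} → i ≢ h → σ +ε i ≡ τ +ε h → ∃[ ρ ] σ ≡ ρ +ε h × τ ≡ ρ +ε i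
  +ε-diamond (x ∷ σ) (y ∷ τ) {Fin.zero}  {Fin.zero}  i≢h p = ⊥-elim (i≢h refl)
  +ε-diamond (x ∷ σ) (y ∷ τ) {Fin.zero}  {Fin.suc h} i≢h refl = x ∷ τ , refl , refl
  +ε-diamond (x ∷ σ) (y ∷ τ) {Fin.suc i} {Fin.zero}  i≢h refl = y ∷ σ , refl , refl
  +ε-diamond (x ∷ σ) (y ∷ τ) {Fin.suc i} {Fin.suc h} i≢h p with +ε-diamond σ τ (λ { refl → i≢h refl }) (cong Vec.tail p)
  ... | ρ , refl , refl = x ∷ ρ , refl , cong₂ _∷_ (cong Vec.head (sym p)) refl

  ≤ᵥ-refl : ∀ {m} {σ : Vec ℕ m} → σ ≤ᵥ σ
  ≤ᵥ-refl = Pointwise.refl ℕ.≤-refl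

  ≤ᵥ-trans : ∀ {m} {ρ σ τ : Vec ℕ m} → ρ ≤ᵥ σ → σ ≤ᵥ τ → ρ ≤ᵥ τ
  ≤ᵥ-trans = Pointwise.trans ℕ.≤-trans

  ≤ᵥ-+ε : ∀ {m} (σ : Vec ℕ m) i → σ ≤ᵥ σ +ε i
  ≤ᵥ-+ε (x ∷ σ) Fin.zero    = ℕ.n≤1+n x ∷ ≤ᵥ-refl
  ≤ᵥ-+ε (x ∷ σ) (Fin.suc i) = ℕ.≤-refl ∷ ≤ᵥ-+ε σ i

  -- The induction principle for climbing from `τ` to `σ` by single increments.
  ≤ᵥ⇒≡⊎+ε : ∀ {m} {τ σ : Vec ℕ m} → τ ≤ᵥ σ → τ ≡ σ ⊎ (∃[ i ] ∃[ ρ ] ρ +ε i ≡ σ × τ ≤ᵥ ρ)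
  ≤ᵥ⇒≡⊎+ε [] = inj₁ refl
  ≤ᵥ⇒≡⊎+ε (_∷_ {y = zero} z≤n p) with ≤ᵥ⇒≡⊎+ε p
  ... | inj₁ refl = inj₁ refl
  ... | inj₂ (i , ρ , refl , q) = inj₂ (Fin.suc i , zero ∷ ρ , refl , z≤n ∷ q)
  ≤ᵥ⇒≡⊎+ε (_∷_ {x = x} {y = suc y} x≤y p) with ℕ.m≤n⇒m<n∨m≡n x≤y
  ... | inj₁ (s≤s x≤y) = inj₂ (Fin.zero , y ∷ _ , refl , x≤y ∷ p)
  ... | inj₂ refl with ≤ᵥ⇒≡⊎+ε p
  ...   | inj₁ refl = inj₁ refl
  ...   | inj₂ (i , ρ , refl , q) = inj₂ (Fin.suc i , suc y ∷ ρ , refl , ℕ.≤-refl ∷ q)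

  ≤ᵥ⇒∣∣≤ : ∀ {m} {τ σ : Vec ℕ m} → τ ≤ᵥ σ → ∣ τ ∣ ≤ ∣ σ ∣
  ≤ᵥ⇒∣∣≤ [] = z≤n
  ≤ᵥ⇒∣∣≤ (p ∷ q) = ℕ.+-mono-≤ p (≤ᵥ⇒∣∣≤ q)

  ≤ᵥ-∣∣≡⇒≡ : ∀ {m} {τ σ : Vec ℕ m} → τ ≤ᵥ σ → ∣ τ ∣ ≡ ∣ σ ∣ → τ ≡ σ
  ≤ᵥ-∣∣≡⇒≡ {σ = σ} p q with ≤ᵥ⇒≡⊎+ε p
  ... | inj₁ r = r
  ... | inj₂ (i , ρ , refl , r) = ⊥-elim (ℕ.<-irrefl q (subst (_ <_) (sym (∣+ε∣ ρ i)) (s≤s (≤ᵥ⇒∣∣≤ r))))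

  ≤ᵥ-+ε-lower : ∀ {m} {ρ : Vec ℕ m} σ h → ρ ≤ᵥ σ +ε h → lookup ρ h ≤ lookup σ h → ρ ≤ᵥ σ
  ≤ᵥ-+ε-lower (x ∷ σ) Fin.zero    (p ∷ q) r = r ∷ q
  ≤ᵥ-+ε-lower (x ∷ σ) (Fin.suc h) (p ∷ q) r = p ∷ ≤ᵥ-+ε-lower σ h q r

  -- By pigeonhole some entry of `σ` is larger than that of `μ`. Since `τ` is `σ` lowered at that
  -- entry, the strict inequality there becomes a weak one.
  exceeds : ∀ {m} (μ σ : Vec ℕ m) → ∣ μ ∣ < ∣ σ ∣ → ∃[ h ] ∃[ τ ] τ +ε h ≡ σ × lookup μ h ≤ lookup τ h
  exceeds (x ∷ μ) (y ∷ σ) p with x ℕ.<? y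
  ... | yes (s≤s x≤y) = Fin.zero , _ ∷ σ , refl , x≤y
  ... | no x≮y with exceeds μ σ (ℕ.+-cancelˡ-< x _ _ (ℕ.<-≤-trans p (ℕ.+-monoˡ-≤ ∣ σ ∣ (ℕ.≮⇒≥ x≮y))))
  ...   | h , τ , refl , q = Fin.suc h , y ∷ τ , refl , q

  infixl 6 _⁺_
  _⁺_ : ∀ {m n} → Index m n → Fin m → Index m n
  (σ , k) ⁺ i = σ +ε i , k

  ⁺-comm : ∀ {m n} (v : Index m n) i j → v ⁺ i ⁺ j ≡ v ⁺ j ⁺ i
  ⁺-comm (σ , k) i j = cong (_, k) (+ε-comm σ i j)

  ⁺-injective : ∀ {m n} {u v : Index m n} i → u ⁺ i ≡ v ⁺ i → u ≡ v
  ⁺-injective i p = cong₂ _,_ (+ε-injective i (cong proj₁ p)) (cong proj₂ p)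

  degree-⁺ : ∀ {m n} (v : Index m n) i → degree (v ⁺ i) ≡ suc (degree v)
  degree-⁺ (σ , k) i = ∣+ε∣ σ i

  init-∣∣-injective : ∀ {m} (σ τ : Vec ℕ (suc m)) → ∣ σ ∣ ≡ ∣ τ ∣ → init σ ≡ init τ → σ ≡ τ
  init-∣∣-injective {zero} (x ∷ []) (y ∷ []) p q =
    cong (_∷ []) (trans (sym (ℕ.+-identityʳ x)) (trans p (ℕ.+-identityʳ y)))
  init-∣∣-injective {suc m} (x ∷ σ) (y ∷ τ) p q with cong Vec.head q
  ... | refl = cong (x ∷_) (init-∣∣-injective σ τ (ℕ.+-cancelˡ-≡ x _ _ p) (cong Vec.tail q))

  key-injective : ∀ {m n} {u v : Index (suc m) n} → key u ≡ key v → u ≡ v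
  key-injective {u = ξ , k} {η , g} p =
    cong₂ _,_ (init-∣∣-injective ξ η (cong Vec.head p) (cong (λ w → Vec.tail (Vec.tail w)) p))
              (Fin.toℕ-injective (cong (λ w → Vec.head (Vec.tail w)) p))

  init-+ε-mono : ∀ {m} (σ τ : Vec ℕ (suc m)) i → Lex-< _≡_ _<_ (init σ) (init τ) →
                 Lex-< _≡_ _<_ (init (σ +ε i)) (init (τ +ε i))
  init-+ε-mono {zero}  (x ∷ []) (y ∷ []) i (base ())
  init-+ε-mono {suc m} (x ∷ σ)  (y ∷ τ)  Fin.zero    (this p q) = this (s≤s p) q
  init-+ε-mono {suc m} (x ∷ σ)  (y ∷ τ)  Fin.zero    (next p q) = next (cong suc p) q
  init-+ε-mono {suc m} (x ∷ σ)  (y ∷ τ)  (Fin.suc i) (this p q) = this p refl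
  init-+ε-mono {suc m} (x ∷ σ)  (y ∷ τ)  (Fin.suc i) (next p q) = next p (init-+ε-mono σ τ i q)

  ⊲-⁺ : ∀ {m n} (u v : Index (suc m) n) i → u ⊲ v → u ⁺ i ⊲ v ⁺ i
  ⊲-⁺ (ξ , k) (η , g) i (this p q) rewrite ∣+ε∣ ξ i | ∣+ε∣ η i = this (s≤s p) refl
  ⊲-⁺ (ξ , k) (η , g) i (next p (this q r)) rewrite ∣+ε∣ ξ i | ∣+ε∣ η i = next (cong suc p) (this q refl)
  ⊲-⁺ (ξ , k) (η , g) i (next p (next q r)) rewrite ∣+ε∣ ξ i | ∣+ε∣ η i = next (cong suc p) (next q (init-+ε-mono ξ η i r))

  numeral : ∀ {l} → ℕ → Vec ℕ l → ℕ
  numeral B []               = 0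
  numeral B (_∷_ {n = l} x w) = x * B ^ l + numeral B w

  numeral-< : ∀ {l} B {w : Vec ℕ l} → Allᵥ (_< B) w → numeral B w < B ^ l
  numeral-< B []                         = s≤s z≤n
  numeral-< {suc l} B {x ∷ w} (p ∷ q) = begin-strict
    x * B ^ l + numeral B w   <⟨ ℕ.+-monoʳ-< (x * B ^ l) (numeral-< B q) ⟩
    x * B ^ l + B ^ l         ≡⟨ ℕ.+-comm (x * B ^ l) (B ^ l) ⟩
    suc x * B ^ l             ≤⟨ ℕ.*-monoˡ-≤ (B ^ l) p ⟩
    B * B ^ l                 ∎
    where open ℕ.≤-Reasoning

  -- Only the smaller number has to have proper digits: its tail must not make up for the smaller
  -- digit in front.
  numeral-mono : ∀ {l} B {v w : Vec ℕ l} → Allᵥ (_< B) v → Lex-< _≡_ _<_ v w → numeral B v < numeral B w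
  numeral-mono B p (base ())
  numeral-mono {suc l} B {x ∷ v} {y ∷ w} (p ∷ q) (this x<y _) = begin-strict
    x * B ^ l + numeral B v   <⟨ ℕ.+-monoʳ-< (x * B ^ l) (numeral-< B q) ⟩
    x * B ^ l + B ^ l         ≡⟨ ℕ.+-comm (x * B ^ l) (B ^ l) ⟩
    suc x * B ^ l             ≤⟨ ℕ.*-monoˡ-≤ (B ^ l) x<y ⟩
    y * B ^ l                 ≤⟨ ℕ.m≤m+n _ _ ⟩
    y * B ^ l + numeral B w   ∎
    where open ℕ.≤-Reasoning
  numeral-mono {suc l} B {x ∷ v} (p ∷ q) (next refl r) = ℕ.+-monoʳ-< (x * B ^ l) (numeral-mono B q r)

  init-entries : ∀ {m} (σ : Vec ℕ (suc m)) {B} → ∣ σ ∣ < B → Allᵥ (_< B) (init σ)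
  init-entries {zero}  (x ∷ []) p = []
  init-entries {suc m} (x ∷ σ)  p = ℕ.≤-<-trans (ℕ.m≤m+n x _) p ∷ init-entries σ (ℕ.≤-<-trans (ℕ.m≤n+m _ x) p)

  module _ {m n : ℕ} where

    private
      digits : Index (suc m) n → Vec ℕ (suc m)
      digits (ξ , k) = toℕ k ∷ init ξ

      -- In degree `d` the digits are `toℕ k`, which is below `n`, and entries of an exponent, which
      -- are at most `d`; `n + suc d` exceeds both. The offset reserves all numbers with `suc m`
      -- digits for each smaller degree. With `⊲` embedded in the natural numbers, the rings can be
      -- stacked in a sequence and the inductions run over numbers.
      radix offset : ℕ → ℕ
      radix d = n + suc d
      offset zero    = 0
      offset (suc d) = offset d + radix d ^ suc m

      digits-< : ∀ v → Allᵥ (_< radix (degree v)) (digits v)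
      digits-< (ξ , k) = ℕ.<-≤-trans (Fin.toℕ<n k) (ℕ.m≤m+n n _) ∷ init-entries ξ (ℕ.m≤n+m _ n)

      offset-mono : ∀ {d e} → d ≤ e → offset d ≤ offset e
      offset-mono {zero}  p = z≤n
      offset-mono {suc d} {suc e} p with ℕ.m≤n⇒m<n∨m≡n p
      ... | inj₁ (s≤s q) = ℕ.≤-trans (offset-mono q) (ℕ.m≤m+n (offset e) _)
      ... | inj₂ refl = ℕ.≤-refl

    abstract
      -- Indices of degree d are numbered in base n + d + 1, after those of lower degree.
      rank : Index (suc m) n → ℕ
      rank v = offset (degree v) + numeral (radix (degree v)) (digits v)

      degree<⇒rank< : ∀ u v → degree u < degree v → rank u < rank v
      degree<⇒rank< u v p = begin-strict
        rank u                                                 <⟨ ℕ.+-monoʳ-< (offset (degree u)) (numeral-< (radix (degree u)) (digits-< u)) ⟩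
        offset (suc (degree u))                                ≤⟨ offset-mono p ⟩
        offset (degree v)                                      ≤⟨ ℕ.m≤m+n _ _ ⟩
        rank v                                                 ∎
        where open ℕ.≤-Reasoning

      ⊲⇒rank< : ∀ u v → u ⊲ v → rank u < rank v
      ⊲⇒rank< u v (this p _) = degree<⇒rank< u v p
      ⊲⇒rank< u v (next p q) = begin-strict
        offset (degree u) + numeral (radix (degree u)) (digits u) <⟨ ℕ.+-monoʳ-< (offset (degree u)) (numeral-mono (radix (degree u)) (digits-< u) q) ⟩
        offset (degree u) + numeral (radix (degree u)) (digits v) ≡⟨ cong (λ d → offset d + numeral (radix d) (digits v)) p ⟩
        rank v ∎
        where open ℕ.≤-Reasoning

      ⊲-cases : ∀ (u v : Index (suc m) n) → u ⊲ v ⊎ u ≡ v ⊎ v ⊲ u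
      ⊲-cases u v with Lex.<-cmp sym ℕ.<-cmp (key u) (key v)
      ... | tri< p _ _ = inj₁ p
      ... | tri≈ _ p _ = inj₂ (inj₁ (key-injective (Pointwise-≡⇒≡ p)))
      ... | tri> _ _ p = inj₂ (inj₂ p)

      rank<⇒⊲ : ∀ u v → rank u < rank v → u ⊲ v
      rank<⇒⊲ u v p with ⊲-cases u v
      ... | inj₁ q = q
      ... | inj₂ (inj₁ refl) = ⊥-elim (ℕ.<-irrefl refl p)
      ... | inj₂ (inj₂ q) = ⊥-elim (ℕ.<-asym p (⊲⇒rank< v u q))

      rank-injective : ∀ u v → rank u ≡ rank v → u ≡ v
      rank-injective u v p with ⊲-cases u v
      ... | inj₁ q = ⊥-elim (ℕ.<-irrefl p (⊲⇒rank< u v q))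
      ... | inj₂ (inj₁ refl) = refl
      ... | inj₂ (inj₂ q) = ⊥-elim (ℕ.<-irrefl (sym p) (⊲⇒rank< v u q))

      rank-⁺-mono : ∀ u v i → rank u < rank v → rank (u ⁺ i) < rank (v ⁺ i)
      rank-⁺-mono u v i p = ⊲⇒rank< (u ⁺ i) (v ⁺ i) (⊲-⁺ u v i (rank<⇒⊲ u v p))

      rank-⁺-reflect : ∀ u v i → rank (u ⁺ i) < rank (v ⁺ i) → rank u < rank v
      rank-⁺-reflect u v i p with ℕ.<-cmp (rank u) (rank v)
      ... | tri< q _ _ = q
      ... | tri≈ _ q _ = ⊥-elim (ℕ.<-irrefl (cong (λ w → rank (w ⁺ i)) (rank-injective u v q)) p)
      ... | tri> _ _ q = ⊥-elim (ℕ.<-asym p (rank-⁺-mono v u i q))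

      rank-<-⁺ : ∀ v i → rank v < rank (v ⁺ i)
      rank-<-⁺ v i = degree<⇒rank< v (v ⁺ i) (ℕ.≤-reflexive (sym (degree-⁺ v i)))

      rank≤⇒degree≤ : ∀ u v → rank u ≤ rank v → degree u ≤ degree v
      rank≤⇒degree≤ u v p = ℕ.≮⇒≥ λ q → ℕ.≤⇒≯ p (degree<⇒rank< v u q)

      rank≤⇒⊴ : ∀ u v → rank u ≤ rank v → u ⊴ v
      rank≤⇒⊴ u v p with ℕ.m≤n⇒m<n∨m≡n p
      ... | inj₁ q = Lex.<⇒≤ (rank<⇒⊲ u v q)
      ... | inj₂ q rewrite rank-injective u v q = Lex.≤-refl (Pointwise.refl refl)

open Indices

-- Maps of coefficient lists, and differential polynomials as expressions.

module _ {c ℓ c′ ℓ′} (A : RawRing c ℓ) (C : CommutativeRing c′ ℓ′)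
         (φ : RawRing.Carrier A → CommutativeRing.Carrier C) where
  private module A = RawRing A
  open CommutativeRing C
  open PolynomialRing C
  private module UA = Univariate A

  module _ (φ-+ : ∀ x y → φ (x A.+ y) ≈ φ x + φ y) where

    -- The source is a `RawRing` so that it can be the syntax of expressions, where the ring laws
    -- fail, as well as a field `K⟮ P ⟯`.
    map-⊕ : ∀ f g → map φ (f UA.⊕ g) ≋ map φ f ⊕ map φ g
    map-⊕ []      g       = ≋-refl
    map-⊕ (x ∷ f) []      = ≋-refl
    map-⊕ (x ∷ f) (y ∷ g) = ∷-cong (φ-+ x y) (map-⊕ f g)

    module _ (φ-* : ∀ x y → φ (x A.* y) ≈ φ x * φ y) (φ-0 : φ A.0# ≈ 0#) where

      map-scale : ∀ x g → map φ (map (x A.*_) g) ≋ map (φ x *_) (map φ g)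
      map-scale x []      = ≋-refl
      map-scale x (y ∷ g) = ∷-cong (φ-* x y) (map-scale x g)

      map-⊗ : ∀ f g → map φ (f UA.⊗ g) ≋ map φ f ⊗ map φ g
      map-⊗ []      g = ≋-refl
      map-⊗ (x ∷ f) g = ≋-trans (map-⊕ (map (x A.*_) g) (A.0# ∷ f UA.⊗ g))
        (⊕-cong (map-scale x g) (∷-cong φ-0 (map-⊗ f g)))

module Expressions {c ℓ₁ ℓ₂ m} (K : DifferentialField c ℓ₁ ℓ₂ (suc m)) (n : ℕ) where
  module K where
    open DifferentialField K public
    open HeytingField heytingField public using (heytingCommutativeRing)
    open HeytingCommutativeRing heytingCommutativeRing public using (commutativeRing)

  private module ∂ (i : Fin (suc m)) = IsDerivation (K.isDerivation i)
  module _ (i : Fin (suc m)) where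
    open DerivationProperties.OfDerivation K.commutativeRing (∂.D-cong i) (∂.D-+ i) (∂.D-* i) public
      renaming (δ-0 to ∂-0; δ-1 to ∂-1; δ-neg to ∂-neg)

  V : Set
  V = Index (suc m) n

  infixl 6 _⊞_
  infixl 7 _⊠_
  infix  8 ⊟_
  -- Differential polynomials are kept as syntax: `D` and `∂/∂` become plain recursions, and the
  -- various rings (values at `a`, values at a stage, the limit, dual numbers) are congruences on
  -- one and the same carrier.
  data Expr : Set c where
    con     : K.Carrier → Expr
    var     : V → Expr
    _⊞_ _⊠_ : Expr → Expr → Expr
    ⊟_      : Expr → Expr

  In : Pred V 0ℓ → Expr → Set
  In P (con x) = ⊤
  In P (var v) = P v
  In P (e ⊞ f) = In P e × In P f
  In P (e ⊠ f) = In P e × In P f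
  In P (⊟ e)   = In P e

  In-map : ∀ {P Q : Pred V 0ℓ} → (∀ {v} → P v → Q v) → ∀ e → In P e → In Q e
  In-map h (con x) p       = tt
  In-map h (var v) p       = h p
  In-map h (e ⊞ f) (p , q) = In-map h e p , In-map h f q
  In-map h (e ⊠ f) (p , q) = In-map h e p , In-map h f q
  In-map h (⊟ e)   p       = In-map h e p

  In-∩ : ∀ {P Q : Pred V 0ℓ} e → In P e → In Q e → In (λ v → P v × Q v) e
  In-∩ (con x) p q = tt
  In-∩ (var v) p q = p , q
  In-∩ (e ⊞ f) (p , p′) (q , q′) = In-∩ e p q , In-∩ f p′ q′
  In-∩ (e ⊠ f) (p , p′) (q , q′) = In-∩ e p q , In-∩ f p′ q′
  In-∩ (⊟ e)   p q = In-∩ e p q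

  In-bounded : ∀ (ρ : V → ℕ) e → ∃[ N ] In (λ v → ρ v < N) e
  In-bounded ρ (con x) = 0 , tt
  In-bounded ρ (var v) = suc (ρ v) , ℕ.≤-refl
    where import Data.Nat.Properties as ℕ
  In-bounded ρ (⊟ e) = In-bounded ρ e
  In-bounded ρ (e ⊞ f) with In-bounded ρ e | In-bounded ρ f
  ... | M , p | N , q = M ℕ.⊔ N , In-map (λ r → ℕ.≤-trans r (ℕ.m≤m⊔n M N)) e p , In-map (λ r → ℕ.≤-trans r (ℕ.m≤n⊔m M N)) f q
    where import Data.Nat.Properties as ℕ
  In-bounded ρ (e ⊠ f) with In-bounded ρ e | In-bounded ρ f
  ... | M , p | N , q = M ℕ.⊔ N , In-map (λ r → ℕ.≤-trans r (ℕ.m≤m⊔n M N)) e p , In-map (λ r → ℕ.≤-trans r (ℕ.m≤n⊔m M N)) f q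
    where import Data.Nat.Properties as ℕ

  𝟘 𝟙 : Expr
  𝟘 = con K.0#
  𝟙 = con K.1#

  D : Fin (suc m) → Expr → Expr
  D i (con x) = con (K.∂ i x)
  D i (var v) = var (v ⁺ i)
  D i (e ⊞ f) = D i e ⊞ D i f
  D i (e ⊠ f) = D i e ⊠ f ⊞ e ⊠ D i f
  D i (⊟ e)   = ⊟ D i e

  In-D : ∀ {P Q : Pred V 0ℓ} i → (∀ {v} → P v → Q v) → (∀ {v} → P v → Q (v ⁺ i)) → ∀ e → In P e → In Q (D i e)
  In-D i h h′ (con x) p       = tt
  In-D i h h′ (var v) p       = h′ p
  In-D i h h′ (e ⊞ f) (p , q) = In-D i h h′ e p , In-D i h h′ f q
  In-D i h h′ (e ⊠ f) (p , q) = (In-D i h h′ e p , In-map h f q) , (In-map h e p , In-D i h h′ f q)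
  In-D i h h′ (⊟ e)   p       = In-D i h h′ e p

  -- What remains of `D i e` when the derivative of `var t` is replaced by zero. By `D-split` a
  -- relation `e` then differentiates to an equation for `var (t ⁺ i)` whose leading coefficient is
  -- the separant `∂/∂ t e`.
  D∖ : Fin (suc m) → V → Expr → Expr
  D∖ i t (con x) = con (K.∂ i x)
  D∖ i t (var v) with v ≟ᵢ t
  ... | yes _ = 𝟘
  ... | no _  = var (v ⁺ i)
  D∖ i t (e ⊞ f) = D∖ i t e ⊞ D∖ i t f
  D∖ i t (e ⊠ f) = D∖ i t e ⊠ f ⊞ e ⊠ D∖ i t f
  D∖ i t (⊟ e)   = ⊟ D∖ i t e

  In-D∖ : ∀ {P Q : Pred V 0ℓ} i t → (∀ {v} → P v → Q v) → (∀ {v} → P v → v ≢ t → Q (v ⁺ i)) → ∀ e → In P e → In Q (D∖ i t e)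
  In-D∖ i t h h′ (con x) p       = tt
  In-D∖ i t h h′ (var v) p       with v ≟ᵢ t
  ... | yes _  = tt
  ... | no v≢t = h′ p v≢t
  In-D∖ i t h h′ (e ⊞ f) (p , q) = In-D∖ i t h h′ e p , In-D∖ i t h h′ f q
  In-D∖ i t h h′ (e ⊠ f) (p , q) = (In-D∖ i t h h′ e p , In-map h f q) , (In-map h e p , In-D∖ i t h h′ f q)
  In-D∖ i t h h′ (⊟ e)   p       = In-D∖ i t h h′ e p

  ∂/∂ : V → Expr → Expr
  ∂/∂ t (con x) = 𝟘
  ∂/∂ t (var v) with v ≟ᵢ t
  ... | yes _ = 𝟙
  ... | no _  = 𝟘
  ∂/∂ t (e ⊞ f) = ∂/∂ t e ⊞ ∂/∂ t f
  ∂/∂ t (e ⊠ f) = ∂/∂ t e ⊠ f ⊞ e ⊠ ∂/∂ t f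
  ∂/∂ t (⊟ e)   = ⊟ ∂/∂ t e

  In-∂/∂ : ∀ {P : Pred V 0ℓ} t e → In P e → In P (∂/∂ t e)
  In-∂/∂ t (con x) p       = tt
  In-∂/∂ t (var v) p       with v ≟ᵢ t
  ... | yes _ = tt
  ... | no _  = tt
  In-∂/∂ t (e ⊞ f) (p , q) = In-∂/∂ t e p , In-∂/∂ t f q
  In-∂/∂ t (e ⊠ f) (p , q) = (In-∂/∂ t e p , q) , (p , In-∂/∂ t f q)
  In-∂/∂ t (⊟ e)   p       = In-∂/∂ t e p

  record Congruence ℓ : Set (lsuc (c ⊔ ℓ) ⊔ ℓ₁) where
    infix 4 _≈_
    field
      _≈_               : Rel Expr ℓ
      isCommutativeRing : IsCommutativeRing _≈_ _⊞_ _⊠_ ⊟_ 𝟘 𝟙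
      con-cong          : ∀ {x y} → x K.≈ y → con x ≈ con y
      con-+             : ∀ x y → con (x K.+ y) ≈ con x ⊞ con y
      con-*             : ∀ x y → con (x K.* y) ≈ con x ⊠ con y
      con-neg           : ∀ x → con (K.- x) ≈ ⊟ con x

    commutativeRing : CommutativeRing c ℓ
    commutativeRing = record { isCommutativeRing = isCommutativeRing }
    open CommutativeRing commutativeRing public hiding (_≈_; isCommutativeRing; Carrier; _+_; _*_; -_; 0#; 1#)

  exprRing : RawRing c c
  exprRing = record { Carrier = Expr ; _≈_ = _≡_ ; _+_ = _⊞_ ; _*_ = _⊠_ ; -_ = ⊟_ ; 0# = 𝟘 ; 1# = 𝟙 }

  module _ where
    open Univariate exprRing

    expand : V → Expr → List Expr
    expand v (con x) = con x ∷ []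
    expand v (var u) with u ≟ᵢ v
    ... | yes _ = 𝟘 ∷ 𝟙 ∷ []
    ... | no _  = var u ∷ []
    expand v (e ⊞ f) = expand v e ⊕ expand v f
    expand v (e ⊠ f) = expand v e ⊗ expand v f
    expand v (⊟ e)   = map ⊟_ (expand v e)

    module _ {P : Pred V 0ℓ} where

      In-⊕ : ∀ f g → All (In P) f → All (In P) g → All (In P) (f ⊕ g)
      In-⊕ []      g       ps       qs       = qs
      In-⊕ (x ∷ f) []      ps       qs       = ps
      In-⊕ (x ∷ f) (y ∷ g) (p ∷ ps) (q ∷ qs) = (p , q) ∷ In-⊕ f g ps qs

      In-scale : ∀ x → In P x → ∀ f → All (In P) f → All (In P) (map (x ⊠_) f)
      In-scale x p []      []       = []
      In-scale x p (y ∷ f) (q ∷ qs) = (p , q) ∷ In-scale x p f qs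

      In-⊗ : ∀ f g → All (In P) f → All (In P) g → All (In P) (f ⊗ g)
      In-⊗ []      g []       qs = []
      In-⊗ (x ∷ f) g (p ∷ ps) qs = In-⊕ (map (x ⊠_) g) (𝟘 ∷ f ⊗ g) (In-scale x p g qs) (tt ∷ In-⊗ f g ps qs)

      In-expand : ∀ v e → In (λ u → u ≢ v → P u) e → All (In P) (expand v e)
      In-expand v (con x) p = tt ∷ []
      In-expand v (var u) p with u ≟ᵢ v
      ... | yes _  = tt ∷ tt ∷ []
      ... | no u≢v = p u≢v ∷ []
      In-expand v (e ⊞ f) (p , q) = In-⊕ (expand v e) (expand v f) (In-expand v e p) (In-expand v f q)
      In-expand v (e ⊠ f) (p , q) = In-⊗ (expand v e) (expand v f) (In-expand v e p) (In-expand v f q)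
      In-expand v (⊟ e)   p       = negation (expand v e) (In-expand v e p)
        where
        negation : ∀ f → All (In P) f → All (In P) (map ⊟_ f)
        negation []      []       = []
        negation (x ∷ f) (p ∷ ps) = p ∷ negation f ps

  module CongruenceProperties {ℓ} (C : Congruence ℓ) where
    open Congruence C hiding (zero)
    open IntegerSolver commutativeRing
    open import Relation.Binary.Reasoning.Setoid setoid

    ∂/∂-≈𝟘 : ∀ t e → In (_≢ t) e → ∂/∂ t e ≈ 𝟘
    ∂/∂-≈𝟘 t (con x) p = refl
    ∂/∂-≈𝟘 t (var v) p with v ≟ᵢ t
    ... | yes q = ⊥-elim (p q)
    ... | no _  = refl
    ∂/∂-≈𝟘 t (e ⊞ f) (p , q) = trans (+-cong (∂/∂-≈𝟘 t e p) (∂/∂-≈𝟘 t f q)) (+-identityˡ 𝟘)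
    ∂/∂-≈𝟘 t (e ⊠ f) (p , q) = trans (+-cong (*-congʳ (∂/∂-≈𝟘 t e p)) (*-congˡ (∂/∂-≈𝟘 t f q)))
      (solve 2 (λ e f → :0 :* f :+ e :* :0 := :0) refl e f)
    ∂/∂-≈𝟘 t (⊟ e)   p = trans (-‿cong (∂/∂-≈𝟘 t e p)) (solve 0 (:- :0 := :0) refl)

    D-split : ∀ i t e → D i e ≈ ∂/∂ t e ⊠ var (t ⁺ i) ⊞ D∖ i t e
    D-split i t (con x) = solve 2 (λ a x → a := :0 :* x :+ a) refl _ _
    D-split i t (var v) with v ≟ᵢ t
    ... | yes ≡.refl = solve 1 (λ x → x := :1 :* x :+ :0) refl _
    ... | no _       = solve 2 (λ a x → a := :0 :* x :+ a) refl _ _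
    D-split i t (e ⊞ f) = trans (+-cong (D-split i t e) (D-split i t f))
      (solve 5 (λ p x a q b → (p :* x :+ a) :+ (q :* x :+ b) := (p :+ q) :* x :+ (a :+ b)) refl _ _ _ _ _)
    D-split i t (e ⊠ f) = trans (+-cong (*-congʳ (D-split i t e)) (*-congˡ (D-split i t f)))
      (solve 7 (λ p x a q b e f → (p :* x :+ a) :* f :+ e :* (q :* x :+ b) := (p :* f :+ e :* q) :* x :+ (a :* f :+ e :* b)) refl _ _ _ _ _ _ _)
    D-split i t (⊟ e)   = trans (-‿cong (D-split i t e))
      (solve 3 (λ p x a → :- (p :* x :+ a) := :- p :* x :+ :- a) refl _ _ _)

    -- In `D i e` the variable `t ⁺ i` arises only by differentiating `t`. So a relation and its
    -- derivative have the same separant, and separability is passed on to `t ⁺ i`.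
    ∂/∂-D : ∀ i t e → In (_≢ t ⁺ i) e → ∂/∂ (t ⁺ i) (D i e) ≈ ∂/∂ t e
    ∂/∂-D i t (con x) p = refl
    ∂/∂-D i t (var v) p with (v ⁺ i) ≟ᵢ (t ⁺ i) | v ≟ᵢ t
    ... | yes _ | yes _      = refl
    ... | yes q | no v≢t     = ⊥-elim (v≢t (⁺-injective i q))
    ... | no q  | yes ≡.refl = ⊥-elim (q ≡.refl)
    ... | no _  | no _       = refl
    ∂/∂-D i t (e ⊞ f) (p , q) = +-cong (∂/∂-D i t e p) (∂/∂-D i t f q)
    ∂/∂-D i t (e ⊠ f) (p , q) = trans
      (+-cong (+-cong (*-congʳ (∂/∂-D i t e p)) (*-congˡ (∂/∂-≈𝟘 (t ⁺ i) f q)))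
              (+-cong (*-congʳ (∂/∂-≈𝟘 (t ⁺ i) e p)) (*-congˡ (∂/∂-D i t f q))))
      (solve 6 (λ p q e f a b → (p :* f :+ a :* :0) :+ (:0 :* b :+ e :* q) := p :* f :+ e :* q) refl _ _ _ _ _ _)
    ∂/∂-D i t (⊟ e)   p = -‿cong (∂/∂-D i t e p)

    D-comm : ∀ i j e → D i (D j e) ≈ D j (D i e)
    D-comm i j (con x) = con-cong (K.∂-comm i j x)
    D-comm i j (var v) = reflexive (≡.cong var (⁺-comm v j i))
    D-comm i j (e ⊞ f) = +-cong (D-comm i j e) (D-comm i j f)
    D-comm i j (e ⊠ f) = trans
      (+-cong (+-congʳ (*-congʳ (D-comm i j e))) (+-congˡ (*-congˡ (D-comm i j f))))
      (solve 8 (λ e f p q a b s t → (p :* f :+ a :* b) :+ (s :* t :+ e :* q) := (p :* f :+ s :* t) :+ (a :* b :+ e :* q)) refl _ _ _ _ _ _ _ _)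
    D-comm i j (⊟ e)   = -‿cong (D-comm i j e)

    constant : ∀ e → In (λ _ → ⊥) e → Σ K.Carrier λ x → e ≈ con x
    constant (con x) p = x , refl
    constant (e ⊞ f) (p , q) with constant e p | constant f q
    ... | x , a | y , b = x K.+ y , trans (+-cong a b) (sym (con-+ x y))
    constant (e ⊠ f) (p , q) with constant e p | constant f q
    ... | x , a | y , b = x K.* y , trans (*-cong a b) (sym (con-* x y))
    constant (⊟ e) p with constant e p
    ... | x , a = K.- x , trans (-‿cong a) (sym (con-neg x))

    -- Equality of the dual numbers e + ε D i e.
    dual : Fin (suc m) → Congruence ℓ
    dual i = record
      { _≈_ = λ e f → e ≈ f × D i e ≈ D i f
      ; isCommutativeRing = mkIsCommutativeRing
          (record { refl = refl , refl
                  ; sym = λ (p , q) → sym p , sym q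
                  ; trans = λ (p , q) (p′ , q′) → trans p p′ , trans q q′ })
          (λ (p , q) (p′ , q′) → +-cong p p′ , +-cong q q′)
          (λ e f g → +-assoc e f g , +-assoc _ _ _)
          (λ e f → +-comm e f , +-comm _ _)
          (λ e → +-identityˡ e , trans (+-congʳ (con-cong (∂-0 i))) (+-identityˡ _))
          (λ (p , q) → -‿cong p , -‿cong q)
          (λ e → -‿inverseˡ e , trans (-‿inverseˡ _) (con-cong (K.sym (∂-0 i))))
          (λ (p , q) (p′ , q′) → *-cong p p′ , +-cong (*-cong q p′) (*-cong p q′))
          (λ e f g → *-assoc e f g , solve 6 (λ e f g a b c →
              (a :* f :+ e :* b) :* g :+ e :* f :* c := a :* (f :* g) :+ e :* (b :* g :+ f :* c)) refl e f g _ _ _)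
          (λ e f → *-comm e f , solve 4 (λ e f a b → a :* f :+ e :* b := b :* e :+ f :* a) refl e f _ _)
          (λ e → *-identityˡ e , trans (+-congʳ (*-congʳ (con-cong (∂-1 i)))) (solve 2 (λ e a → :0 :* e :+ :1 :* a := a) refl e _))
          (λ g e f → distribʳ g e f , solve 6 (λ e f g a b c →
              (a :+ b) :* g :+ (e :+ f) :* c := (a :* g :+ e :* c) :+ (b :* g :+ f :* c)) refl e f g _ _ _)
      ; con-cong = λ p → con-cong p , con-cong (∂.D-cong i p)
      ; con-+ = λ x y → con-+ x y , trans (con-cong (∂.D-+ i x y)) (con-+ _ _)
      ; con-* = λ x y → con-* x y , trans (con-cong (∂.D-* i x y))
                                      (trans (con-+ _ _) (+-cong (con-* _ _) (con-* _ _)))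
      ; con-neg = λ x → con-neg x , trans (con-cong (∂-neg i x)) (con-neg _) }

  record Domain ℓ : Set (lsuc (c ⊔ ℓ) ⊔ ℓ₁) where
    field
      congruence : Congruence ℓ
    open Congruence congruence public
    field
      𝟙≉𝟘 : ¬ 𝟙 ≈ 𝟘
      noZeroDivisors : ∀ {e f} → e ⊠ f ≈ 𝟘 → e ≈ 𝟘 ⊎ f ≈ 𝟘

    integralDomain : IntegralDomain c ℓ
    integralDomain = record { commutativeRing = commutativeRing ; 1≉0 = 𝟙≉𝟘 ; noZeroDivisors = noZeroDivisors }

  -- The predicate `λ u → u ≢ v → P u` is `P` with `v` adjoined. Closure under `D i` passes to it in
  -- two cases: `v` solves a linear equation over `P` that holds together with its derivative, or
  -- `v` is transcendental over `P`.
  module ExtendDerivation {ℓ} (𝔸 : Domain ℓ) (i : Fin (suc m)) (P : Pred V 0ℓ) (v : V)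
    (closed : ∀ e → In P e → Domain._≈_ 𝔸 e 𝟘 → Domain._≈_ 𝔸 (D i e) 𝟘) where
    open Domain 𝔸 hiding (zero)
    open CongruenceProperties congruence
    open DomainProperties integralDomain
    open IntegerSolver commutativeRing
    private module A₁ = Congruence (dual i)
    private module S₁ = IntegerSolver A₁.commutativeRing

    private
      -- Restates `closed`: an expression over `P` that vanishes also vanishes as a dual number.
      ≈𝟘⇒≈₁𝟘 : ∀ e → In P e → e ≈ 𝟘 → e A₁.≈ 𝟘
      ≈𝟘⇒≈₁𝟘 e p q = q , trans (closed e p q) (con-cong (K.sym (∂-0 i)))

    -- The factor σ is a power of s.
    module _ (s q : Expr) (In-s : In P s) (In-q : In P q) (s≉𝟘 : ¬ s ≈ 𝟘) (sv≈q : s ⊠ var v A₁.≈ q) where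

      eliminate : ∀ e → In (λ u → u ≢ v → P u) e →
                  Σ Expr λ σ → Σ Expr λ f → In P σ × In P f × ¬ σ ≈ 𝟘 × σ ⊠ e A₁.≈ f
      eliminate (con x) p = 𝟙 , con x , tt , tt , 𝟙≉𝟘 , A₁.*-identityˡ (con x)
      eliminate (var u) p with u ≟ᵢ v
      ... | yes ≡.refl = s , q , In-s , In-q , s≉𝟘 , sv≈q
      ... | no u≢v     = 𝟙 , var u , tt , p u≢v , 𝟙≉𝟘 , A₁.*-identityˡ (var u)
      eliminate (e ⊞ f) (p , p′) with eliminate e p | eliminate f p′
      ... | σ , g , a , b , σ≉𝟘 , σe≈g | τ , h , a′ , b′ , τ≉𝟘 , τf≈h =
        σ ⊠ τ , τ ⊠ g ⊞ σ ⊠ h , (a , a′) , ((a′ , b) , (a , b′)) , *-≉0 σ≉𝟘 τ≉𝟘 ,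
        A₁.trans (S₁.solve 4 (λ σ τ e f → σ S₁.:* τ S₁.:* (e S₁.:+ f) S₁.:= τ S₁.:* (σ S₁.:* e) S₁.:+ σ S₁.:* (τ S₁.:* f)) A₁.refl σ τ e f)
                 (A₁.+-cong (A₁.*-congˡ {τ} σe≈g) (A₁.*-congˡ {σ} τf≈h))
      eliminate (e ⊠ f) (p , p′) with eliminate e p | eliminate f p′
      ... | σ , g , a , b , σ≉𝟘 , σe≈g | τ , h , a′ , b′ , τ≉𝟘 , τf≈h =
        σ ⊠ τ , g ⊠ h , (a , a′) , (b , b′) , *-≉0 σ≉𝟘 τ≉𝟘 ,
        A₁.trans (S₁.solve 4 (λ σ τ e f → σ S₁.:* τ S₁.:* (e S₁.:* f) S₁.:= (σ S₁.:* e) S₁.:* (τ S₁.:* f)) A₁.refl σ τ e f)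
                 (A₁.*-cong σe≈g τf≈h)
      eliminate (⊟ e) p with eliminate e p
      ... | σ , g , a , b , σ≉𝟘 , σe≈g =
        σ , ⊟ g , a , b , σ≉𝟘 ,
        A₁.trans (S₁.solve 2 (λ σ e → σ S₁.:* (S₁.:- e) S₁.:= S₁.:- (σ S₁.:* e)) A₁.refl σ e) (A₁.-‿cong σe≈g)

      -- In the dual numbers `σ ⊠ e` equals some `f` over `P`. If `e` vanishes, so does `f`, hence
      -- also `D i f`; the ε-part of the equation then reads `σ ⊠ D i e ≈ 𝟘`, and `σ` cancels.
      extend-rational : ∀ e → In (λ u → u ≢ v → P u) e → e ≈ 𝟘 → D i e ≈ 𝟘
      extend-rational e p e≈𝟘 with eliminate e p
      ... | σ , f , a , b , σ≉𝟘 , (σe≈f , Dσe≈Df) = cancel-≈0 σ≉𝟘 (trans (sym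
              (trans (+-congʳ (trans (*-congˡ e≈𝟘) (zeroʳ _))) (+-identityˡ _)))
              (trans Dσe≈Df (closed f b (trans (sym σe≈f) (trans (*-congˡ e≈𝟘) (zeroʳ σ))))))

    -- As a dual number, `e` is the Horner value of its expansion at `var v`. The coefficients lie
    -- over `P`, so they vanish as dual numbers, whatever the derivative of `v` is.
    extend-free : ∀ e → In (λ u → u ≢ v → P u) e → All (_≈ 𝟘) (expand v e) → D i e ≈ 𝟘
    extend-free e p zeros = trans (proj₂ (A₁.trans (≈horner e) (horner-≈𝟘 (expand v e) zeros (In-expand v e p))))
                                  (con-cong (∂-0 i))
      where
      X : List Expr → Expr
      -- The `map id` carries lists combined by the operations of `exprRing` to polynomials over the
      -- dual numbers; this is the form in which `map-⊕` and `map-⊗` apply.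
      X f = horner A₁.commutativeRing (var v) (map id f)

      open PolynomialRing A₁.commutativeRing using (_≋_)

      X-cong : ∀ f g → map id f ≋ g → X f A₁.≈ horner A₁.commutativeRing (var v) g
      X-cong f g r = horner-cong A₁.commutativeRing (var v) (map id f) g r

      horner-≈𝟘 : ∀ f → All (_≈ 𝟘) f → All (In P) f → X f A₁.≈ 𝟘
      horner-≈𝟘 [] [] [] = A₁.refl
      horner-≈𝟘 (x ∷ f) (z ∷ zs) (q ∷ qs) = A₁.trans
        (A₁.+-cong (≈𝟘⇒≈₁𝟘 x q z) (A₁.trans (A₁.*-congˡ {var v} (horner-≈𝟘 f zs qs)) (A₁.zeroʳ (var v))))
        (A₁.+-identityˡ 𝟘)

      ≈horner : ∀ e → e A₁.≈ X (expand v e)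
      ≈horner (con x) = S₁.solve 2 (λ a x → a S₁.:= a S₁.:+ x S₁.:* S₁.:0) A₁.refl (con x) (var v)
      ≈horner (var u) with u ≟ᵢ v
      ... | yes ≡.refl = S₁.solve 1 (λ x → x S₁.:= S₁.:0 S₁.:+ x S₁.:* (S₁.:1 S₁.:+ x S₁.:* S₁.:0)) A₁.refl (var v)
      ... | no _       = S₁.solve 2 (λ a x → a S₁.:= a S₁.:+ x S₁.:* S₁.:0) A₁.refl (var u) (var v)
      ≈horner (e ⊞ f) = A₁.trans (A₁.+-cong (≈horner e) (≈horner f)) (A₁.sym (A₁.trans
        (X-cong (expand v (e ⊞ f)) _ (map-⊕ exprRing A₁.commutativeRing id (λ _ _ → A₁.refl) (expand v e) (expand v f)))
        (horner-⊕ A₁.commutativeRing (var v) (map id (expand v e)) (map id (expand v f)))))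
      ≈horner (e ⊠ f) = A₁.trans (A₁.*-cong (≈horner e) (≈horner f)) (A₁.sym (A₁.trans
        (X-cong (expand v (e ⊠ f)) _ (map-⊗ exprRing A₁.commutativeRing id (λ _ _ → A₁.refl) (λ _ _ → A₁.refl) A₁.refl (expand v e) (expand v f)))
        (horner-⊗ A₁.commutativeRing (var v) (map id (expand v e)) (map id (expand v f)))))
      ≈horner (⊟ e) = A₁.trans (A₁.-‿cong (≈horner e)) (negation (expand v e))
        where
        negation : ∀ f → ⊟ X f A₁.≈ X (map ⊟_ f)
        negation [] = S₁.solve 0 (S₁.:- S₁.:0 S₁.:= S₁.:0) A₁.refl
        negation (x ∷ f) = A₁.trans
          (S₁.solve 3 (λ x v a → S₁.:- (x S₁.:+ v S₁.:* a) S₁.:= S₁.:- x S₁.:+ v S₁.:* (S₁.:- a)) A₁.refl x (var v) (X f))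
          (A₁.+-congˡ {⊟ x} (A₁.*-congˡ {var v} (negation f)))

  module Model {c′ ℓ′} (R : CommutativeRing c′ ℓ′) (hom : RingHomomorphism K.rawRing (CommutativeRing.rawRing R))
               (b : V → CommutativeRing.Carrier R) where
    open CommutativeRing R
    open RingHomomorphism hom

    ev : Expr → Carrier
    ev (con x) = ⟦ x ⟧
    ev (var v) = b v
    ev (e ⊞ f) = ev e + ev f
    ev (e ⊠ f) = ev e * ev f
    ev (⊟ e)   = - ev e

    kernel : Congruence ℓ′
    kernel = record
      { _≈_ = λ e f → ev e ≈ ev f
      ; isCommutativeRing = mkIsCommutativeRing
          (record { refl = refl ; sym = sym ; trans = trans })
          +-cong (λ _ _ _ → +-assoc _ _ _) (λ _ _ → +-comm _ _)
          (λ _ → trans (+-congʳ 0#-homo) (+-identityˡ _))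
          -‿cong (λ _ → trans (-‿inverseˡ _) (sym 0#-homo))
          *-cong (λ _ _ _ → *-assoc _ _ _) (λ _ _ → *-comm _ _)
          (λ _ → trans (*-congʳ 1#-homo) (*-identityˡ _))
          (λ _ _ _ → distribʳ _ _ _)
      ; con-cong = ⟦⟧-cong
      ; con-+ = +-homo
      ; con-* = *-homo
      ; con-neg = -‿homo }

  module _ (r : ℕ) where

    -- The shape of `D i e` when `e` has order below `r`: degree at most one in the variables `P`,
    -- with coefficients of order below `r`. Being syntactic, it allows the coefficient of a
    -- variable to be read off by recursion.
    data Affine (P : Pred V 0ℓ) : Pred Expr c where
      base : ∀ {e} → In (λ u → degree u < r) e → Affine P e
      var  : ∀ {v} → P v → Affine P (var v)
      add  : ∀ {e f} → Affine P e → Affine P f → Affine P (e ⊞ f)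
      mulˡ : ∀ {e f} → In (λ u → degree u < r) e → Affine P f → Affine P (e ⊠ f)
      mulʳ : ∀ {e f} → Affine P e → In (λ u → degree u < r) f → Affine P (e ⊠ f)
      neg  : ∀ {e} → Affine P e → Affine P (⊟ e)

    Affine-map : ∀ {P Q : Pred V 0ℓ} → (∀ {v} → P v → Q v) → ∀ {e} → Affine P e → Affine Q e
    Affine-map h (base p)   = base p
    Affine-map h (var p)    = var (h p)
    Affine-map h (add a b)  = add (Affine-map h a) (Affine-map h b)
    Affine-map h (mulˡ p a) = mulˡ p (Affine-map h a)
    Affine-map h (mulʳ a p) = mulʳ (Affine-map h a) p
    Affine-map h (neg a)    = neg (Affine-map h a)

    Affine⇒In : ∀ {P Q : Pred V 0ℓ} → (∀ {v} → P v → Q v) → (∀ {v} → degree v < r → Q v) → ∀ {e} → Affine P e → In Q e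
    Affine⇒In h h′ {e} (base p)   = In-map h′ e p
    Affine⇒In h h′ (var p)        = h p
    Affine⇒In h h′ (add a b)      = Affine⇒In h h′ a , Affine⇒In h h′ b
    Affine⇒In h h′ {e ⊠ f} (mulˡ p a) = In-map h′ e p , Affine⇒In h h′ a
    Affine⇒In h h′ {e ⊠ f} (mulʳ a p) = Affine⇒In h h′ a , In-map h′ f p
    Affine⇒In h h′ (neg a)        = Affine⇒In h h′ a

    Affine-D : ∀ {P : Pred V 0ℓ} i e → In (λ u → degree u < r) e →
               In (λ u → degree (u ⁺ i) < r ⊎ P (u ⁺ i)) e → Affine P (D i e)
    Affine-D i (con x) p q = base tt
    Affine-D i (var v) p (inj₁ q) = base q
    Affine-D i (var v) p (inj₂ q) = var q
    Affine-D i (e ⊞ f) (p , p′) (q , q′) = add (Affine-D i e p q) (Affine-D i f p′ q′)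
    Affine-D i (e ⊠ f) (p , p′) (q , q′) = add (mulʳ (Affine-D i e p q) p′) (mulˡ p (Affine-D i f p′ q′))
    Affine-D i (⊟ e) p q = neg (Affine-D i e p q)

    Affine-D∖ : ∀ {P : Pred V 0ℓ} i t e → In (λ u → degree u < r) e →
               In (λ u → u ≢ t → degree (u ⁺ i) < r ⊎ P (u ⁺ i)) e → Affine P (D∖ i t e)
    Affine-D∖ i t (con x) p q = base tt
    Affine-D∖ i t (var v) p q with v ≟ᵢ t
    ... | yes _ = base tt
    ... | no v≢t with q v≢t
    ...   | inj₁ q′ = base q′
    ...   | inj₂ q′ = var q′
    Affine-D∖ i t (e ⊞ f) (p , p′) (q , q′) = add (Affine-D∖ i t e p q) (Affine-D∖ i t f p′ q′)
    Affine-D∖ i t (e ⊠ f) (p , p′) (q , q′) = add (mulʳ (Affine-D∖ i t e p q) p′) (mulˡ p (Affine-D∖ i t f p′ q′))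
    Affine-D∖ i t (⊟ e) p q = neg (Affine-D∖ i t e p q)

    module _ {P : Pred V 0ℓ} (v : V) where

      slope rest : ∀ {e} → Affine P e → Expr
      slope (base p)          = 𝟘
      slope (var {u} p) with u ≟ᵢ v
      ... | yes _ = 𝟙
      ... | no _  = 𝟘
      slope (add a b)         = slope a ⊞ slope b
      slope (mulˡ {e} p a)    = e ⊠ slope a
      slope (mulʳ {f = f} a p) = slope a ⊠ f
      slope (neg a)           = ⊟ slope a

      rest (base {e} p)       = e
      rest (var {u} p) with u ≟ᵢ v
      ... | yes _ = 𝟘
      ... | no _  = var u
      rest (add a b)          = rest a ⊞ rest b
      rest (mulˡ {e} p a)     = e ⊠ rest a
      rest (mulʳ {f = f} a p) = rest a ⊠ f
      rest (neg a)            = ⊟ rest a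

      In-slope : ∀ {e} (a : Affine P e) → In (λ u → degree u < r) (slope a)
      In-slope (base p)   = tt
      In-slope (var {u} p) with u ≟ᵢ v
      ... | yes _ = tt
      ... | no _  = tt
      In-slope (add a b)  = In-slope a , In-slope b
      In-slope (mulˡ p a) = p , In-slope a
      In-slope (mulʳ a p) = In-slope a , p
      In-slope (neg a)    = In-slope a

      Affine-rest : ∀ {Q : Pred V 0ℓ} → (∀ {u} → P u → u ≢ v → Q u) → ∀ {e} (a : Affine P e) → Affine Q (rest a)
      Affine-rest h (base p)   = base p
      Affine-rest h (var {u} p) with u ≟ᵢ v
      ... | yes _  = base tt
      ... | no u≢v = var (h p u≢v)
      Affine-rest h (add a b)  = add (Affine-rest h a) (Affine-rest h b)
      Affine-rest h (mulˡ p a) = mulˡ p (Affine-rest h a)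
      Affine-rest h (mulʳ a p) = mulʳ (Affine-rest h a) p
      Affine-rest h (neg a)    = neg (Affine-rest h a)

      module _ {ℓ} (C : Congruence ℓ) where
        open Congruence C
        open IntegerSolver commutativeRing

        Affine-split : ∀ {e} (a : Affine P e) → e ≈ rest a ⊞ slope a ⊠ var v
        Affine-split (base p) = solve 2 (λ e x → e := e :+ :0 :* x) refl _ _
        Affine-split (var {u} p) with u ≟ᵢ v
        ... | yes ≡.refl = solve 1 (λ x → x := :0 :+ :1 :* x) refl _
        ... | no _       = solve 2 (λ e x → e := e :+ :0 :* x) refl _ _
        Affine-split (add a b) = trans (+-cong (Affine-split a) (Affine-split b))
          (solve 5 (λ p q s t x → (p :+ s :* x) :+ (q :+ t :* x) := (p :+ q) :+ (s :+ t) :* x) refl _ _ _ _ _)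
        Affine-split (mulˡ p a) = trans (*-congˡ (Affine-split a))
          (solve 4 (λ e p s x → e :* (p :+ s :* x) := e :* p :+ e :* s :* x) refl _ _ _ _)
        Affine-split (mulʳ a p) = trans (*-congʳ (Affine-split a))
          (solve 4 (λ e p s x → (p :+ s :* x) :* e := p :* e :+ s :* e :* x) refl _ _ _ _)
        Affine-split (neg a) = trans (-‿cong (Affine-split a))
          (solve 3 (λ p s x → :- (p :+ s :* x) := :- p :+ :- s :* x) refl _ _ _)

module _ {a ℓ b ℓ′} (A : RawRing a ℓ) (B : RawRing b ℓ′) where
  private
    module A = RawRing A
    module B = RawRing B

  mkRingHomomorphism : (φ : A.Carrier → B.Carrier) → (∀ {x y} → x A.≈ y → φ x B.≈ φ y) →
    (∀ x y → φ (x A.+ y) B.≈ φ x B.+ φ y) → (∀ x y → φ (x A.* y) B.≈ φ x B.* φ y) →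
    (∀ x → φ (A.- x) B.≈ B.- φ x) → φ A.0# B.≈ B.0# → φ A.1# B.≈ B.1# → RingHomomorphism A B
  mkRingHomomorphism φ φ-cong φ-+ φ-* φ-neg φ-0 φ-1 = record
    { ⟦_⟧ = φ
    ; isRingHomomorphism = record
      { isSemiringHomomorphism = record
        { isNearSemiringHomomorphism = record
          { +-isMonoidHomomorphism = record
            { isMagmaHomomorphism = record { isRelHomomorphism = record { cong = φ-cong } ; homo = φ-+ }
            ; ε-homo = φ-0 }
          ; *-homo = φ-* }
        ; 1#-homo = φ-1 }
      ; -‿homo = φ-neg } }

module _ {c ℓ} (R : CommutativeRing c ℓ) where
  open CommutativeRing R hiding (zero)
  open PolynomialRing R

  constantHom : RingHomomorphism rawRing (CommutativeRing.rawRing polynomialRing)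
  constantHom = mkRingHomomorphism rawRing (CommutativeRing.rawRing polynomialRing) (_∷ [])
    (λ p → ∷-cong p ≋-refl) (λ _ _ → ≋-refl)
    (λ _ _ → ∷-cong (sym (+-identityʳ _)) ≋-refl) (λ _ → ≋-refl)
    (pointwise (λ { zero → refl ; (suc d) → refl })) ≋-refl

-- The tower of polynomial rings and its limit.

module Stages {c ℓ₁ ℓ₂ m} (em : ∀ {P : Set ℓ₁} → Dec P)
  (K : DifferentialField c ℓ₁ ℓ₂ (suc m)) (n r : ℕ) (𝕃 : IntegralDomain c ℓ₁)
  (hom : RingHomomorphism (DifferentialField.rawRing K) (IntegralDomain.rawRing 𝕃))
  (a : Index (suc m) n → IntegralDomain.Carrier 𝕃) where
  open Expressions K n
  private module 𝕃 = IntegralDomain 𝕃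
  private module ML = Model 𝕃.commutativeRing hom a

  -- How the generator at v arises from the previous ones: kept from the given field, a new
  -- transcendental, or the solution of s x = t.
  data Instruction (v : V) : Set (c ⊔ ℓ₁) where
    keep : degree v < r → Instruction v
    free : r ≤ degree v → Instruction v
    det  : r ≤ degree v → (s t : Expr) (s⁻¹ : 𝕃.Carrier) → In (λ u → degree u < r) s → s⁻¹ 𝕃.* ML.ev s 𝕃.≈ 𝕃.1# →
           In (λ u → rank u < rank v) t → Instruction v

  module _ (instruction : ∀ v → Instruction v) where

    -- An indeterminate is adjoined at every stage, also where the instruction determines the
    -- generator or no index has that rank. The rings thus do not vary with the instructions.
    R : ℕ → IntegralDomain c ℓ₁
    R zero    = 𝕃
    R (suc k) = polynomialDomain em (R k)

    private module R (k : ℕ) = IntegralDomain (R k)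

    embedding : ∀ k → RingHomomorphism 𝕃.rawRing (R.rawRing k)
    embedding zero    = mkRingHomomorphism 𝕃.rawRing 𝕃.rawRing id id (λ _ _ → 𝕃.refl) (λ _ _ → 𝕃.refl) (λ _ → 𝕃.refl) 𝕃.refl 𝕃.refl
    embedding (suc k) = Composition.ringHomomorphism {M₁ = 𝕃.ring} {R.ring k} {R.ring (suc k)}
      (embedding k) (constantHom (R.commutativeRing k))

    private module emb (k : ℕ) = RingHomomorphism (embedding k)

    stageHom : ∀ k → RingHomomorphism (K.rawRing) (R.rawRing k)
    stageHom k = Composition.ringHomomorphism {M₁ = K.ring} {𝕃.ring} {R.ring k} hom (embedding k)

    nextGenerator : ∀ k v → Dec (rank v ≡ k) → Instruction v → (V → R.Carrier k) → R.Carrier (suc k)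
    nextGenerator k v (no _)  _           b = b v ∷ []
    nextGenerator k v (yes _) (keep _)    b = b v ∷ []
    nextGenerator k v (yes _) (free _)    b = R.0# k ∷ R.1# k ∷ []
    -- The variables of `s` have degree below `r`, so its value at this stage comes from `L` and is
    -- inverted by the image of `s⁻¹`; the ring need not be localised.
    nextGenerator k v (yes _) (det _ s t s⁻¹ _ _ _) b = R._*_ k (emb.⟦_⟧ k s⁻¹) (Model.ev (R.commutativeRing k) (stageHom k) b t) ∷ []

    -- b k v is meaningful only if degree v < r or rank v < k.
    b : ∀ k → V → R.Carrier k
    b zero    v = a v
    b (suc k) v = nextGenerator k v (rank v ℕ.≟ k) (instruction v) (b k)

    private module St (k : ℕ) = Model (R.commutativeRing k) (stageHom k) (b k)
    open St using (ev; kernel)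

    generator-other : ∀ k v → rank v ≢ k → b (suc k) v ≡ b k v ∷ []
    generator-other k v p with rank v ℕ.≟ k
    ... | yes q = ⊥-elim (p q)
    ... | no _  = ≡.refl

    generator-at : ∀ v → b (suc (rank v)) v ≡ nextGenerator (rank v) v (yes ≡.refl) (instruction v) (b (rank v))
    generator-at v with rank v ℕ.≟ rank v
    ... | yes ≡.refl = ≡.refl
    ... | no p = ⊥-elim (p ≡.refl)

    ev-constant : ∀ k e → In (λ v → rank v ≢ k) e → R._≈_ (suc k) (ev (suc k) e) (ev k e ∷ [])
    ev-constant k (con x) p = R.refl (suc k)
    ev-constant k (var v) p = R.reflexive (suc k) (generator-other k v p)
    ev-constant k (e ⊞ f) (p , q) = R.trans (suc k) (R.+-cong (suc k) (ev-constant k e p) (ev-constant k f q))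
      (R.sym (suc k) (RingHomomorphism.+-homo (constantHom (R.commutativeRing k)) _ _))
    ev-constant k (e ⊠ f) (p , q) = R.trans (suc k) (R.*-cong (suc k) (ev-constant k e p) (ev-constant k f q))
      (R.sym (suc k) (RingHomomorphism.*-homo (constantHom (R.commutativeRing k)) _ _))
    ev-constant k (⊟ e) p = R.-‿cong (suc k) (ev-constant k e p)

    Zero : ℕ → Expr → Set ℓ₁
    Zero k e = R._≈_ k (ev k e) (R.0# k)

    module _ (e : Expr) {N : ℕ} (p : In (λ v → rank v < N) e) where

      private
        avoid : ∀ {k} → N ≤ k → In (λ v → rank v ≢ k) e
        avoid N≤k = In-map (λ r<N r≡k → ℕ.<-irrefl r≡k (ℕ.<-≤-trans r<N N≤k)) e p

      Zero-suc : ∀ {k} → N ≤ k → Zero k e → Zero (suc k) e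
      Zero-suc {k} N≤k z = R.trans (suc k) (ev-constant k e (avoid N≤k))
        (pointwise (λ { zero → z ; (suc d) → R.refl k }))
        where open PolynomialRing (R.commutativeRing k)

      Zero-pred : ∀ {k} → N ≤ k → Zero (suc k) e → Zero k e
      Zero-pred {k} N≤k z = PolynomialRing.coefficients (R.trans (suc k) (R.sym (suc k) (ev-constant k e (avoid N≤k))) z) 0

      Zero-up : ∀ {k l} → N ≤ k → k ≤ l → Zero k e → Zero l e
      Zero-up {k} {l} N≤k k≤l z with ℕ.≤⇒≤′ k≤l
      ... | q = go q
        where
        go : ∀ {l} → k ℕ.≤′ l → Zero l e
        go (ℕ.≤′-reflexive ≡.refl) = z
        go (ℕ.≤′-step q) = Zero-suc (ℕ.≤-trans N≤k (ℕ.≤′⇒≤ q)) (go q)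

      Zero-down : ∀ {k l} → N ≤ k → k ≤ l → Zero l e → Zero k e
      Zero-down {k} {l} N≤k k≤l z = go (ℕ.≤⇒≤′ k≤l) z
        where
        go : ∀ {l} → k ℕ.≤′ l → Zero l e → Zero k e
        go (ℕ.≤′-reflexive ≡.refl) z = z
        go (ℕ.≤′-step q) z = go q (Zero-pred (ℕ.≤-trans N≤k (ℕ.≤′⇒≤ q)) z)

    infix 4 _∼_
    -- Equality in the direct limit. An expression has finitely many variables, so its value is
    -- merely carried along as a constant once the stage exceeds their ranks.
    record _∼_ (e f : Expr) : Set ℓ₁ where
      constructor eventually
      field
        bound : ℕ
        agree : ∀ {k} → bound ≤ k → R._≈_ k (ev k e) (ev k f)
    open _∼_

    private
      always : ∀ {e f} → (∀ k → R._≈_ k (ev k e) (ev k f)) → e ∼ f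
      always h = eventually 0 (λ {k} _ → h k)

      both : ∀ {e f g h p q} → (∀ k → R._≈_ k (ev k e) (ev k f) → R._≈_ k (ev k g) (ev k h) → R._≈_ k (ev k p) (ev k q)) →
             e ∼ f → g ∼ h → p ∼ q
      both t (eventually M x) (eventually N y) = eventually (M ℕ.⊔ N) λ {k} l →
        t k (x (ℕ.≤-trans (ℕ.m≤m⊔n M N) l)) (y (ℕ.≤-trans (ℕ.m≤n⊔m M N) l))

      module Kk (k : ℕ) = Congruence (kernel k)

    limit : Congruence ℓ₁
    limit = record
      { _≈_ = _∼_
      ; isCommutativeRing = mkIsCommutativeRing
          (record { refl = always (λ k → R.refl k)
                  ; sym = λ (eventually N x) → eventually N (λ {k} l → R.sym k (x l))
                  ; trans = both (λ k → R.trans k) })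
          (both (λ k → R.+-cong k)) (λ e f g → always (λ k → Kk.+-assoc k e f g)) (λ e f → always (λ k → Kk.+-comm k e f))
          (λ e → always (λ k → Kk.+-identityˡ k e))
          (λ (eventually N x) → eventually N (λ {k} l → R.-‿cong k (x l)))
          (λ e → always (λ k → Kk.-‿inverseˡ k e))
          (both (λ k → R.*-cong k)) (λ e f g → always (λ k → Kk.*-assoc k e f g)) (λ e f → always (λ k → Kk.*-comm k e f))
          (λ e → always (λ k → Kk.*-identityˡ k e)) (λ e f g → always (λ k → Kk.distribʳ k e f g))
      ; con-cong = λ p → always (λ k → Kk.con-cong k p)
      ; con-+ = λ x y → always (λ k → Kk.con-+ k x y)
      ; con-* = λ x y → always (λ k → Kk.con-* k x y)
      ; con-neg = λ x → always (λ k → Kk.con-neg k x) }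

    ev-𝟘 : ∀ k → Zero k 𝟘
    ev-𝟘 k = RingHomomorphism.0#-homo (stageHom k)

    module _ (e : Expr) {N : ℕ} (p : In (λ v → rank v < N) e) where

      Zero⇒∼𝟘 : ∀ {k} → N ≤ k → Zero k e → e ∼ 𝟘
      Zero⇒∼𝟘 {k} N≤k z = eventually k (λ {l} k≤l → R.trans l (Zero-up e p N≤k k≤l z) (R.sym l (ev-𝟘 l)))

      ∼𝟘⇒Zero : ∀ {k} → N ≤ k → e ∼ 𝟘 → Zero k e
      ∼𝟘⇒Zero {k} N≤k (eventually M x) = Zero-down e p N≤k (ℕ.m≤n⊔m M k)
        (R.trans (M ℕ.⊔ k) (x (ℕ.m≤m⊔n M k)) (ev-𝟘 (M ℕ.⊔ k)))

    limitDomain : Domain ℓ₁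
    limitDomain = record
      { congruence = limit
      ; 𝟙≉𝟘 = λ p → 𝕃.1≉0 (𝕃.trans (𝕃.sym (RingHomomorphism.1#-homo hom)) (∼𝟘⇒Zero 𝟙 tt {0} ℕ.≤-refl p))
      ; noZeroDivisors = λ {e} {f} → zeroDivisors e f }
      where
      zeroDivisors : ∀ e f → e ⊠ f ∼ 𝟘 → e ∼ 𝟘 ⊎ f ∼ 𝟘
      -- A stage above the ranks of all variables in both factors decides the question, and it is a
      -- domain.
      zeroDivisors e f p with In-bounded rank (e ⊠ f)
      ... | N , q , q′ with R.noZeroDivisors N (∼𝟘⇒Zero (e ⊠ f) (q , q′) ℕ.≤-refl p)
      ...   | inj₁ z = inj₁ (Zero⇒∼𝟘 e q ℕ.≤-refl z)
      ...   | inj₂ z = inj₂ (Zero⇒∼𝟘 f q′ ℕ.≤-refl z)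

    embedding-injective : ∀ k {x} → R._≈_ k (emb.⟦_⟧ k x) (R.0# k) → x 𝕃.≈ 𝕃.0#
    embedding-injective zero    p = p
    embedding-injective (suc k) p = embedding-injective k (PolynomialRing.coefficients p 0)

    b-kept : ∀ k v → degree v < r → R._≈_ k (b k v) (emb.⟦_⟧ k (a v))
    b-kept zero    v p = 𝕃.refl
    b-kept (suc k) v p with rank v ℕ.≟ k | instruction v
    ... | no _  | _ = PolynomialRing.∷-cong (R.commutativeRing k) (b-kept k v p) (PolynomialRing.≋-refl (R.commutativeRing k))
    ... | yes _ | keep _ = PolynomialRing.∷-cong (R.commutativeRing k) (b-kept k v p) (PolynomialRing.≋-refl (R.commutativeRing k))
    ... | yes _ | free q = ⊥-elim (ℕ.<⇒≱ p q)
    ... | yes _ | det q _ _ _ _ _ _ = ⊥-elim (ℕ.<⇒≱ p q)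

    ev-kept : ∀ k e → In (λ v → degree v < r) e → R._≈_ k (ev k e) (emb.⟦_⟧ k (ML.ev e))
    ev-kept k (con x) p = R.refl k
    ev-kept k (var v) p = b-kept k v p
    ev-kept k (e ⊞ f) (p , q) = R.trans k (R.+-cong k (ev-kept k e p) (ev-kept k f q)) (R.sym k (emb.+-homo k _ _))
    ev-kept k (e ⊠ f) (p , q) = R.trans k (R.*-cong k (ev-kept k e p) (ev-kept k f q)) (R.sym k (emb.*-homo k _ _))
    ev-kept k (⊟ e) p = R.trans k (R.-‿cong k (ev-kept k e p)) (R.sym k (emb.-‿homo k _))

    kept-∼𝟘 : ∀ e → In (λ v → degree v < r) e → ML.ev e 𝕃.≈ 𝕃.0# → e ∼ 𝟘
    kept-∼𝟘 e p z = eventually 0 (λ {k} _ → R.trans k (R.trans k (ev-kept k e p) (R.trans k (emb.⟦⟧-cong k z) (emb.0#-homo k))) (R.sym k (ev-𝟘 k)))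

    kept-≈0 : ∀ e → In (λ v → degree v < r) e → e ∼ 𝟘 → ML.ev e 𝕃.≈ 𝕃.0#
    kept-≈0 e p (eventually N z) = embedding-injective N
      (R.trans N (R.sym N (ev-kept N e p)) (R.trans N (z ℕ.≤-refl) (ev-𝟘 N)))

    det-∼ : ∀ v {q s t s⁻¹ x y z} → instruction v ≡ det q s t s⁻¹ x y z → s ⊠ var v ∼ t
    det-∼ v {q} {s} {t} {s⁻¹} {x} {y} {z} eq = Domain-≈ (Zero⇒∼𝟘 (s ⊠ var v ⊞ ⊟ t)
        {suc k} ((In-map (λ {u} p → ℕ.m<n⇒m<1+n (precedes u p)) s x , ℕ.n<1+n k) , In-map (λ {u} → ℕ.m<n⇒m<1+n) t z) ℕ.≤-refl zero-at)
      where
      k = rank v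
      open DomainProperties (Domain.integralDomain limitDomain) renaming (-≈0⇒≈ to Domain-≈)
      precedes : ∀ u → degree u < r → rank u < rank v
      precedes u p = degree<⇒rank< u v (ℕ.<-≤-trans p q)
      module H = RingHomomorphism (constantHom (R.commutativeRing k))
      module S = R (suc k)
      avoid : ∀ u → rank u < k → rank u ≢ k
      avoid u p r = ℕ.<-irrefl r p
      generator≡ : b (suc k) v ≡ (R._*_ k (emb.⟦_⟧ k s⁻¹) (ev k t) ∷ [])
      generator≡ = ≡.trans (generator-at v) (≡.cong (λ i → nextGenerator k v (yes ≡.refl) i (b k)) eq)
      value : R._≈_ k (R._*_ k (ev k s) (R._*_ k (emb.⟦_⟧ k s⁻¹) (ev k t))) (ev k t)
      value = R.trans k (R.sym k (R.*-assoc k _ _ _)) (R.trans k (R.*-congʳ k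
        (R.trans k (R.*-congʳ k (ev-kept k s x)) (R.trans k (R.sym k (emb.*-homo k _ _))
          (R.trans k (emb.⟦⟧-cong k (𝕃.trans (𝕃.*-comm _ _) y)) (emb.1#-homo k))))) (R.*-identityˡ k _))
      zero-at : Zero (suc k) (s ⊠ var v ⊞ ⊟ t)
      zero-at = S.trans (S.+-cong (S.*-cong (ev-constant k s (In-map (λ {u} p → avoid u (precedes u p)) s x)) (S.reflexive generator≡))
                                  (S.-‿cong (ev-constant k t (In-map (λ {u} → avoid u) t z))))
        (S.trans (S.+-congʳ {S.- (ev k t ∷ [])} (S.trans (S.sym (H.*-homo (ev k s) (R._*_ k (emb.⟦_⟧ k s⁻¹) (ev k t)))) (H.⟦⟧-cong value)))
          (S.-‿inverseʳ (ev k t ∷ [])))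

    -- At stage `suc (rank v)` the generator at `v` is the indeterminate over the stage before, so
    -- the coefficients of the value of `e` are the values of its expansion in `v`.
    free-expand : ∀ v {q} → instruction v ≡ free q → ∀ e → In (λ u → u ≢ v → rank u < rank v) e → e ∼ 𝟘 → All (_∼ 𝟘) (expand v e)
    free-expand v {q} eq e p e∼𝟘 = vanish (expand v e) (In-expand v e p)
        (R.trans (suc k) (R.sym (suc k) (ev-expand e p)) (∼𝟘⇒Zero e {suc k} (In-map bounded e p) ℕ.≤-refl e∼𝟘))
      where
      k = rank v
      module P = PolynomialRing (R.commutativeRing k)
      open P using (_≋_; ≋-sym; ≋-trans; ≋-refl; ⊕-cong; ⊗-cong; negate-cong; ∷-cong; pointwise; coefficients)
      bounded : ∀ {u} → (u ≢ v → rank u < k) → rank u < suc k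
      bounded {u} h with u ≟ᵢ v
      ... | yes ≡.refl = ℕ.n<1+n k
      ... | no u≢v     = ℕ.m<n⇒m<1+n (h u≢v)
      generator≡ : b (suc k) v ≡ (R.0# k ∷ R.1# k ∷ [])
      generator≡ = ≡.trans (generator-at v) (≡.cong (λ i → nextGenerator k v (yes ≡.refl) i (b k)) eq)
      vanish : ∀ f → All (In (λ u → rank u < k)) f → map (ev k) f ≋ [] → All (_∼ 𝟘) f
      vanish [] [] z = []
      vanish (x ∷ f) (q ∷ qs) z = Zero⇒∼𝟘 x q ℕ.≤-refl (coefficients z 0) ∷ vanish f qs (pointwise (λ d → coefficients z (suc d)))
      ev-expand : ∀ e → In (λ u → u ≢ v → rank u < k) e → ev (suc k) e ≋ map (ev k) (expand v e)
      ev-expand (con x) p = ≋-refl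
      ev-expand (var u) p with u ≟ᵢ v
      ... | yes ≡.refl = ≋-trans (R.reflexive (suc k) generator≡)
            (∷-cong (R.sym k (ev-𝟘 k)) (∷-cong (R.sym k (RingHomomorphism.1#-homo (stageHom k))) ≋-refl))
      ... | no u≢v = R.reflexive (suc k) (generator-other k u (λ r → ℕ.<-irrefl r (p u≢v)))
      ev-expand (e ⊞ f) (p , q) = ≋-trans (⊕-cong (ev-expand e p) (ev-expand f q))
        (≋-sym (map-⊕ exprRing (R.commutativeRing k) (ev k) (λ _ _ → R.refl k) (expand v e) (expand v f)))
      ev-expand (e ⊠ f) (p , q) = ≋-trans (⊗-cong (ev-expand e p) (ev-expand f q))
        (≋-sym (map-⊗ exprRing (R.commutativeRing k) (ev k) (λ _ _ → R.refl k) (λ _ _ → R.refl k) (ev-𝟘 k) (expand v e) (expand v f)))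
      ev-expand (⊟ e) p = ≋-trans (negate-cong (ev-expand e p)) (negation (expand v e))
        where
        negation : ∀ f → P.negate (map (ev k) f) ≋ map (ev k) (map ⊟_ f)
        negation []      = ≋-refl
        negation (x ∷ f) = ∷-cong (R.refl k) (negation f)

-- The differential condition in terms of `D`.

box-unique : ∀ m d → Unique (box m d)
box-unique zero    d = [] ∷ []
box-unique (suc m) d = Unique.cartesianProductWith⁺ _∷_ ∷-injective (Unique.upTo⁺ (suc d)) (box-unique m d)

∈-box : ∀ {m d} (ξ : Vec ℕ m) → ∣ ξ ∣ ≤ d → ξ ∈ box m d
∈-box []      p = here ≡.refl
∈-box (x ∷ ξ) p = ∈-cartesianProductWith⁺ _∷_
  (∈-upTo⁺ (ℕ.s≤s (ℕ.≤-trans (ℕ.m≤m+n x _) p))) (∈-box ξ (ℕ.≤-trans (ℕ.m≤n+m _ x) p))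

below-unique : ∀ {m n} (w : Index (suc m) n) → Unique (below w)
below-unique {m} {n} w = Unique.filter⁺ (_⊴? w) (Unique.cartesianProduct⁺ (box-unique (suc m) (degree w)) (Unique.allFin⁺ n))

⊴⇒degree≤ : ∀ {m n} (u w : Index (suc m) n) → u ⊴ w → degree u ≤ degree w
⊴⇒degree≤ u w (this p _) = ℕ.<⇒≤ p
⊴⇒degree≤ u w (next p _) = ℕ.≤-reflexive p

∈-below : ∀ {m n} (u w : Index (suc m) n) → u ⊴ w → u ∈ below w
∈-below u w p = ∈-filter⁺ (_⊴? w) (∈-cartesianProduct⁺ (∈-box (proj₁ u) (⊴⇒degree≤ u w p)) (∈-allFin (proj₂ u))) p

module _ {c ℓ} (R : CommutativeRing c ℓ) where
  open CommutativeRing R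
  open IntegerSolver R

  ∑ : ∀ {v} {V : Set v} → List V → (V → Carrier) → Carrier
  ∑ vs h = foldr _+_ 0# (map h vs)

  module _ {v} {V : Set v} where

    ∑-cong : ∀ (vs : List V) {g h} → (∀ v → g v ≈ h v) → ∑ vs g ≈ ∑ vs h
    ∑-cong []       p = refl
    ∑-cong (v ∷ vs) p = +-cong (p v) (∑-cong vs p)

    ∑-0 : ∀ (vs : List V) → ∑ vs (λ _ → 0#) ≈ 0#
    ∑-0 []       = refl
    ∑-0 (v ∷ vs) = trans (+-identityˡ _) (∑-0 vs)

    ∑-+ : ∀ (vs : List V) g h → ∑ vs (λ v → g v + h v) ≈ ∑ vs g + ∑ vs h
    ∑-+ []       g h = sym (+-identityˡ 0#)
    ∑-+ (v ∷ vs) g h = trans (+-congˡ (∑-+ vs g h))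
      (solve 4 (λ a b s t → (a :+ b) :+ (s :+ t) := (a :+ s) :+ (b :+ t)) refl _ _ _ _)

    ∑-* : ∀ (vs : List V) x h → ∑ vs (λ v → x * h v) ≈ x * ∑ vs h
    ∑-* []       x h = sym (zeroʳ x)
    ∑-* (v ∷ vs) x h = trans (+-congˡ (∑-* vs x h)) (sym (distribˡ x _ _))

    module _ (_≟_ : ∀ (u v : V) → Dec (u ≡ v)) (u : V) (h : V → Carrier) where

      private
        at : V → Carrier
        at v = if does (u ≟ v) then h v else 0#

        at-other : ∀ {v} → u ≢ v → at v ≈ 0#
        at-other {v} p with u ≟ v
        ... | yes q = ⊥-elim (p q)
        ... | no _  = refl

        at-self : at u ≈ h u
        at-self with u ≟ u
        ... | yes _ = refl
        ... | no p  = ⊥-elim (p ≡.refl)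

        ∑-avoid : ∀ vs → All (u ≢_) vs → ∑ vs at ≈ 0#
        ∑-avoid []       []       = refl
        ∑-avoid (v ∷ vs) (p ∷ ps) = trans (+-cong (at-other p) (∑-avoid vs ps)) (+-identityˡ 0#)

      ∑-select : ∀ {vs} → Unique vs → u ∈ vs → ∑ vs (λ v → if does (u ≟ v) then h v else 0#) ≈ h u
      ∑-select (p ∷ ps) (here ≡.refl) = trans (+-cong at-self (∑-avoid _ p)) (+-identityʳ _)
      ∑-select (p ∷ ps) (there q) =
        trans (+-cong (at-other (λ e → All.lookup p q (≡.sym e))) (∑-select ps q)) (+-identityˡ _)

module PolynomialDerivative {c ℓ₁ ℓ₂ m} (K : DifferentialField c ℓ₁ ℓ₂ (suc m)) (n : ℕ)
  {c′ ℓ′} (R : CommutativeRing c′ ℓ′) (hom : RingHomomorphism (DifferentialField.rawRing K) (CommutativeRing.rawRing R))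
  (a : Index (suc m) n → CommutativeRing.Carrier R) where
  open Expressions K n
  open CommutativeRing R
  open IntegerSolver R
  open RingHomomorphism hom renaming (⟦_⟧ to ι)
  open Model R hom a
  open Evaluation rawRing ι a
  open import Relation.Binary.Reasoning.Setoid setoid

  Poly : Set c
  Poly = Polynomial K.Carrier V

  infixl 7 _·_
  _·_ : Poly → Poly → Poly
  _·_ = cartesianProductWith (λ s t → proj₁ s K.* proj₁ t , proj₂ s ++ proj₂ t)

  toPolynomial : Expr → Poly
  toPolynomial (con x) = (x , []) ∷ []
  toPolynomial (var v) = (K.1# , v ∷ []) ∷ []
  toPolynomial (e ⊞ f) = toPolynomial e ++ toPolynomial f
  toPolynomial (e ⊠ f) = toPolynomial e · toPolynomial f
  toPolynomial (⊟ e)   = mapCoefficients K.-_ (toPolynomial e)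

  module _ {P : Pred V 0ℓ} where

    VariablesIn-· : ∀ f g → VariablesIn P f → VariablesIn P g → VariablesIn P (f · g)
    VariablesIn-· []            g []       qs = []
    VariablesIn-· ((x , w) ∷ f) g (p ∷ ps) qs = All.++⁺ (scaled g qs) (VariablesIn-· f g ps qs)
      where
      scaled : ∀ g → VariablesIn P g → VariablesIn P (map (λ t → x K.* proj₁ t , w ++ proj₂ t) g)
      scaled []      []       = []
      scaled (t ∷ g) (q ∷ qs) = All.++⁺ p q ∷ scaled g qs

    VariablesIn-toPolynomial : ∀ e → In P e → VariablesIn P (toPolynomial e)
    VariablesIn-toPolynomial (con x) p = [] ∷ []
    VariablesIn-toPolynomial (var v) p = (p ∷ []) ∷ []
    VariablesIn-toPolynomial (e ⊞ f) (p , q) = All.++⁺ (VariablesIn-toPolynomial e p) (VariablesIn-toPolynomial f q)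
    VariablesIn-toPolynomial (e ⊠ f) (p , q) =
      VariablesIn-· (toPolynomial e) (toPolynomial f) (VariablesIn-toPolynomial e p) (VariablesIn-toPolynomial f q)
    VariablesIn-toPolynomial (⊟ e) p = All.map⁺ (VariablesIn-toPolynomial e p)

  monomial : List V → Carrier
  monomial w = foldr (λ v x → a v * x) 1# w

  monomial-++ : ∀ w w′ → monomial (w ++ w′) ≈ monomial w * monomial w′
  monomial-++ []      w′ = sym (*-identityˡ _)
  monomial-++ (v ∷ w) w′ = trans (*-congˡ (monomial-++ w w′)) (sym (*-assoc _ _ _))

  eval-++ : ∀ f g → eval (f ++ g) ≈ eval f + eval g
  eval-++ []      g = sym (+-identityˡ _)
  eval-++ (t ∷ f) g = trans (+-congˡ (eval-++ f g)) (sym (+-assoc _ _ _))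

  module _ (i : Fin (suc m)) where

    -- The value of the derivative of a monomial, with `a (v ⁺ i)` for the derivative of `v`. Its
    -- extension `eval′` to polynomials mediates between `D i` on expressions and the sum of partial
    -- derivatives in the differential condition.
    monomial′ : List V → Carrier
    monomial′ []      = 0#
    monomial′ (v ∷ w) = a (v ⁺ i) * monomial w + a v * monomial′ w

    term′ : K.Carrier × List V → Carrier
    term′ (x , w) = ι (K.∂ i x) * monomial w + ι x * monomial′ w

    eval′ : Poly → Carrier
    eval′ f = foldr (λ t x → term′ t + x) 0# f

    monomial′-++ : ∀ w w′ → monomial′ (w ++ w′) ≈ monomial′ w * monomial w′ + monomial w * monomial′ w′
    monomial′-++ []      w′ = solve 2 (λ x y → y := :0 :* x :+ :1 :* y) refl _ _
    monomial′-++ (v ∷ w) w′ = trans (+-cong (*-congˡ (monomial-++ w w′)) (*-congˡ (monomial′-++ w w′)))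
      (solve 6 (λ b x y a x′ y′ → b :* (x :* y) :+ a :* (x′ :* y :+ x :* y′) := (b :* x :+ a :* x′) :* y :+ a :* x :* y′) refl _ _ _ _ _ _)

    eval′-++ : ∀ f g → eval′ (f ++ g) ≈ eval′ f + eval′ g
    eval′-++ []      g = sym (+-identityˡ _)
    eval′-++ (t ∷ f) g = trans (+-congˡ (eval′-++ f g)) (sym (+-assoc _ _ _))

    private
      scale : K.Carrier × List V → Poly → Poly
      scale s = map (λ t → proj₁ s K.* proj₁ t , proj₂ s ++ proj₂ t)

      eval-scale : ∀ s g → eval (scale s g) ≈ term s * eval g
      eval-scale s             []            = sym (zeroʳ _)
      eval-scale s@(x , w) ((y , w′) ∷ g) = trans
        (+-cong (*-cong (*-homo x y) (monomial-++ w w′)) (eval-scale s g))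
        (solve 5 (λ x w y w′ g → (x :* y) :* (w :* w′) :+ (x :* w) :* g := (x :* w) :* (y :* w′ :+ g)) refl _ _ _ _ _)

      ι-∂-* : ∀ x y → ι (K.∂ i (x K.* y)) ≈ ι (K.∂ i x) * ι y + ι x * ι (K.∂ i y)
      ι-∂-* x y = trans (⟦⟧-cong (IsDerivation.D-* (K.isDerivation i) x y)) (trans (+-homo _ _) (+-cong (*-homo _ _) (*-homo _ _)))

      eval′-scale : ∀ s g → eval′ (scale s g) ≈ term′ s * eval g + term s * eval′ g
      eval′-scale s             []            = solve 2 (λ x y → :0 := x :* :0 :+ y :* :0) refl _ _
      eval′-scale s@(x , w) ((y , w′) ∷ g) = trans
        (+-cong (+-cong (*-cong (ι-∂-* x y) (monomial-++ w w′)) (*-cong (*-homo x y) (monomial′-++ w w′))) (eval′-scale s g))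
        (solve 10 (λ x y x′ y′ w w′ v v′ g g′ →
            (((x′ :* y :+ x :* y′) :* (w :* w′) :+ x :* y :* (v :* w′ :+ w :* v′)) :+ ((x′ :* w :+ x :* v) :* g :+ (x :* w) :* g′))
            := (x′ :* w :+ x :* v) :* (y :* w′ :+ g) :+ (x :* w) :* ((y′ :* w′ :+ y :* v′) :+ g′))
          refl _ _ _ _ _ _ _ _ _ _)

    eval-· : ∀ f g → eval (f · g) ≈ eval f * eval g
    eval-· []      g = sym (zeroˡ _)
    eval-· (s ∷ f) g = trans (eval-++ (scale s g) (f · g))
      (trans (+-cong (eval-scale s g) (eval-· f g)) (sym (distribʳ _ _ _)))

    eval′-· : ∀ f g → eval′ (f · g) ≈ eval′ f * eval g + eval f * eval′ g
    eval′-· []      g = solve 2 (λ x y → :0 := :0 :* x :+ :0 :* y) refl _ _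
    eval′-· (s ∷ f) g = trans (eval′-++ (scale s g) (f · g))
      (trans (+-cong (eval′-scale s g) (eval′-· f g))
        (solve 6 (λ t′ x t y a b → (t′ :* x :+ t :* y) :+ (a :* x :+ b :* y) := (t′ :+ a) :* x :+ (t :+ b) :* y) refl _ _ _ _ _ _))

    eval-toPolynomial : ∀ e → eval (toPolynomial e) ≈ ev e
    eval-toPolynomial (con x) = trans (+-identityʳ _) (*-identityʳ _)
    eval-toPolynomial (var v) = trans (+-congʳ (*-congʳ 1#-homo)) (solve 1 (λ x → :1 :* (x :* :1) :+ :0 := x) refl _)
    eval-toPolynomial (e ⊞ f) = trans (eval-++ (toPolynomial e) (toPolynomial f)) (+-cong (eval-toPolynomial e) (eval-toPolynomial f))
    eval-toPolynomial (e ⊠ f) = trans (eval-· (toPolynomial e) (toPolynomial f)) (*-cong (eval-toPolynomial e) (eval-toPolynomial f))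
    eval-toPolynomial (⊟ e) = trans (negation (toPolynomial e)) (-‿cong (eval-toPolynomial e))
      where
      negation : ∀ f → eval (mapCoefficients K.-_ f) ≈ - eval f
      negation []            = solve 0 (:0 := :- :0) refl
      negation ((x , w) ∷ f) = trans (+-cong (*-congʳ (-‿homo x)) (negation f))
        (solve 3 (λ x w f → :- x :* w :+ :- f := :- (x :* w :+ f)) refl _ _ _)

    eval′-toPolynomial : ∀ e → eval′ (toPolynomial e) ≈ ev (D i e)
    eval′-toPolynomial (con x) = solve 2 (λ x y → (x :* :1 :+ y :* :0) :+ :0 := x) refl _ _
    eval′-toPolynomial (var v) = trans
      (+-congʳ (+-cong (*-congʳ (trans (⟦⟧-cong (∂-1 i)) 0#-homo)) (*-congʳ 1#-homo)))
      (solve 2 (λ x y → (:0 :* (x :* :1) :+ :1 :* (y :* :1 :+ x :* :0)) :+ :0 := y) refl _ _)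
    eval′-toPolynomial (e ⊞ f) = trans (eval′-++ (toPolynomial e) (toPolynomial f)) (+-cong (eval′-toPolynomial e) (eval′-toPolynomial f))
    eval′-toPolynomial (e ⊠ f) = trans (eval′-· (toPolynomial e) (toPolynomial f))
      (+-cong (*-cong (eval′-toPolynomial e) (eval-toPolynomial f)) (*-cong (eval-toPolynomial e) (eval′-toPolynomial f)))
    eval′-toPolynomial (⊟ e) = trans (negation (toPolynomial e)) (-‿cong (eval′-toPolynomial e))
      where
      negation : ∀ f → eval′ (mapCoefficients K.-_ f) ≈ - eval′ f
      negation []            = solve 0 (:0 := :- :0) refl
      negation ((x , w) ∷ f) = trans
        (+-cong (+-cong (*-congʳ (trans (⟦⟧-cong (∂-neg i x)) (-‿homo _))) (*-congʳ (-‿homo x))) (negation f))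
        (solve 5 (λ x′ w x w′ f → (:- x′ :* w :+ :- x :* w′) :+ :- f := :- ((x′ :* w :+ x :* w′) :+ f)) refl _ _ _ _ _)

    module _ {vs : List V} (unique : Unique vs) where

      private
        removed : V → List V → Carrier
        removed v w = foldr (λ w′ x → monomial w′ + x) 0# (removals _≟ᵢ_ v w)

        sum-∷ : ∀ u (ws : List (List V)) → foldr (λ w′ x → monomial w′ + x) 0# (map (u ∷_) ws) ≈ a u * foldr (λ w′ x → monomial w′ + x) 0# ws
        sum-∷ u []       = sym (zeroʳ _)
        sum-∷ u (w ∷ ws) = trans (+-congˡ (sum-∷ u ws)) (sym (distribˡ _ _ _))

        removed-∷ : ∀ v u w → removed v (u ∷ w) * a (v ⁺ i) ≈
          (if does (u ≟ᵢ v) then a (v ⁺ i) * monomial w else 0#) + a u * (removed v w * a (v ⁺ i))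
        removed-∷ v u w with does (u ≟ᵢ v)
        ... | true  = trans (*-congʳ (+-congˡ (sum-∷ u (removals _≟ᵢ_ v w))))
                (solve 4 (λ w a r b → (w :+ a :* r) :* b := b :* w :+ a :* (r :* b)) refl _ _ _ _)
        ... | false = trans (*-congʳ (sum-∷ u (removals _≟ᵢ_ v w)))
                (solve 3 (λ a r b → a :* r :* b := :0 :+ a :* (r :* b)) refl _ _ _)

        -- The Leibniz rule sums over the occurrences in `w`, the left side over variables and then
        -- over the occurrences of each. As `vs` lists every variable of `w` exactly once, both
        -- count the same terms.
        ∑-removed : ∀ w → All (_∈ vs) w → ∑ R vs (λ v → removed v w * a (v ⁺ i)) ≈ monomial′ w
        ∑-removed [] [] = trans (∑-cong R vs (λ v → zeroˡ _)) (∑-0 R vs)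
        ∑-removed (u ∷ w) (p ∷ ps) = begin
          ∑ R vs (λ v → removed v (u ∷ w) * a (v ⁺ i))
            ≈⟨ ∑-cong R vs (λ v → removed-∷ v u w) ⟩
          ∑ R vs (λ v → (if does (u ≟ᵢ v) then a (v ⁺ i) * monomial w else 0#) + a u * (removed v w * a (v ⁺ i)))
            ≈⟨ ∑-+ R vs _ _ ⟩
          ∑ R vs (λ v → if does (u ≟ᵢ v) then a (v ⁺ i) * monomial w else 0#) + ∑ R vs (λ v → a u * (removed v w * a (v ⁺ i)))
            ≈⟨ +-cong (∑-select R _≟ᵢ_ u (λ v → a (v ⁺ i) * monomial w) unique p)
                      (trans (∑-* R vs (a u) _) (*-congˡ (∑-removed w ps))) ⟩
          monomial′ (u ∷ w) ∎

        eval-map : ∀ x ws → eval (map (x ,_) ws) ≈ ι x * foldr (λ w′ y → monomial w′ + y) 0# ws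
        eval-map x []       = sym (zeroʳ _)
        eval-map x (w ∷ ws) = trans (+-congˡ (eval-map x ws)) (sym (distribˡ _ _ _))

      ∑-partial : ∀ f → VariablesIn (_∈ vs) f →
        ∑ R vs (λ v → eval (partial _≟ᵢ_ v f) * a (v ⁺ i)) + eval (mapCoefficients (K.∂ i) f) ≈ eval′ f
      ∑-partial [] [] = trans (+-identityʳ _) (trans (∑-cong R vs (λ v → zeroˡ _)) (∑-0 R vs))
      ∑-partial ((x , w) ∷ f) (p ∷ ps) = begin
        ∑ R vs (λ v → eval (partial _≟ᵢ_ v ((x , w) ∷ f)) * a (v ⁺ i)) + (ι (K.∂ i x) * monomial w + eval (mapCoefficients (K.∂ i) f))
          ≈⟨ +-congʳ (∑-cong R vs (λ v → trans (*-congʳ (trans (eval-++ (map (x ,_) (removals _≟ᵢ_ v w)) _) (+-congʳ (eval-map x (removals _≟ᵢ_ v w)))))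
               (solve 4 (λ x r p b → (x :* r :+ p) :* b := x :* (r :* b) :+ p :* b) refl _ _ _ _))) ⟩
        ∑ R vs (λ v → ι x * (removed v w * a (v ⁺ i)) + eval (partial _≟ᵢ_ v f) * a (v ⁺ i)) + (ι (K.∂ i x) * monomial w + eval (mapCoefficients (K.∂ i) f))
          ≈⟨ +-congʳ (trans (∑-+ R vs _ _) (+-congʳ (trans (∑-* R vs (ι x) _) (*-congˡ (∑-removed w p))))) ⟩
        (ι x * monomial′ w + ∑ R vs (λ v → eval (partial _≟ᵢ_ v f) * a (v ⁺ i))) + (ι (K.∂ i x) * monomial w + eval (mapCoefficients (K.∂ i) f))
          ≈⟨ solve 4 (λ p q s t → (p :+ q) :+ (s :+ t) := (s :+ p) :+ (q :+ t)) refl _ _ _ _ ⟩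
        term′ (x , w) + (∑ R vs (λ v → eval (partial _≟ᵢ_ v f) * a (v ⁺ i)) + eval (mapCoefficients (K.∂ i) f))
          ≈⟨ +-congˡ (∑-partial f ps) ⟩
        term′ (x , w) + eval′ f ∎

-- Fields, separable leaders and their equations.

module FieldProperties (em : ∀ {a} → ExcludedMiddle a) {c ℓ₁ ℓ₂} (L : HeytingField c ℓ₁ ℓ₂) where
  open HeytingField L using (_#_; heytingCommutativeRing; #⇒invertible; invertible⇒#; #-irrefl; tight)
  open HeytingCommutativeRing heytingCommutativeRing using (commutativeRing)
  open Field L
  open IntegerSolver commutativeRing

  inverse : ∀ {x} → ¬ x ≈ 0# → Σ Carrier λ y → y * x ≈ 1#
  inverse {x} x≉0 with em {P = x # 0#}
  ... | no ¬x#0 = ⊥-elim (x≉0 (proj₁ (tight x 0#) ¬x#0))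
  ... | yes x#0 with #⇒invertible x#0
  ...   | y , yx≈1 , _ = y , trans (solve 2 (λ x y → y :* x := y :* (x :- :0)) refl x y) yx≈1

  1≉0 : ¬ 1# ≈ 0#
  1≉0 p = #-irrefl (refl {0#}) (invertible⇒# (0# , trans (zeroˡ _) (sym p) , trans (zeroʳ _) (sym p)))

  field-noZeroDivisors : ∀ {x y} → x * y ≈ 0# → x ≈ 0# ⊎ y ≈ 0#
  field-noZeroDivisors {x} {y} p with em {P = x ≈ 0#}
  ... | yes x≈0 = inj₁ x≈0
  ... | no x≉0 with inverse x≉0
  ...   | z , zx≈1 = inj₂ (trans (sym (trans (*-congʳ zx≈1) (*-identityˡ y)))
                       (trans (*-assoc z x y) (trans (*-congˡ p) (zeroʳ z))))

  integralDomain : IntegralDomain c ℓ₁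
  integralDomain = record { commutativeRing = commutativeRing ; 1≉0 = 1≉0 ; noZeroDivisors = field-noZeroDivisors }

module _ {c ℓ c′ ℓ′} (A : RawRing c ℓ) (C : CommutativeRing c′ ℓ′)
         (φ : RawRing.Carrier A → CommutativeRing.Carrier C) where
  private module A = RawRing A
  open CommutativeRing C hiding (zero)
  open PolynomialRing C using (coefficients; pointwise; coefficient)
  private module UA = Univariate A

  evalAt≡horner : ∀ x f → evalAt A rawRing φ x f ≡ horner C x (map φ f)
  evalAt≡horner x []      = ≡.refl
  evalAt≡horner x (c ∷ f) = ≡.cong (λ y → φ c + x * y) (evalAt≡horner x f)

  module _ (φ-0 : φ A.0# ≈ 0#) where

    coefficient-map-hom : ∀ f d → coefficient (map φ f) d ≈ φ (UA.coefficient f d)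
    coefficient-map-hom []      d       = sym φ-0
    coefficient-map-hom (x ∷ f) zero    = refl
    coefficient-map-hom (x ∷ f) (suc d) = coefficient-map-hom f d

    evalAt-cong : (∀ {x y} → x A.≈ y → φ x ≈ φ y) → ∀ x f g → f UA.≋ g →
                  evalAt A rawRing φ x f ≈ evalAt A rawRing φ x g
    evalAt-cong φ-cong x f g p = trans (reflexive (evalAt≡horner x f)) (trans
      (horner-cong C x (map φ f) (map φ g) (pointwise λ d →
        trans (coefficient-map-hom f d) (trans (φ-cong (p d)) (sym (coefficient-map-hom g d)))))
      (reflexive (≡.sym (evalAt≡horner x g))))

  module _ (φ-+ : ∀ x y → φ (x A.+ y) ≈ φ x + φ y) where

    evalAt-⊕ : ∀ x f g → evalAt A rawRing φ x (f UA.⊕ g) ≈ evalAt A rawRing φ x f + evalAt A rawRing φ x g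
    evalAt-⊕ x f g = trans (reflexive (evalAt≡horner x (f UA.⊕ g))) (trans
      (horner-cong C x _ _ (map-⊕ A C φ φ-+ f g)) (trans (horner-⊕ C x (map φ f) (map φ g))
      (reflexive (≡.sym (≡.cong₂ _+_ (evalAt≡horner x f) (evalAt≡horner x g))))))

    evalAt-⊗ : (∀ x y → φ (x A.* y) ≈ φ x * φ y) → φ A.0# ≈ 0# →
      ∀ x f g → evalAt A rawRing φ x (f UA.⊗ g) ≈ evalAt A rawRing φ x f * evalAt A rawRing φ x g
    evalAt-⊗ φ-* φ-0 x f g = trans (reflexive (evalAt≡horner x (f UA.⊗ g))) (trans
      (horner-cong C x _ _ (map-⊗ A C φ φ-+ φ-* φ-0 f g)) (trans (horner-⊗ C x (map φ f) (map φ g))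
      (reflexive (≡.sym (≡.cong₂ _*_ (evalAt≡horner x f) (evalAt≡horner x g))))))

module Leaders (em : ∀ {a} → ExcludedMiddle a) {c ℓ₁ ℓ₂ m} (K : DifferentialField c ℓ₁ ℓ₂ (suc m)) (n r : ℕ)
  (E : Extension K n r) (DC : Extension.DifferentialCondition E) where
  open Extension E
  open Expressions K n
  open FieldProperties em L using (inverse; integralDomain) public
  private module KF = FieldProperties em (DifferentialField.heytingField K)
  open IntegralDomain integralDomain hiding (zero)
  open DomainProperties integralDomain
  open Model commutativeRing ιHom a public
  open IntegerSolver commutativeRing
  open CongruenceProperties kernel
  open PolynomialDerivative K n commutativeRing ιHom a
  private module ι = RingHomomorphism ιHom

  ι-injective : ∀ {x} → ι x ≈ 0# → x K.≈ K.0#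
  ι-injective {x} p with em {P = x K.≈ K.0#}
  ... | yes q = q
  ... | no q with KF.inverse q
  ...   | y , yx≈1 = ⊥-elim (1≉0 (trans (sym ι.1#-homo) (trans (ι.⟦⟧-cong (K.sym yx≈1))
                       (trans (ι.*-homo y x) (trans (*-congˡ p) (zeroʳ _))))))

  ∂/∂-self : ∀ t → ∂/∂ t (var t) ≡ 𝟙
  ∂/∂-self t with t ≟ᵢ t
  ... | yes _ = ≡.refl
  ... | no p  = ⊥-elim (p ≡.refl)

  private
    -- The differential condition needs an index of degree below `r` that bounds the variables. The
    -- descent on `N` finds one, passing over numbers that are not the rank of such an index; if
    -- none is found, `e` has no variables and is a constant of `K`.
    kept-derivative : ∀ N i e → In (λ v → degree v < r × rank v < N) e → ev e ≈ 0# → ev (D i e) ≈ 0#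
    kept-derivative zero i e p z with CongruenceProperties.constant (dual i) e (In-map (λ ()) e p)
    ... | x , (e≈x , De≈∂x) = trans De≈∂x (trans (ι.⟦⟧-cong (K.trans
            (IsDerivation.D-cong (K.isDerivation i) (ι-injective (trans (sym e≈x) z))) (∂-0 i))) ι.0#-homo)
    kept-derivative (suc N) i e p z with em {P = Σ V λ v → degree v < r × rank v ≡ N}
    ... | no none = kept-derivative N i e (In-map (λ {u} (d , s) → d , ℕ.≤∧≢⇒< (ℕ.<⇒≤pred s) (λ q → none (u , d , q))) e p) z
    ... | yes ((σ , k) , d , ≡.refl) = trans (sym (eval′-toPolynomial i e)) (trans (sym
            (∑-partial i (below-unique (σ , k)) (toPolynomial e)
              (VariablesIn-toPolynomial e (In-map (λ {u} (_ , s) → ∈-below u (σ , k) (precedes u s)) e p))))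
            (DC i k σ d (toPolynomial e) (VariablesIn-toPolynomial e (In-map (λ {u} (_ , s) → precedes u s) e p))
              (trans (eval-toPolynomial i e) z)))
      where
      precedes : ∀ u → rank u < suc (rank (σ , k)) → u ⊴ (σ , k)
      precedes u s = rank≤⇒⊴ u (σ , k) (ℕ.<⇒≤pred s)

  D-kernel : ∀ i e → In (λ v → degree v < r) e → ev e ≈ 0# → ev (D i e) ≈ 0#
  D-kernel i e p z with In-bounded rank e
  ... | N , q = kept-derivative N i e (In-∩ e p q) z

  record Quotient (P : Pred V 0ℓ) (x : Carrier) : Set (c ⊔ ℓ₁) where
    constructor quotient
    field
      top bottom : Expr
      In-top     : In P top
      In-bottom  : In P bottom
      bottom≉0   : ¬ ev bottom ≈ 0#
      equation   : x * ev bottom ≈ ev top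

  module _ {P : Pred V 0ℓ} where

    polynomialQuotient : ∀ e {x} → In P e → x ≈ ev e → Quotient P x
    polynomialQuotient e p q = quotient e 𝟙 p tt (λ z → 1≉0 (trans (sym ι.1#-homo) z))
      (trans (*-congˡ ι.1#-homo) (trans (*-identityʳ _) q))

    generatedQuotient : ∀ {x} → Generated (DifferentialField.heytingField K) L ι a P x → Quotient P x
    generatedQuotient (base x)  = polynomialQuotient (con x) tt refl
    generatedQuotient (gen v p) = polynomialQuotient (var v) p refl
    generatedQuotient zer       = polynomialQuotient 𝟘 tt (sym ι.0#-homo)
    generatedQuotient one       = polynomialQuotient 𝟙 tt (sym ι.1#-homo)
    generatedQuotient (resp p x) with generatedQuotient x
    ... | quotient f g s t u q = quotient f g s t u (trans (*-congʳ (sym p)) q)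
    generatedQuotient (neg x) with generatedQuotient x
    ... | quotient f g s t u q = quotient (⊟ f) g s t u (trans (solve 2 (λ x g → :- x :* g := :- (x :* g)) refl _ _) (-‿cong q))
    generatedQuotient (add x y) with generatedQuotient x | generatedQuotient y
    ... | quotient f g s t u q | quotient f′ g′ s′ t′ u′ q′ =
      quotient (f ⊠ g′ ⊞ f′ ⊠ g) (g ⊠ g′) ((s , t′) , (s′ , t)) (t , t′) (*-≉0 u u′)
        (trans (solve 4 (λ x y g g′ → (x :+ y) :* (g :* g′) := x :* g :* g′ :+ y :* g′ :* g) refl _ _ _ _)
               (+-cong (*-congʳ q) (*-congʳ q′)))
    generatedQuotient (mul x y) with generatedQuotient x | generatedQuotient y
    ... | quotient f g s t u q | quotient f′ g′ s′ t′ u′ q′ =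
      quotient (f ⊠ f′) (g ⊠ g′) (s , s′) (t , t′) (*-≉0 u u′)
        (trans (solve 4 (λ x y g g′ → x :* y :* (g :* g′) := x :* g :* (y :* g′)) refl _ _ _ _) (*-cong q q′))
    generatedQuotient (inv {x} {y} z xy≈1) with generatedQuotient z
    ... | quotient f g s t u q = quotient g f t s
          (λ f≈0 → u (trans (sym (trans (*-congʳ xy≈1) (*-identityˡ _)))
            (trans (solve 3 (λ x y g → x :* y :* g := y :* (x :* g)) refl _ _ _) (trans (*-congˡ (trans q f≈0)) (zeroʳ _)))))
          (trans (*-congˡ (sym q)) (trans (solve 3 (λ x y g → y :* (x :* g) := x :* y :* g) refl _ _ _)
            (trans (*-congʳ xy≈1) (*-identityˡ _))))

    ev-generated : ∀ e → In P e → Generated (DifferentialField.heytingField K) L ι a P (ev e)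
    ev-generated (con x) p       = base x
    ev-generated (var v) p       = gen v p
    ev-generated (e ⊞ f) (p , q) = add (ev-generated e p) (ev-generated f q)
    ev-generated (e ⊠ f) (p , q) = mul (ev-generated e p) (ev-generated f q)
    ev-generated (⊟ e)   p       = neg (ev-generated e p)

  -- The trace of a separable minimal polynomial that differentiation preserves: a relation with
  -- leader `t` whose separant is nonzero at `a`, without any minimality of degree.
  record Witness (t : V) : Set (c ⊔ ℓ₁) where
    constructor witness
    field
      relation   : Expr
      In-≤       : In (λ u → rank u ≤ rank t) relation
      vanishes   : ev relation ≈ 0#
      separant≉0 : ¬ ev (∂/∂ t relation) ≈ 0#

  record Linear (t : V) : Set (c ⊔ ℓ₁) where
    constructor linear
    field
      leading    : Expr
      lower      : Expr
      In-leading : In (λ u → degree u < r) leading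
      affine     : Affine r (λ u → degree u ≡ r × rank u < rank t) lower
      leading≉0  : ¬ ev leading ≈ 0#
      equation   : ev leading * a t ≈ ev lower

  private
    degree≤ : ∀ {u t : V} → degree t < r → rank u ≤ rank t → degree u < r
    degree≤ {u} {t} p q = ℕ.≤-<-trans (rank≤⇒degree≤ u t q) p

    rank≤-⁺ : ∀ (u t : V) i → rank u ≤ rank t → rank (u ⁺ i) ≤ rank (t ⁺ i)
    rank≤-⁺ u t i p with ℕ.m≤n⇒m<n∨m≡n p
    ... | inj₁ q = ℕ.<⇒≤ (rank-⁺-mono u t i q)
    ... | inj₂ q = ℕ.≤-reflexive (≡.cong (λ v → rank (v ⁺ i)) (rank-injective u t q))

  -- The derivative of the relation vanishes by `D-kernel`. The relation does not contain `t ⁺ i`,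
  -- so `∂/∂-D` identifies the new separant with the old one.
  Witness-⁺ : ∀ t i → degree t < r → Witness t → Witness (t ⁺ i)
  Witness-⁺ t i d (witness f p z s) = witness (D i f)
    (In-D i (λ {u} q → ℕ.≤-trans q (ℕ.<⇒≤ (rank-<-⁺ t i))) (λ {u} q → rank≤-⁺ u t i q) f p)
    (D-kernel i f (In-map (λ {u} → degree≤ {u} {t} d) f p) z)
    (λ z′ → s (trans (sym (∂/∂-D i t f (In-map
      (λ {u} q u≡ → ℕ.<-irrefl (≡.cong rank u≡) (ℕ.≤-<-trans q (rank-<-⁺ t i))) f p))) z′))

  -- A relation of order below `r` is differentiated and split at `t`: the separant becomes the
  -- leading coefficient, and the remainder is affine in the degree `r` variables `u ⁺ i`, which
  -- precede `t ⁺ i`.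
  Witness⇒Linear : ∀ t i → suc (degree t) ≡ r → Witness t → Linear (t ⁺ i)
  Witness⇒Linear t i ≡.refl (witness f p z s) = linear (∂/∂ t f) (⊟ D∖ i t f)
    (In-∂/∂ t f In-f) (neg (Affine-D∖ r i t f In-f (In-map affine f p))) s
    (-≈0⇒≈ (trans (+-congˡ (solve 1 (λ x → :- (:- x) := x) refl _)) (trans (sym (D-split i t f)) (D-kernel i f In-f z))))
    where
    In-f : In (λ v → degree v < r) f
    In-f = In-map (λ {u} → degree≤ {u} {t} ℕ.≤-refl) f p
    affine : ∀ {u} → rank u ≤ rank t → u ≢ t → degree (u ⁺ i) < r ⊎ (degree (u ⁺ i) ≡ r × rank (u ⁺ i) < rank (t ⁺ i))
    affine {u} q u≢t with ℕ.m≤n⇒m<n∨m≡n (ℕ.≤-trans (ℕ.≤-reflexive (degree-⁺ u i)) (ℕ.s≤s (rank≤⇒degree≤ u t q)))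
    ... | inj₁ d = inj₁ d
    ... | inj₂ d = inj₂ (d , rank-⁺-mono u t i (ℕ.≤∧≢⇒< q (λ e → u≢t (rank-injective u t e))))

  module _ (t : V) where
    private
      F = K⟮ _⊲ t ⟯
      module F = RawRing F
      open Univariate F using (derivative; _⊕_; _⊗_)
      at : List F.Carrier → Carrier
      at = evalAt F rawRing proj₁ (a t)

      ∂≈0 : ∀ e → In (_⊲ t) e → ev (∂/∂ t e) ≈ 0#
      ∂≈0 e p = trans (∂/∂-≈𝟘 t e (In-map (λ {u} q u≡t → ℕ.<-irrefl (≡.cong rank u≡t) (⊲⇒rank< u t q)) e p)) ι.0#-homo

      -- The common denominator `g` and the cleared coefficients involve only indices before `t`. So
      -- `∂/∂ t` acts on `t` alone, and the same `g` serves for `p` and for its derivative.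
      clear : ∀ p → Σ Expr λ f → Σ Expr λ g → In (λ u → rank u ≤ rank t) f × In (_⊲ t) g × ¬ ev g ≈ 0# ×
              ev f ≈ ev g * at p × ev (∂/∂ t f) ≈ ev g * at (derivative p)
      clear [] = 𝟘 , 𝟙 , tt , tt , (λ z → 1≉0 (trans (sym ι.1#-homo) z)) ,
        trans ι.0#-homo (sym (zeroʳ _)) , trans ι.0#-homo (sym (zeroʳ _))
      clear ((x , gx) ∷ p) with clear p | generatedQuotient gx
      ... | f , g , In-f , In-g , g≉0 , f≈ , f′≈ | quotient A B In-A In-B B≉0 xB≈A =
        A ⊠ g ⊞ B ⊠ (var t ⊠ f) , B ⊠ g ,
        ((In-map weaken A In-A , In-map weaken g In-g) , (In-map weaken B In-B , (ℕ.≤-refl , In-f))) ,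
        (In-B , In-g) , *-≉0 B≉0 g≉0 ,
        trans (+-cong (*-congʳ (sym xB≈A)) (*-congˡ (*-congˡ f≈)))
          (solve 5 (λ x B g α e → x :* B :* g :+ B :* (α :* (g :* e)) := B :* g :* (x :+ α :* e)) refl _ _ _ _ _) ,
        trans (+-cong (+-cong (*-congʳ (∂≈0 A In-A)) (*-congˡ (∂≈0 g In-g)))
                (+-cong (*-congʳ (∂≈0 B In-B)) (*-congˡ (+-cong (*-cong (trans (reflexive (≡.cong ev (∂/∂-self t))) ι.1#-homo) f≈) (*-congˡ f′≈)))))
          (trans (solve 7 (λ g A B α e e′ y → (:0 :* g :+ A :* :0) :+ (:0 :* y :+ B :* (:1 :* (g :* e) :+ α :* (g :* e′)))
              := B :* g :* (e :+ (:0 :+ α :* e′))) refl _ _ _ _ _ _ _)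
            (*-congˡ (sym (evalAt-⊕ F commutativeRing proj₁ (λ _ _ → refl) (a t) p (F.0# ∷ derivative p)))))
        where
        weaken : ∀ {u} → u ⊲ t → rank u ≤ rank t
        weaken {u} q = ℕ.<⇒≤ (⊲⇒rank< u t q)

    SeparablyAlgebraic⇒Witness : SeparablyAlgebraic F rawRing proj₁ (a t) → Witness t
    SeparablyAlgebraic⇒Witness (p , minimal , (u , v , up+vp′≋1)) with clear p
    ... | f , g , In-f , In-g , g≉0 , f≈ , f′≈ = witness f In-f
        (trans f≈ (trans (*-congˡ root) (zeroʳ _)))
        (λ z → *-≉0 g≉0 p′≉0 (trans (sym f′≈) z))
      where
      open IsMinimalPolynomial minimal using (root)
      p′≉0 : ¬ at (derivative p) ≈ 0#
      -- Evaluating the Bézout identity of `p` and its derivative at the root `a t` shows that the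
      -- derivative cannot vanish there as well.
      p′≉0 z = 1≉0 (trans (solve 1 (λ x → :1 := :1 :+ x :* :0) refl (a t)) (trans
        (sym (evalAt-cong F commutativeRing proj₁ refl (λ q → q) (a t) (u ⊗ p ⊕ v ⊗ derivative p) (F.1# ∷ []) up+vp′≋1))
        (trans (evalAt-⊕ F commutativeRing proj₁ (λ _ _ → refl) (a t) (u ⊗ p) (v ⊗ derivative p))
          (trans (+-cong (product u p root) (product v (derivative p) z)) (+-identityˡ 0#)))))
        where
        product : ∀ h q → at q ≈ 0# → at (h ⊗ q) ≈ 0#
        product h q z = trans (evalAt-⊗ F commutativeRing proj₁ (λ _ _ → refl) (λ _ _ → refl) refl (a t) h q)
          (trans (*-congˡ z) (zeroʳ _))

    generated⇒SeparablyAlgebraic : Generated (DifferentialField.heytingField K) L ι a (_⊲ t) (a t) →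
                                   SeparablyAlgebraic F rawRing proj₁ (a t)
    generated⇒SeparablyAlgebraic g = linearPolynomial , record
        { monic = (F.- (a t , g)) ∷ [] , ≡.refl
        ; root = solve 1 (λ a → :- a :+ a :* (:1 :+ a :* :0) := :0) refl (a t)
        ; minimal = λ { [] _ _ → []
                      ; (y ∷ []) _ z → trans (solve 2 (λ y a → y := y :+ a :* :0) refl _ _) z ∷ []
                      ; (_ ∷ _ ∷ _) (ℕ.s≤s (ℕ.s≤s ())) _ } }
      -- The Bézout coefficients are 0 and 1: the derivative of the linear polynomial is 1, written
      -- with a trailing zero.
      , [] , F.1# ∷ [] , λ { 0 → solve 0 (:1 :* (:1 :+ :0) :+ :0 := :1) refl ; 1 → solve 0 (:1 :* :0 := :0) refl
                           ; (suc (suc d)) → refl }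
      where
      linearPolynomial : List F.Carrier
      linearPolynomial = (F.- (a t , g)) ∷ F.1# ∷ []

    Linear⇒generated : degree t ≡ r → Linear t → Generated (DifferentialField.heytingField K) L ι a (_⊲ t) (a t)
    Linear⇒generated d (linear s e p q s≉0 eq) with inverse s≉0
    ... | y , ys≈1 = resp
        (trans (*-congˡ (sym eq)) (trans (sym (*-assoc _ _ _)) (trans (*-congʳ ys≈1) (*-identityˡ _))))
        (mul (inv (ev-generated s (In-map (λ {u} → lower u) s p)) (trans (*-comm _ _) ys≈1))
             (ev-generated e (Affine⇒In r (λ {u} (_ , s) → rank<⇒⊲ u t s) (λ {u} → lower u) q)))
      where
      lower : ∀ u → degree u < r → u ⊲ t
      lower u p = rank<⇒⊲ u t (degree<⇒rank< u t (ℕ.<-≤-trans p (ℕ.≤-reflexive (≡.sym d))))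

    Linear⇒SeparableLeader : degree t ≡ r → Linear t → SeparableLeader t
    Linear⇒SeparableLeader d l = ℕ.≤-reflexive d , generated⇒SeparablyAlgebraic (Linear⇒generated d l)

  minimalLeader : ∀ σ k → SeparableLeader (σ , k) → Σ (Vec ℕ (suc m)) λ τ → τ ≤ᵥ σ × MinimalSeparableLeader (τ , k)
  minimalLeader σ k l = go (suc ∣ σ ∣) σ ℕ.≤-refl l
    where
    go : ∀ N σ → ∣ σ ∣ < N → SeparableLeader (σ , k) → Σ (Vec ℕ (suc m)) λ τ → τ ≤ᵥ σ × MinimalSeparableLeader (τ , k)
    go (suc N) σ (ℕ.s≤s p) l with em {P = Σ (Vec ℕ (suc m)) λ ρ → ρ ≤ᵥ σ × ρ ≢ σ × SeparableLeader (ρ , k)}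
    ... | no none = σ , ≤ᵥ-refl , l , λ ρ ρ≤σ ρ≢σ l′ → none (ρ , ρ≤σ , ρ≢σ , l′)
    ... | yes (ρ , ρ≤σ , ρ≢σ , l′) with go N ρ (ℕ.<-≤-trans (ℕ.≤∧≢⇒< (≤ᵥ⇒∣∣≤ ρ≤σ) (λ e → ρ≢σ (≤ᵥ-∣∣≡⇒≡ ρ≤σ e))) p) l′
    ...   | τ , τ≤ρ , minimal = τ , ≤ᵥ-trans τ≤ρ ρ≤σ , minimal

-- The choice of instructions.

module Construction (em : ∀ {a} → ExcludedMiddle a) {c ℓ₁ ℓ₂ m} (K : DifferentialField c ℓ₁ ℓ₂ (suc m)) (n : ℕ)
  (μ : Vec ℕ (suc m)) (E : Extension K n ∣ μ ∣) (DC : Extension.DifferentialCondition E)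
  (leader≤μ : ∀ σ k → Extension.MinimalSeparableLeader E (σ , k) → σ ≤ᵥ μ) where

  private
    r : ℕ
    r = ∣ μ ∣

  open Expressions K n
  open Leaders em K n r E DC
  open Extension E using (ιHom; a; K⟮_⟯)
  open Stages em K n r integralDomain ιHom a
  private
    module L = IntegralDomain integralDomain
    module LS = IntegerSolver L.commutativeRing
    module LP = DomainProperties integralDomain

  boundary : ∀ v → degree v ≡ r → Dec (Linear v) → Instruction v
  boundary v d (no _)  = free (ℕ.≤-reflexive (≡.sym d))
  boundary v d (yes (linear s t p q s≉0 _)) = det (ℕ.≤-reflexive (≡.sym d)) s t (proj₁ (inverse s≉0)) p (proj₂ (inverse s≉0))
    (Affine⇒In r proj₂ (λ {u} l → degree<⇒rank< u v (ℕ.<-≤-trans l (ℕ.≤-reflexive (≡.sym d)))) q)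

  -- D h applied to s x = t is again linear in the new generator, with the same leading coefficient s.
  prolong : ∀ h v → r ≤ degree v → Instruction v → Instruction (v ⁺ h)
  prolong h v p (keep q) = ⊥-elim (ℕ.<⇒≱ q p)
  prolong h v p (free _) = free (ℕ.≤-trans p (ℕ.≤-trans (ℕ.n≤1+n _) (ℕ.≤-reflexive (≡.sym (degree-⁺ v h)))))
  prolong h v p (det _ s t s⁻¹ x y z) =
    det (ℕ.≤-trans p (ℕ.≤-trans (ℕ.n≤1+n _) (ℕ.≤-reflexive (≡.sym (degree-⁺ v h))))) s (D h t ⊞ ⊟ (D h s ⊠ var v)) s⁻¹ x y
      ( In-D h (λ {u} l → ℕ.<-trans l (rank-<-⁺ v h)) (λ {u} → rank-⁺-mono u v h) t z
      , ( In-D h (λ {u} l → degree<⇒rank< u (v ⁺ h) (lower u l)) (λ {u} l → degree<⇒rank< (u ⁺ h) (v ⁺ h) (lower⁺ u l)) s x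
        , rank-<-⁺ v h))
    where
    lower⁺ : ∀ u → degree u < r → degree (u ⁺ h) < degree (v ⁺ h)
    lower⁺ u l = ℕ.≤-trans (ℕ.≤-reflexive (≡.cong suc (degree-⁺ u h)))
      (ℕ.≤-trans (ℕ.s≤s (ℕ.<-≤-trans l p)) (ℕ.≤-reflexive (≡.sym (degree-⁺ v h))))
    lower : ∀ u → degree u < r → degree u < degree (v ⁺ h)
    lower u l = ℕ.<-trans (ℕ.≤-reflexive (≡.sym (degree-⁺ u h))) (lower⁺ u l)

  private
    exceeding : ∀ e {σ : Vec ℕ (suc m)} → ∣ σ ∣ ≡ suc e ℕ.+ r → r < ∣ σ ∣
    exceeding e p = ℕ.≤-trans (ℕ.s≤s (ℕ.m≤n+m r e)) (ℕ.≤-reflexive (≡.sym p))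

    previous : ∀ {e} {τ : Vec ℕ (suc m)} {h} → ∣ τ +ε h ∣ ≡ suc e ℕ.+ r → ∣ τ ∣ ≡ e ℕ.+ r
    previous {τ = τ} {h} p = ℕ.suc-injective (≡.trans (≡.sym (∣+ε∣ τ h)) p)

    above : ∀ e σ k → ∣ σ ∣ ≡ e ℕ.+ r → Instruction (σ , k)
    above zero    σ k p = boundary (σ , k) p em
    above (suc e) σ k p with exceeds μ σ (exceeding e {σ} p)
    ... | h , τ , ≡.refl , _ = prolong h (τ , k)
          (ℕ.≤-trans (ℕ.m≤n+m r e) (ℕ.≤-reflexive (≡.sym (previous {e} {τ} {h} p)))) (above e τ k (previous {e} {τ} {h} p))

    choose : ∀ σ k → Dec (∣ σ ∣ < r) → Instruction (σ , k)
    choose σ k (yes p) = keep p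
    choose σ k (no p)  = above (∣ σ ∣ ℕ.∸ r) σ k (≡.sym (ℕ.m∸n+n≡m (ℕ.≮⇒≥ p)))

  instruction : ∀ v → Instruction v
  instruction (σ , k) = choose σ k (∣ σ ∣ ℕ.<? r)

  private
    -- `instruction` runs `above` on `∣ σ ∣ ∸ r` with its own proof, while the recursion carries
    -- another number and proof. Equations between natural numbers being irrelevant, the results
    -- agree, which makes the recursive step of `above` visible in `instruction`.
    instruction≡above : ∀ e σ k (p : ∣ σ ∣ ≡ e ℕ.+ r) → instruction (σ , k) ≡ above e σ k p
    instruction≡above e σ k p with ∣ σ ∣ ℕ.<? r
    ... | yes q = ⊥-elim (ℕ.<⇒≱ q (ℕ.≤-trans (ℕ.m≤n+m r e) (ℕ.≤-reflexive (≡.sym p))))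
    ... | no q  = irrelevant (≡.trans (≡.cong (ℕ._∸ r) p) (ℕ.m+n∸n≡m e r)) (≡.sym (ℕ.m∸n+n≡m (ℕ.≮⇒≥ q)))
      where
      irrelevant : ∀ {e′} → e′ ≡ e → (p′ : ∣ σ ∣ ≡ e′ ℕ.+ r) → above e′ σ k p′ ≡ above e σ k p
      irrelevant ≡.refl p′ = ≡.cong (above e σ k) (ℕ.≡-irrelevant p′ p)

  instruction-boundary : ∀ v (p : degree v ≡ r) → instruction v ≡ boundary v p em
  instruction-boundary (σ , k) p = instruction≡above 0 σ k p

  -- Records the direction that `above` selected. The inequality at `h` is weak for `τ`, hence
  -- strict for `σ`.
  record Predecessor (σ : Vec ℕ (suc m)) (k : Fin n) : Set (c ⊔ ℓ₁) where
    constructor predecessor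
    field
      h    : Fin (suc m)
      τ    : Vec ℕ (suc m)
      τ+ε  : τ +ε h ≡ σ
      μ≤τ  : lookup μ h ≤ lookup τ h
      r≤τ  : r ≤ ∣ τ ∣
      prolongs : instruction (τ +ε h , k) ≡ prolong h (τ , k) r≤τ (instruction (τ , k))

  findPredecessor : ∀ σ k → r < ∣ σ ∣ → Predecessor σ k
  findPredecessor σ k r<σ = go (∣ σ ∣ ℕ.∸ suc r) σ (≡.sym (≡.trans (≡.sym (ℕ.+-suc _ r)) (ℕ.m∸n+n≡m r<σ)))
    where
    go : ∀ e σ → ∣ σ ∣ ≡ suc e ℕ.+ r → Predecessor σ k
    go e σ p with instruction≡above (suc e) σ k p
    ... | eq with exceeds μ σ (exceeding e {σ} p)
    ...   | h , τ , ≡.refl , q = predecessor h τ ≡.refl q _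
            (≡.trans eq (≡.cong (prolong h (τ , k) _) (≡.sym (instruction≡above e τ k (previous {e} {τ} {h} p)))))

  -- Determined indices and the leaders below them.

  record Det (v : V) : Set (c ⊔ ℓ₁) where
    constructor isDet
    field
      {r≤v} : r ≤ degree v
      {s t} : Expr
      {s⁻¹} : L.Carrier
      {In-s} : In (λ u → degree u < r) s
      {inverseˡ} : s⁻¹ L.* ev s L.≈ L.1#
      {In-t} : In (λ u → rank u < rank v) t
      isDet≡ : instruction v ≡ det r≤v s t s⁻¹ In-s inverseˡ In-t

  Linear⇒Det : ∀ v → degree v ≡ r → Linear v → Det v
  Linear⇒Det v d l with instruction-boundary v d
  ... | eq with em {P = Linear v}
  ...   | yes (linear _ _ _ _ _ _) = isDet eq
  ...   | no ¬l = ⊥-elim (¬l l)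

  Det⇒Linear : ∀ v → degree v ≡ r → Det v → Linear v
  Det⇒Linear v d (isDet eq) with instruction-boundary v d
  ... | eq′ with em {P = Linear v}
  ...   | yes l = l
  ...   | no _ with ≡.trans (≡.sym eq) eq′
  ...     | ()

  Det-prolong : ∀ h v p → instruction (v ⁺ h) ≡ prolong h v p (instruction v) → Det v → Det (v ⁺ h)
  Det-prolong h v p eq (isDet eq′) = isDet (≡.trans eq (≡.cong (prolong h v p) eq′))

  prolong-Det : ∀ h v p → instruction (v ⁺ h) ≡ prolong h v p (instruction v) → Det (v ⁺ h) → Det v
  prolong-Det h v p eq (isDet eq′) with instruction v in eq″
  ... | keep q = ⊥-elim (ℕ.<⇒≱ q p)
  ... | free _ with ≡.trans (≡.sym eq) eq′
  ...   | ()
  prolong-Det h v p eq (isDet eq′) | det _ _ _ _ _ _ _ = isDet eq″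

  -- The leaders that survive in M: those of degree r are kept only if their equation is linear.
  record Good (k : Fin n) (τ : Vec ℕ (suc m)) : Set (c ⊔ ℓ₁) where
    constructor good
    field
      τ≤μ  : τ ≤ᵥ μ
      kind : (∣ τ ∣ < r × Witness (τ , k)) ⊎ (∣ τ ∣ ≡ r × Linear (τ , k))

  -- Predecessors lead down to degree `r`, where a linear equation makes the index a separable
  -- leader. A minimal leader below it either has smaller degree and gives a `Witness`, or is that
  -- index itself, whose equation is linear.
  Det⇒Good : ∀ e σ k → ∣ σ ∣ ≡ e ℕ.+ r → Det (σ , k) → Σ (Vec ℕ (suc m)) λ τ → τ ≤ᵥ σ × Good k τ
  Det⇒Good zero σ k p d with minimalLeader σ k (Linear⇒SeparableLeader (σ , k) p (Det⇒Linear (σ , k) p d))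
  ... | τ , τ≤σ , minimal@((_ , algebraic) , _) with ℕ.m≤n⇒m<n∨m≡n (≤ᵥ⇒∣∣≤ τ≤σ)
  ...   | inj₁ lt = τ , τ≤σ , good (leader≤μ τ k minimal) (inj₁ (ℕ.<-≤-trans lt (ℕ.≤-reflexive p) , SeparablyAlgebraic⇒Witness (τ , k) algebraic))
  ...   | inj₂ eq with ≤ᵥ-∣∣≡⇒≡ τ≤σ eq
  ...     | ≡.refl = σ , ≤ᵥ-refl , good (leader≤μ σ k minimal) (inj₂ (p , Det⇒Linear (σ , k) p d))
  Det⇒Good (suc e) σ k p d with findPredecessor σ k (exceeding e {σ} p)
  ... | predecessor h τ ≡.refl _ r≤τ eq with Det⇒Good e τ k (previous {e} {τ} {h} p) (prolong-Det h (τ , k) r≤τ eq d)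
  ...   | ρ , ρ≤τ , g = ρ , ≤ᵥ-trans ρ≤τ (≤ᵥ-+ε τ h) , g

  Witness-≤ : ∀ N {τ} σ k → ∣ σ ∣ ≡ N → τ ≤ᵥ σ → ∣ σ ∣ < r → Witness (τ , k) → Witness (σ , k)
  Witness-≤ N σ k p τ≤σ lt w with ≤ᵥ⇒≡⊎+ε τ≤σ
  ... | inj₁ ≡.refl = w
  Witness-≤ zero σ k p τ≤σ lt w | inj₂ (i , ρ , ≡.refl , q) with ≡.trans (≡.sym (∣+ε∣ ρ i)) p
  ... | ()
  Witness-≤ (suc N) σ k p τ≤σ lt w | inj₂ (i , ρ , ≡.refl , q) = Witness-⁺ (ρ , k) i ρ<r
      (Witness-≤ N ρ k (ℕ.suc-injective (≡.trans (≡.sym (∣+ε∣ ρ i)) p)) q ρ<r w)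
    where
    ρ<r : ∣ ρ ∣ < r
    ρ<r = ℕ.<-trans (ℕ.≤-reflexive (≡.sym (∣+ε∣ ρ i))) lt

  -- As τ ≤ μ, raising σ in a direction where it already exceeds μ reaches no new leader.
  Good-lower : ∀ {k τ} σ h → Good k τ → τ ≤ᵥ σ +ε h → lookup μ h ≤ lookup σ h → τ ≤ᵥ σ
  Good-lower σ h (good τ≤μ _) p q = ≤ᵥ-+ε-lower σ h p (ℕ.≤-trans (Pointwise.lookup τ≤μ h) q)

  -- The selected predecessor is still above `τ` by `Good-lower`, so the descent ends at an index of
  -- degree `r` above `τ`. Together with `Det⇒Good` this makes the determined indices closed upwards
  -- in all directions, not only in the selected ones.
  Good⇒Det : ∀ e σ k {τ} → ∣ σ ∣ ≡ e ℕ.+ r → τ ≤ᵥ σ → Good k τ → Det (σ , k)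
  Good⇒Det zero σ k p τ≤σ (good _ (inj₂ (q , l))) with ≤ᵥ-∣∣≡⇒≡ τ≤σ (≡.trans q (≡.sym p))
  ... | ≡.refl = Linear⇒Det (σ , k) p l
  Good⇒Det zero σ k p τ≤σ (good _ (inj₁ (lt , w))) with ≤ᵥ⇒≡⊎+ε τ≤σ
  ... | inj₁ ≡.refl = ⊥-elim (ℕ.<-irrefl p lt)
  ... | inj₂ (i , ρ , ≡.refl , q) = Linear⇒Det (ρ +ε i , k) p
          (Witness⇒Linear (ρ , k) i ρ+1≡r (Witness-≤ ∣ ρ ∣ ρ k ≡.refl q (ℕ.≤-reflexive ρ+1≡r) w))
    where
    ρ+1≡r : suc ∣ ρ ∣ ≡ r
    ρ+1≡r = ≡.trans (≡.sym (∣+ε∣ ρ i)) p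
  Good⇒Det (suc e) σ k p τ≤σ g with findPredecessor σ k (exceeding e {σ} p)
  ... | predecessor h ρ ≡.refl μ≤ρ r≤ρ eq =
        Det-prolong h (ρ , k) r≤ρ eq (Good⇒Det e ρ k (previous {e} {ρ} {h} p) (Good-lower ρ h g τ≤σ μ≤ρ) g)

  -- Affine relations pass from `a` to the limit.

  𝔸 : Domain ℓ₁
  𝔸 = limitDomain instruction
  open Domain 𝔸 hiding (zero)
  open DomainProperties (Domain.integralDomain 𝔸)
  open IntegerSolver commutativeRing
  open CongruenceProperties congruence

  det-≈ : ∀ {v} (d : Det v) → Det.s d ⊠ var v ≈ Det.t d
  det-≈ {v} d = det-∼ instruction v (Det.isDet≡ d)

  s≉𝟘 : ∀ {v} (d : Det v) → ¬ Det.s d ≈ 𝟘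
  s≉𝟘 d z = L.1≉0 (L.trans (L.sym (Det.inverseˡ d)) (L.trans (L.*-congˡ (kept-≈0 instruction (Det.s d) (Det.In-s d) z)) (L.zeroʳ _)))

  -- The limit satisfies the equation that `boundary` picked, which may differ from the given one;
  -- hence the fresh `Linear v` in the conclusion.
  Linear⇒≈ : ∀ v → degree v ≡ r → Linear v → Σ (Linear v) λ l → Linear.leading l ⊠ var v ≈ Linear.lower l
  Linear⇒≈ v d l with instruction-boundary v d
  ... | eq with em {P = Linear v}
  ...   | yes l′@(linear _ _ _ _ _ _) = l′ , det-∼ instruction v eq
  ...   | no ¬l = ⊥-elim (¬l l)

  kept-≈𝟘 : ∀ e → In (λ v → degree v < r) e → ev e L.≈ L.0# → e ≈ 𝟘
  kept-≈𝟘 = kept-∼𝟘 instruction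

  private
    -- If `v` has a linear equation `s x = t`, multiplication by `s` and substitution of `t` remove
    -- `v` while keeping the expression affine. Otherwise the slope in `v` vanishes at `a`, for it
    -- would yield such an equation, and only the rest remains.
    affine-step : ∀ v → degree v ≡ r →
      (∀ {e} → Affine r (λ u → degree u ≡ r × rank u < rank v) e → ev e L.≈ L.0# → e ≈ 𝟘) →
      ∀ {e} → Affine r (λ u → degree u ≡ r × rank u ≤ rank v) e → ev e L.≈ L.0# → e ≈ 𝟘
    affine-step v d affine-< {e} A z = cases em
      where
      lower : Affine r (λ u → degree u ≡ r × rank u < rank v) (rest r v A)
      lower = Affine-rest r v (λ {u} (d′ , l′) u≢v → d′ , ℕ.≤∧≢⇒< l′ (λ q → u≢v (rank-injective u v q))) A

      split : ev (rest r v A) L.+ ev (slope r v A) L.* a v L.≈ L.0#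
      split = L.trans (L.sym (Affine-split r v kernel A)) z

      cases : Dec (Linear v) → e ≈ 𝟘
      cases (yes l) with Linear⇒≈ v d l
      ... | linear s t In-s At s≉0 sa≈t , sv≈t = cancel-≈0 {s} {e} (λ q → s≉0 (kept-≈0 instruction s In-s q))
        (trans (*-congˡ (Affine-split r v congruence A))
          (trans (trans (solve 4 (λ s p q x → s :* (p :+ q :* x) := s :* p :+ q :* (s :* x)) refl _ _ _ _) (+-congˡ (*-congˡ sv≈t)))
            (affine-< (add (mulˡ In-s lower) (mulˡ (In-slope r v A) At))
              (L.trans (L.+-congˡ (L.*-congˡ (L.sym sa≈t)))
                (L.trans (LS.solve 4 (λ s p q x → s LS.:* p LS.:+ q LS.:* (s LS.:* x) LS.:= s LS.:* (p LS.:+ q LS.:* x)) L.refl _ _ _ _)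
                  (L.trans (L.*-congˡ split) (L.zeroʳ _)))))))
      cases (no ¬l) with em {P = ev (slope r v A) L.≈ L.0#}
      ... | no q≉0 = ⊥-elim (¬l (linear (slope r v A) (⊟ rest r v A) (In-slope r v A) (neg lower) q≉0
              (LP.-≈0⇒≈ (L.trans (LS.solve 2 (λ x y → x LS.:- LS.:- y LS.:= y LS.:+ x) L.refl _ _) split))))
      ... | yes q≈0 = trans (Affine-split r v congruence A) (trans (+-cong
              (affine-< lower (L.trans (L.sym (L.trans (L.+-congˡ (L.trans (L.*-congʳ q≈0) (L.zeroˡ _))) (L.+-identityʳ _))) split))
              (trans (*-congʳ (kept-≈𝟘 _ (In-slope r v A) q≈0)) (zeroˡ _))) (+-identityˡ 𝟘))

  affine-≈𝟘 : ∀ N {e} → Affine r (λ u → degree u ≡ r × rank u < N) e → ev e L.≈ L.0# → e ≈ 𝟘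
  affine-≈𝟘 zero {e} A z = kept-≈𝟘 e (Affine⇒In r (λ ()) id A) z
  affine-≈𝟘 (suc N) {e} A z with em {P = Σ V λ v → degree v ≡ r × rank v ≡ N}
  ... | no none = affine-≈𝟘 N (Affine-map r (λ {u} (d , l) → d , ℕ.≤∧≢⇒< (ℕ.<⇒≤pred l) (λ q → none (u , d , q))) A) z
  ... | yes (v , d , q) = affine-step v d
        (λ B → affine-≈𝟘 N (Affine-map r (λ {u} (d , l) → d , ℕ.<-≤-trans l (ℕ.≤-reflexive q)) B))
        (Affine-map r (λ {u} (d , l) → d , ℕ.≤-trans (ℕ.<⇒≤pred l) (ℕ.≤-reflexive (≡.sym q))) A) z

  -- The derivative vanishes at `a` by the differential condition. It may involve degree `r`, where
  -- the limit has lost relations of `a`, but it is affine and so survives.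
  D-kept : ∀ i e → In (λ v → degree v < r) e → e ≈ 𝟘 → D i e ≈ 𝟘
  D-kept i e p z with In-bounded (λ u → rank (u ⁺ i)) e
  ... | N , q = affine-≈𝟘 N (Affine-D r i e p (In-map (λ {u} (d , l) → cases u d l) e (In-∩ e p q)))
                  (D-kernel i e p (kept-≈0 instruction e p z))
    where
    cases : ∀ u → degree u < r → rank (u ⁺ i) < N → degree (u ⁺ i) < r ⊎ (degree (u ⁺ i) ≡ r × rank (u ⁺ i) < N)
    cases u d l with ℕ.m≤n⇒m<n∨m≡n (ℕ.≤-trans (ℕ.≤-reflexive (degree-⁺ u i)) d)
    ... | inj₁ d′ = inj₁ d′
    ... | inj₂ d′ = inj₂ (d′ , l)

  -- Closure of the ideal under the derivations.

  Closed : Fin (suc m) → Pred V 0ℓ → Set (c ⊔ ℓ₁)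
  Closed i P = ∀ e → In P e → e ≈ 𝟘 → D i e ≈ 𝟘

  private
    -- The bound is on `u ⁺ i`, the new variables in `D i e`, and holds for every `i`: thus both
    -- `D h` and `D i` may be applied to a relation at the bottom of a square while the value at its
    -- top is still in question.
    Hypothesis : ℕ → Set (c ⊔ ℓ₁)
    Hypothesis N = ∀ i → Closed i (λ u → rank (u ⁺ i) < N)

    below-closed : ∀ i v → Hypothesis (rank (v ⁺ i)) → Closed i (λ u → rank u < rank v)
    below-closed i v H e p = H i e (In-map (λ {u} → rank-⁺-mono u v i) e p)

    Upto : V → Pred V 0ℓ
    Upto v u = u ≢ v → rank u < rank v

    closed-free : ∀ i v → Hypothesis (rank (v ⁺ i)) → ∀ {q} → instruction v ≡ free q → Closed i (Upto v)
    closed-free i v H eq e p e≈𝟘 = ExtendDerivation.extend-free 𝔸 i (λ u → rank u < rank v) v (below-closed i v H)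
      e p (free-expand instruction v eq e p e≈𝟘)

    -- The equation at `v ⁺ h` is by construction the `D h`-derivative of the one at `v`, so the
    -- latter holds in the dual numbers. If `v` is free there is nothing for its derivative to
    -- satisfy.
    closed-defining : ∀ h v (p : r ≤ degree v) → Hypothesis (rank (v ⁺ h)) →
                      instruction (v ⁺ h) ≡ prolong h v p (instruction v) → Closed h (Upto v)
    closed-defining h v p H eq with instruction v in eq′
    ... | keep q = ⊥-elim (ℕ.<⇒≱ q p)
    ... | free q = closed-free h v H eq′
    ... | det q s t s⁻¹ x y z = ExtendDerivation.extend-rational 𝔸 h (λ u → rank u < rank v) v (below-closed h v H)
          s t (In-map (λ {u} l → degree<⇒rank< u v (ℕ.<-≤-trans l p)) s x) z (s≉𝟘 d)
          (det-≈ d , trans (+-congˡ (det-≈ (isDet eq)))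
            (solve 2 (λ a b → a :+ (b :- a) := b) refl _ _))
      where
      d : Det v
      d = isDet eq′

    -- What coherence requires at the bottom corner of a square. It comes from a `Witness` below
    -- degree `r` and from the defining equation in higher degrees.
    record Relation (t : V) : Set (c ⊔ ℓ₁) where
      constructor relation
      field
        f          : Expr
        In-f       : In (λ u → rank u ≤ rank t) f
        f≈𝟘        : f ≈ 𝟘
        separant≉𝟘 : ¬ ∂/∂ t f ≈ 𝟘

    Witness⇒Relation : ∀ t → degree t < r → Witness t → Relation t
    Witness⇒Relation t d (witness f p z s) = relation f p (kept-≈𝟘 f In-f z)
        (λ q → s (kept-≈0 instruction (∂/∂ t f) (In-∂/∂ t f In-f) q))
      where
      In-f : In (λ u → degree u < r) f
      In-f = In-map (λ {u} l → ℕ.≤-<-trans (rank≤⇒degree≤ u t l) d) f p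

    Det⇒Relation : ∀ t → Det t → Relation t
    Det⇒Relation v d@(isDet {q} {s} {t} {s⁻¹} {x} {y} {z} _) = relation (s ⊠ var v ⊞ ⊟ t)
        ((In-map (λ {u} l → ℕ.<⇒≤ (s-below u l)) s x , ℕ.≤-refl) , In-map (λ {u} → ℕ.<⇒≤) t z)
        (≈⇒-≈0 (det-≈ d))
        (λ w → s≉𝟘 d (trans (sym separant) w))
      where
      s-below : ∀ u → degree u < r → rank u < rank v
      s-below u l = degree<⇒rank< u v (ℕ.<-≤-trans l q)
      other : ∀ u → rank u < rank v → u ≢ v
      other u l u≡v = ℕ.<-irrefl (≡.cong rank u≡v) l
      separant : ∂/∂ v (s ⊠ var v ⊞ ⊟ t) ≈ s
      separant = trans
        (+-cong (+-cong (*-congʳ (∂/∂-≈𝟘 v s (In-map (λ {u} l → other u (s-below u l)) s x)))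
                        (*-congˡ (reflexive (∂/∂-self v))))
                (-‿cong (∂/∂-≈𝟘 v t (In-map (λ {u} → other u) t z))))
        (solve 2 (λ s x → :0 :* x :+ s :* :1 :- :0 := s) refl s (var v))

    leader-Relation : ∀ ρ k {τ} → τ ≤ᵥ ρ → Good k τ → Relation (ρ , k)
    leader-Relation ρ k τ≤ρ g with ∣ ρ ∣ ℕ.<? r
    ... | no ρ≮r = Det⇒Relation (ρ , k) (Good⇒Det (∣ ρ ∣ ℕ.∸ r) ρ k (≡.sym (ℕ.m∸n+n≡m (ℕ.≮⇒≥ ρ≮r))) τ≤ρ g)
    ... | yes ρ<r with Good.kind g
    ...   | inj₁ (_ , w) = Witness⇒Relation (ρ , k) ρ<r (Witness-≤ ∣ ρ ∣ ρ k ≡.refl τ≤ρ ρ<r w)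
    ...   | inj₂ (q , _) = ⊥-elim (ℕ.<-irrefl (≡.trans q ≡.refl) (ℕ.≤-<-trans (≤ᵥ⇒∣∣≤ τ≤ρ) ρ<r))

    -- D i (D h f) = D h (D i f) forces the value of D i at t ⁺ h, since D h f is linear in t ⁺ h.
    closed-coherent : ∀ i h t → Relation t → Hypothesis (rank (t ⁺ h ⁺ i)) → Closed h (Upto (t ⁺ i)) → Closed i (Upto (t ⁺ h))
    closed-coherent i h t (relation f p f≈𝟘 s≉) H closed-h =
      ExtendDerivation.extend-rational 𝔸 i (λ u → rank u < rank v) v (below-closed i v H)
        (∂/∂ t f) (⊟ D∖ h t f) (In-map (λ {u} → below-v u) (∂/∂ t f) (In-∂/∂ t f p))
        (In-D∖ h t (λ {u} → below-v u) (λ {u} l u≢t → rank-⁺-mono u t h (ℕ.≤∧≢⇒< l (λ q → u≢t (rank-injective u t q)))) f p)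
        s≉
        -- `D-split` in the dual numbers reads the vanishing of `D h f` as a linear equation for
        -- `t ⁺ h` with the separant as coefficient.
        (A₁.trans (S₁.solve 2 (λ a b → a S₁.:= (a S₁.:+ b) S₁.:- b) A₁.refl (∂/∂ t f ⊠ var v) (D∖ h t f))
          (A₁.trans (A₁.+-congʳ {⊟ D∖ h t f} (A₁.trans (A₁.sym (CongruenceProperties.D-split (dual i) h t f)) Dhf≈₁𝟘))
                    (A₁.+-identityˡ (⊟ D∖ h t f))))
      where
      v = t ⁺ h
      module A₁ = Congruence (dual i)
      module S₁ = IntegerSolver A₁.commutativeRing
      below-v : ∀ u → rank u ≤ rank t → rank u < rank v
      below-v u l = ℕ.≤-<-trans l (rank-<-⁺ t h)
      rank≤-⁺ : ∀ j u → rank u ≤ rank t → rank (u ⁺ j) ≤ rank (t ⁺ j)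
      rank≤-⁺ j u l with ℕ.m≤n⇒m<n∨m≡n l
      ... | inj₁ l′ = ℕ.<⇒≤ (rank-⁺-mono u t j l′)
      ... | inj₂ q  = ℕ.≤-reflexive (≡.cong (λ w → rank (w ⁺ j)) (rank-injective u t q))
      Dhf≈𝟘 : D h f ≈ 𝟘
      Dhf≈𝟘 = H h f (In-map (λ {u} l → ℕ.≤-<-trans (rank≤-⁺ h u l) (rank-<-⁺ (t ⁺ h) i)) f p) f≈𝟘
      Dif≈𝟘 : D i f ≈ 𝟘
      Dif≈𝟘 = H i f (In-map (λ {u} l → ℕ.≤-<-trans (rank≤-⁺ i u l)
        (ℕ.<-≤-trans (rank-<-⁺ (t ⁺ i) h) (ℕ.≤-reflexive (≡.cong rank (⁺-comm t i h))))) f p) f≈𝟘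
      In-Dif : In (Upto (t ⁺ i)) (D i f)
      In-Dif = In-D i (λ {u} l _ → ℕ.≤-<-trans l (rank-<-⁺ t i))
        (λ {u} l u≢ → ℕ.≤∧≢⇒< (rank≤-⁺ i u l) (λ q → u≢ (rank-injective (u ⁺ i) (t ⁺ i) q))) f p
      Dhf≈₁𝟘 : D h f A₁.≈ 𝟘
      -- The ε-part `D i (D h f)` is exchanged for `D h (D i f)`. The variables of `D i f` reach at
      -- most `t ⁺ i`, where closure under `D h` is already available.
      Dhf≈₁𝟘 = Dhf≈𝟘 , trans (D-comm i h f) (trans (closed-h (D i f) In-Dif Dif≈𝟘) (sym (con-cong (∂-0 i))))

    closed-step : ∀ i v → Hypothesis (rank (v ⁺ i)) → Closed i (Upto v)
    closed-step i v@(σ , k) H e p e≈𝟘 with ∣ σ ∣ ℕ.<? r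
    ... | yes d = D-kept i e (In-map (λ {u} q → kept u q) e p) e≈𝟘
      where
      kept : ∀ u → Upto v u → degree u < r
      kept u q with u ≟ᵢ v
      ... | yes ≡.refl = d
      ... | no u≢v = ℕ.≤-<-trans (rank≤⇒degree≤ u v (ℕ.<⇒≤ (q u≢v))) d
    ... | no σ≮r with instruction v in eq
    ...   | keep q = ⊥-elim (σ≮r q)
    ...   | free q = closed-free i v H eq e p e≈𝟘
    -- The generator at `v ⁺ i` was built from its own predecessor, which is `v` only if the
    -- selected direction `h` is `i`.
    ...   | det _ _ _ _ _ _ _ with findPredecessor (σ +ε i) k (ℕ.<-≤-trans (ℕ.s≤s (ℕ.≮⇒≥ σ≮r)) (ℕ.≤-reflexive (≡.sym (∣+ε∣ σ i))))
    ...     | predecessor h τ τ+ε μ≤τ r≤τ prolongs with i Fin.≟ h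
    ...       | yes ≡.refl with +ε-injective i τ+ε
    ...         | ≡.refl = closed-defining i v r≤τ H prolongs e p e≈𝟘
    closed-step i v@(σ , k) H e p e≈𝟘 | no σ≮r | det _ _ _ _ _ _ _ | predecessor h τ τ+ε μ≤τ r≤τ prolongs | no i≢h
      -- Here `v` is `ρ ⁺ h` and the selected predecessor is `ρ ⁺ i`. The leader below `v` lies
      -- below `ρ` as well, because `ρ` at `h` is already at least `μ` at `h`.
      with +ε-diamond σ τ i≢h (≡.sym τ+ε) | Det⇒Good (∣ σ ∣ ℕ.∸ r) σ k (≡.sym (ℕ.m∸n+n≡m (ℕ.≮⇒≥ σ≮r))) (isDet eq)
    ... | ρ , ≡.refl , ≡.refl | π , π≤σ , g =
      closed-coherent i h (ρ , k) (leader-Relation ρ k (Good-lower ρ h g π≤σ μ≤ρ) g) H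
        (closed-defining h (ρ +ε i , k) r≤τ (λ j → ≡.subst (λ w → Closed j (λ u → rank (u ⁺ j) < rank (w , k))) (≡.sym τ+ε) (H j)) prolongs) e p e≈𝟘
      where
      μ≤ρ : lookup μ h ≤ lookup ρ h
      μ≤ρ = ℕ.≤-trans μ≤τ (ℕ.≤-reflexive (lookup∘updateAt′ h i (λ h≡i → i≢h (≡.sym h≡i)) ρ))

    closed-< : ∀ N → Hypothesis N
    -- No variable satisfies the bound, so `e` has order below `r` vacuously.
    closed-< zero i e p e≈𝟘 = D-kept i e (In-map (λ ()) e p) e≈𝟘
    closed-< (suc N) i e p e≈𝟘 with em {P = Σ V λ v → rank (v ⁺ i) ≡ N}
    ... | no none = closed-< N i e (In-map (λ {u} l → ℕ.≤∧≢⇒< (ℕ.<⇒≤pred l) (λ q → none (u , q))) e p) e≈𝟘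
    ... | yes (v , q) = closed-step i v (λ j → ≡.subst (λ M → Closed j (λ u → rank (u ⁺ j) < M)) (≡.sym q) (closed-< N j)) e
          (In-map (λ {u} l u≢v → rank-⁺-reflect u v i (ℕ.≤∧≢⇒< (ℕ.≤-trans (ℕ.<⇒≤pred l) (ℕ.≤-reflexive (≡.sym q)))
            (λ q′ → u≢v (⁺-injective i (rank-injective (u ⁺ i) (v ⁺ i) q′))))) e p) e≈𝟘

  D-≈𝟘 : ∀ i e → e ≈ 𝟘 → D i e ≈ 𝟘
  D-≈𝟘 i e e≈𝟘 with In-bounded (λ u → rank (u ⁺ i)) e
  ... | N , p = closed-< N i e p e≈𝟘

  D-cong : ∀ i {e f} → e ≈ f → D i e ≈ D i f
  D-cong i {e} {f} e≈f = -≈0⇒≈ (D-≈𝟘 i (e ⊞ ⊟ f) (≈⇒-≈0 e≈f))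

  -- The differential field and the embedding.

  open FractionField ℓ₂ (Domain.integralDomain 𝔸) em

  M : DifferentialField (c ⊔ ℓ₁ ⊔ ℓ₂) (c ⊔ ℓ₁ ⊔ ℓ₂) (c ⊔ ℓ₁ ⊔ ℓ₂) (suc m)
  M = record
    { heytingField = fractionField
    ; ∂ = derivation
    ; isDerivation = isDerivation
    ; ∂-comm = λ i j → derivations-commute (isDerivation i) (isDerivation j) (λ e → M.trans
        (IsDerivation.D-cong (isDerivation i) (quotientRule-embed′ j e)) (M.trans (quotientRule-embed′ i (D j e))
        (M.trans (cross (*-congʳ (D-comm i j e))) (M.sym (M.trans
        (IsDerivation.D-cong (isDerivation j) (quotientRule-embed′ i e)) (quotientRule-embed′ j (D i e)))))))
    }
    where
    module M = Field fractionField
    derivation : Fin (suc m) → Fraction → Fraction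
    derivation i = quotientRule (D i) (D-cong i) (λ _ _ → refl) (λ _ _ → refl)
    quotientRule-embed′ : ∀ i e → derivation i (embed e) ≃ embed (D i e)
    quotientRule-embed′ i = quotientRule-embed (D i) (D-cong i) (λ _ _ → refl) (λ _ _ → refl)
    isDerivation : ∀ i → IsDerivation fractionField (derivation i)
    isDerivation i = quotientRule-isDerivation (D i) (D-cong i) (λ _ _ → refl) (λ _ _ → refl)

  private module M = DifferentialField M

  K⟮a⟯ : RawRing (c ⊔ ℓ₁) ℓ₁
  K⟮a⟯ = K⟮ (λ v → degree v < r) ⟯
  private module K⟮a⟯ = RawRing K⟮a⟯

  toFraction : ∀ {x} → Quotient (λ v → degree v < r) x → Fraction
  toFraction (quotient f g _ p g≉0 _) = f / g [ (λ q → g≉0 (kept-≈0 instruction g p q)) ]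

  -- The cross-multiplied equation has order below `r`, where every relation of `a` holds in the
  -- limit. So the image of an element depends neither on its representation as a quotient nor on
  -- its derivation in `Generated`.
  toFraction-unique : ∀ {x y} (p : Quotient (λ v → degree v < r) x) (q : Quotient (λ v → degree v < r) y) →
                      x L.≈ y → toFraction p ≃ toFraction q
  toFraction-unique {x} {y} (quotient f g s t _ e) (quotient f′ g′ s′ t′ _ e′) x≈y = cross (-≈0⇒≈
    (kept-≈𝟘 (f ⊠ g′ ⊞ ⊟ (f′ ⊠ g)) ((s , t′) , (s′ , t)) (LP.≈⇒-≈0
      (L.trans (L.*-congʳ (L.trans (L.sym e) (L.*-congʳ x≈y))) (L.trans
        (LS.solve 3 (λ y g g′ → y LS.:* g LS.:* g′ LS.:= (y LS.:* g′) LS.:* g) L.refl _ _ _) (L.*-congʳ e′))))))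

  compatibleExtension : CompatibleExtension K E
  compatibleExtension = record
    { M = M
    ; jHom = mkRingHomomorphism K.rawRing M.rawRing (embed ∘ con)
        (λ p → cross (*-congʳ (con-cong p)))
        (λ x y → cross (trans (*-congʳ (con-+ x y)) (solve 2 (λ x y → (x :+ y) :* (:1 :* :1) := (x :* :1 :+ y :* :1) :* :1) refl _ _)))
        (λ x y → cross (trans (*-congʳ (con-* x y)) (solve 2 (λ x y → (x :* y) :* (:1 :* :1) := (x :* y) :* :1) refl _ _)))
        (λ x → cross (*-congʳ (con-neg x))) M.refl M.refl
    ; φHom = mkRingHomomorphism K⟮a⟯ M.rawRing (λ (_ , g) → toFraction (generatedQuotient g))
        (λ {x} {y} → toFraction-unique (generatedQuotient (proj₂ x)) (generatedQuotient (proj₂ y)))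
        -- `generatedQuotient` combines numerators and denominators by the same formulas as the
        -- fraction field, so the homomorphism laws hold by computation.
        (λ (_ , g) (_ , h) → cross refl)
        (λ (_ , g) (_ , h) → cross refl)
        (λ (_ , g) → cross refl)
        M.refl M.refl
    ; extends = λ i x → cross (cross-multiplied (quotientRule-embed (D i) (D-cong i) (λ _ _ → refl) (λ _ _ → refl) (con x)))
    ; over-K = λ x → cross refl
    ; compatible = λ i k σ p → M.trans
        (cross (cross-multiplied (quotientRule-embed (D i) (D-cong i) (λ _ _ → refl) (λ _ _ → refl) (var (σ , k)))))
        (toFraction-unique (polynomialQuotient (var (σ +ε i , k)) (≡.subst (_< r) (≡.sym (∣+ε∣ σ i)) p) L.refl)
          (polynomialQuotient (var (σ +ε i , k)) (≡.subst (_< r) (≡.sym (∣+ε∣ σ i)) p) L.refl) L.refl)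
    }

theorem4p7 : (∀ {a} → ExcludedMiddle a) →
    ∀ {c ℓ₁ ℓ₂} (m n : ℕ) .{{_ : NonZero n}} (K : DifferentialField c ℓ₁ ℓ₂ (suc m)) (μ : Vec ℕ (suc m)) (E : Extension K n ∣ μ ∣) →
    Extension.DifferentialCondition E →
    (∀ (σ : Vec ℕ (suc m)) (k : Fin n) → Extension.MinimalSeparableLeader E (σ , k) → σ ≤ᵥ μ) →
    CompatibleExtension K E
theorem4p7 em m n K μ E DC leader≤μ = Construction.compatibleExtension em K n μ E DC leader≤μ
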